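{- In the incidence Hopf algebra $\mathcal I$, for all $k,l\ge0$ and $o\in\{0,1\}$ such that $P_{k+l,k,o}$ is defined, one has $$\Delta\Big(\frac{[P_{k+l,k,o}]}{l!\,(k-o)!}\Big)=\sum_{\substack{p,q\ge0,\ p+q\ge1\\ p\ge o}}\ \sum_{(l_i),(k_i)}\ \prod_{i=1}^{p}\frac{[P_{l_i+k_i,k_i,1}]}{l_i!\,(k_i-1)!}\prod_{i=p+1}^{p+q}\frac{[P_{l_i+k_i,k_i,0}]}{l_i!\,k_i!}\otimes\frac{[P_{p+q,p,o}]}{q!\,(p-o)!}.$$ The inner sum runs over all tuples $(l_1,\dots,l_{p+q})$ and $(k_1,\dots,k_{p+q})$ of integers such that: - $l_1,\dots,l_p\ge0$ and $l_{p+1},\dots,l_{p+q}\ge1$, with $\sum l_i=l$; - $k_1,\dots,k_p\ge1$ and $k_{p+1},\dots,k_{p+q}\ge0$, with $\sum k_i=k$.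
   Context: Let $V_1,V_2$ be disjoint finite sets, $V=V_1\sqcup V_2$. A semi-pointed partition of $(V_1,V_2)$ is a set partition of $V$ into nonempty blocks in which each block $B$ is either unpointed or pointed at one chosen element of $B\cap V_1$, subject to: a block contained in $V_1$ must be pointed, and a block contained in $V_2$ must be unpointed. $\Pi(V_1,V_2)$ is the set of semi-pointed partitions, ordered by: $P\le Q$ iff every block $b$ of $P$ is a union $q_1\cup\dots\cup q_r$ of blocks of $Q$, and if $b$ is pointed at $e$ then some $q_i$ is pointed at $e$, while if $b$ is unpointed then some $q_i$ is unpointed. Its greatest element is the partition into singletons. $\Pi_{n,p}:=\Pi(\{1,\dots,p\},\{p+1,\dots,n\})$. For $n\ge1$, $0\le p\le n$ and $o\in\{0,1\}$ define $P_{n,p,o}$: - $P_{n,p,1}$ (defined when $p\ge1$) is the dual (order-reversed) poset of the maximal interval of $\Pi_{n,p}$ whose least element is the block $\{1,\dots,n\}$ pointed at $1$; - $P_{n,p,0}$ (defined when $p<n$) is the dual of the maximal interval whose least element is the unpointed block $\{1,\dots,n\}$. In the dual, the least element is the partition into singletons and the greatest element is the one-block partition. Let $\mathcal F$ be the family of finite direct products of such posets; it is closed under taking intervals. Two posets of $\mathcal F$ are identified when they are isomorphic through an isomorphism preserving the numbers of pointed and unpointed blocks of their least and greatest elements, and all one-element posets are identified with the unit. $\mathcal I$ is Schmitt's incidence Hopf algebra over $\mathbb Q$: it has basis the classes $[P]$, the product is induced by direct product (so $[P\times Q]=[P][Q]$), the unit is the class of one-element posets, and $\Delta[P]=\sum_{x\in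 P}[\hat0_P,x]\otimes[x,\hat1_P]$. In particular $[P_{1,1,1}]=[P_{1,0,0}]=1$.
   Formalization: The sum is restricted to pairs (p,q) for which P_{p+q,p,o} is defined; for o=0 this omits the terms with q=0, which would involve the undefined class [P_{p,p,0}]. -}

module Defs where

open import Data.Bool using (Bool; true; false; T)
import Data.Bool.Properties as Bool
open import Data.Fin using (Fin; zero; suc; toℕ; fromℕ<; _↑ˡ_; _↑ʳ_)
import Data.Fin.Properties as Fin
open import Data.Fin.Subset using (Subset; _∈_; _⊆_; ⁅_⁆; _∩_; ∁; ⊤)
open import Data.Fin.Subset.Properties using (_∈?_; _⊆?_; ⊆-antisym; x∈⁅x⁆; x∈⁅y⁆⇒x≡y; ∈⊤; x∈p∩q⁺; x∈∁p⇒x∉p)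
import Data.Integer as ℤ
open import Data.Irrelevant using ([_])
open import Data.List as List using (List; []; _∷_; _++_; map; concatMap; foldr; filter; deduplicate; length; cartesianProduct; cartesianProductWith; upTo; allFin)
open import Data.List.Membership.Propositional using () renaming (_∈_ to _∈ₗ_)
open import Data.List.Membership.Propositional.Properties using (∈-cartesianProductWith⁺; ∈-cartesianProduct⁺; ∈-map⁺; ∈-map⁻; ∈-concat⁺′; ∈-allFin; ∈-upTo⁺)
open import Data.List.Relation.Binary.Disjoint.Propositional using (Disjoint)
open import Data.List.Relation.Unary.All as All using (All; []; _∷_)
import Data.List.Relation.Unary.All.Properties as All
open import Data.List.Relation.Unary.AllPairs as AllPairs using (AllPairs; []; _∷_)
import Data.List.Relation.Unary.AllPairs.Properties as AllPairs
open import Data.List.Relation.Unary.Any using (here; there)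
open import Data.List.Relation.Unary.Unique.Propositional using (Unique)
import Data.List.Relation.Unary.Unique.Propositional.Properties as Unique
open import Data.Maybe using (Maybe; just; nothing)
import Data.Maybe.Properties as Maybe
open import Data.Nat as ℕ using (ℕ; zero; suc; _+_; _∸_; _≤_; _<_; _≤?_; _<?_; _!; z≤n; s≤s)
import Data.Nat.Properties as ℕ
open import Data.Nat.Properties using (_!≢0)
open import Data.Product using (Σ; ∃-syntax; _×_; _,_; proj₁; proj₂)
import Data.Product.Properties as Product
open import Data.Product.Relation.Binary.Pointwise.NonDependent using (×-setoid)
open import Data.Rational as ℚ using (ℚ; 0ℚ; 1ℚ)
open import Data.Refinement using (Refinement; _,_; value; proof; value-injective)
open import Data.Unit using (tt) renaming (⊤ to Unit)
open import Data.Vec as Vec using (Vec; []; _∷_; lookup; tabulate; replicate; toList)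
import Data.Vec.Properties as Vec
open import Function using (_∘_; flip)
open import Level using (0ℓ)
open import Relation.Binary using (Rel; Setoid; DecidableEquality; IsDecPartialOrder; Minimum; Maximum)
open import Relation.Binary.Morphism.Structures using (IsOrderIsomorphism)
open import Relation.Binary.PropositionalEquality using (_≡_; _≢_; refl; sym; trans; cong; cong₂; subst; isEquivalence)
open import Relation.Nullary using (Dec; yes; no; contradiction; ¬?; _×-dec_; _→-dec_)
open import Relation.Nullary.Decidable using (does; recompute; map′; dec-true)
open import Relation.Unary using (Decidable)

record Finite (A : Set) : Set where
  field
    elements : List A
    complete : ∀ x → x ∈ₗ elements
    unique   : Unique elements

open Finite public

module _ {A : Set} where

  vectors : List A → ∀ n → List (Vec A n)
  vectors xs zero    = [] ∷ []
  vectors xs (suc n) = cartesianProductWith _∷_ xs (vectors xs n)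

  vectors-unique : ∀ {xs} → Unique xs → ∀ n → Unique (vectors xs n)
  vectors-unique u zero    = [] ∷ []
  vectors-unique u (suc n) = Unique.cartesianProductWith⁺ _∷_ Vec.∷-injective u (vectors-unique u n)

  vectors-complete : ∀ {xs n} (v : Vec A n) → (∀ i → lookup v i ∈ₗ xs) → v ∈ₗ vectors xs n
  vectors-complete []      h = here refl
  vectors-complete (x ∷ v) h = ∈-cartesianProductWith⁺ _∷_ (h zero) (vectors-complete v (h ∘ suc))

module _ {A : Set} {Q : A → Set} (Q? : Decidable Q) where

  refineList : List A → List (Refinement A Q)
  refineList [] = []
  refineList (x ∷ xs) with Q? x
  ... | yes q = (x , [ q ]) ∷ refineList xs
  ... | no  _ = refineList xs

  refineList-complete : ∀ {xs} (x : Refinement A Q) → value x ∈ₗ xs → x ∈ₗ refineList xs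
  refineList-complete {y ∷ ys} x x∈ with Q? y
  refineList-complete {y ∷ ys} x (here eq) | yes q = here (value-injective eq)
  refineList-complete {y ∷ ys} x (there i) | yes q = there (refineList-complete x i)
  refineList-complete {y ∷ ys} (x , [ q ]) (here refl) | no ¬q = contradiction (recompute (Q? x) q) ¬q
  refineList-complete {y ∷ ys} x (there i) | no ¬q = refineList-complete x i

  refineList-all : ∀ {R : A → Set} {xs} → All R xs → All (R ∘ value) (refineList xs)
  refineList-all [] = []
  refineList-all {xs = x ∷ _} (r ∷ rs) with Q? x
  ... | yes _ = r ∷ refineList-all rs
  ... | no  _ = refineList-all rs

  refineList-unique : ∀ {xs} → Unique xs → Unique (refineList xs)
  refineList-unique [] = []
  refineList-unique {x ∷ _} (x∉ ∷ u) with Q? x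
  ... | yes _ = All.map (λ x≢y → x≢y ∘ cong value) (refineList-all x∉) ∷ refineList-unique u
  ... | no  _ = refineList-unique u

  refinement-finite : Finite A → Finite (Refinement A Q)
  refinement-finite A-fin = record
    { elements = refineList (elements A-fin)
    ; complete = λ x → refineList-complete x (complete A-fin (value x))
    ; unique   = refineList-unique (unique A-fin)
    }

module _ {A : Set} {B : A → Set} where

  pairs : List A → (∀ a → List (B a)) → List (Σ A B)
  pairs xs ys = concatMap (λ a → map (a ,_) (ys a)) xs

  ∈-pairs : ∀ {xs} ys {a b} → a ∈ₗ xs → b ∈ₗ ys a → (a , b) ∈ₗ pairs xs ys
  ∈-pairs ys {a} a∈ b∈ = ∈-concat⁺′ (∈-map⁺ (a ,_) b∈) (∈-map⁺ (λ a → map (a ,_) (ys a)) a∈)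

  pairs-unique : ∀ {xs ys} → Unique xs → (∀ a → Unique (ys a)) → Unique (pairs xs ys)
  pairs-unique {xs} {ys} u v = Unique.concat⁺
    (All.map⁺ (All.universal (λ a → Unique.map⁺ (λ { refl → refl }) (v a)) xs))
    (AllPairs.map⁺ (AllPairs.map disjoint u))
    where
    disjoint : ∀ {a a′} → a ≢ a′ → Disjoint (map (a ,_) (ys a)) (map (a′ ,_) (ys a′))
    disjoint {a} {a′} a≢a′ (i , j) with ∈-map⁻ (a ,_) i | ∈-map⁻ (a′ ,_) j
    ... | _ , _ , refl | _ , _ , e = a≢a′ (cong proj₁ e)

×-finite : ∀ {A B : Set} → Finite A → Finite B → Finite (A × B)
×-finite A-fin B-fin = record
  { elements = cartesianProduct (elements A-fin) (elements B-fin)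
  ; complete = λ (a , b) → ∈-cartesianProduct⁺ (complete A-fin a) (complete B-fin b)
  ; unique   = Unique.cartesianProduct⁺ (unique A-fin) (unique B-fin)
  }

Vec-finite : ∀ {A : Set} → Finite A → ∀ n → Finite (Vec A n)
Vec-finite A-fin n = record
  { elements = vectors (elements A-fin) n
  ; complete = λ v → vectors-complete v (λ i → complete A-fin (lookup v i))
  ; unique   = vectors-unique (unique A-fin) n
  }

Bool-finite : Finite Bool
Bool-finite = record
  { elements = true ∷ false ∷ []
  ; complete = λ { true → here refl ; false → there (here refl) }
  ; unique   = ((λ ()) ∷ []) ∷ [] ∷ []
  }

Maybe-finite : ∀ {A : Set} → Finite A → Finite (Maybe A)
Maybe-finite A-fin = record
  { elements = nothing ∷ map just (elements A-fin)
  ; complete = λ { nothing → here refl ; (just x) → there (∈-map⁺ just (complete A-fin x)) }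
  ; unique   = All.map⁺ (All.universal (λ _ ()) _) ∷ Unique.map⁺ Maybe.just-injective (unique A-fin)
  }

Fin-finite : ∀ n → Finite (Fin n)
Fin-finite n = record { elements = allFin n ; complete = ∈-allFin ; unique = Unique.allFin⁺ n }

-- V₁ = {1,…,p} and V₂ = {p+1,…,n}: the element i of {1,…,n} is the element of Fin n with toℕ equal to i - 1.

V₁ V₂ : ∀ {n} → ℕ → Subset n
V₁ p = tabulate (λ i → does (toℕ i <? p))
V₂ p = ∁ (V₁ p)

-- The second component is the chosen element of a pointed block, and
-- nothing for an unpointed block.

Block : ℕ → Set
Block n = Subset n × Maybe (Fin n)

support : ∀ {n} → Block n → Subset n
support = proj₁

point : ∀ {n} → Block n → Maybe (Fin n)
point = proj₂

_≟ᵇ_ : ∀ {n} → DecidableEquality (Block n)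
_≟ᵇ_ = Product.≡-dec (Vec.≡-dec Bool._≟_) (Maybe.≡-dec Fin._≟_)

-- A partition is stored as the vector whose i-th entry is the block that
-- contains i; distinct partitions have distinct vectors.

record IsSemiPointed {n : ℕ} (p : ℕ) (v : Vec (Block n) n) : Set where
  field
    contains  : ∀ i → i ∈ support (lookup v i)
    constant  : ∀ i j → j ∈ support (lookup v i) → lookup v j ≡ lookup v i
    pointed   : ∀ i e → point (lookup v i) ≡ just e → e ∈ support (lookup v i) ∩ V₁ p
    inside-V₁ : ∀ i → support (lookup v i) ⊆ V₁ p → point (lookup v i) ≢ nothing
    inside-V₂ : ∀ i → support (lookup v i) ⊆ V₂ p → point (lookup v i) ≡ nothing

_≟ᵐ_ : ∀ {n} → DecidableEquality (Maybe (Fin n))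
_≟ᵐ_ = Maybe.≡-dec Fin._≟_

isSemiPointed? : ∀ {n} p → Decidable (IsSemiPointed {n} p)
isSemiPointed? p v = map′
  (λ (a , b , c , d , e) → record
    { contains = a ; constant = b ; pointed = c ; inside-V₁ = d ; inside-V₂ = e })
  (λ h → let open IsSemiPointed h in contains , constant , pointed , inside-V₁ , inside-V₂)
  (     Fin.all? (λ i → i ∈? support (lookup v i))
  ×-dec Fin.all? (λ i → Fin.all? (λ j → j ∈? support (lookup v i) →-dec lookup v j ≟ᵇ lookup v i))
  ×-dec Fin.all? (λ i → Fin.all? (λ e → point (lookup v i) ≟ᵐ just e →-dec e ∈? (support (lookup v i) ∩ V₁ p)))
  ×-dec Fin.all? (λ i → support (lookup v i) ⊆? V₁ p →-dec ¬? (point (lookup v i) ≟ᵐ nothing))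
  ×-dec Fin.all? (λ i → support (lookup v i) ⊆? V₂ p →-dec point (lookup v i) ≟ᵐ nothing))

SemiPointed : ℕ → ℕ → Set
SemiPointed n p = Refinement (Vec (Block n) n) (IsSemiPointed p)

SemiPointed-finite : ∀ n p → Finite (SemiPointed n p)
SemiPointed-finite n p = refinement-finite (isSemiPointed? p)
  (Vec-finite (×-finite (Vec-finite Bool-finite n) (Maybe-finite (Fin-finite n))) n)

module _ {n p : ℕ} where

  blockAt : SemiPointed n p → Fin n → Block n
  blockAt x = lookup (value x)

  blocks : SemiPointed n p → List (Block n)
  blocks x = deduplicate _≟ᵇ_ (toList (value x))

  pointedBlocks unpointedBlocks : SemiPointed n p → ℕ
  pointedBlocks   x = length (filter (λ b → ¬? (point b ≟ᵐ nothing)) (blocks x))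
  unpointedBlocks x = length (filter (λ b → point b ≟ᵐ nothing) (blocks x))

  -- The block b of x at i is a union of blocks of y when it contains the
  -- block of y at each of its elements.  The second conjunct treats both
  -- cases at once: some block of y inside b is pointed at e if b is pointed
  -- at e, and some block of y inside b is unpointed if b is unpointed.

  _⊑_ : Rel (SemiPointed n p) 0ℓ
  x ⊑ y = ∀ i → let b = blockAt x i in
      (∀ j → j ∈ support b → support (blockAt y j) ⊆ support b)
    × (∃[ j ] j ∈ support b × point (blockAt y j) ≡ point b)

  _⊑?_ : ∀ x y → Dec (x ⊑ y)
  x ⊑? y = Fin.all? λ i → let b = blockAt x i in
          Fin.all? (λ j → j ∈? support b →-dec support (blockAt y j) ⊆? support b)
    ×-dec Fin.any? (λ j → j ∈? support b ×-dec point (blockAt y j) ≟ᵐ point b)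

  isSemiPointed : (x : SemiPointed n p) → IsSemiPointed p (value x)
  isSemiPointed (v , [ h ]) = recompute (isSemiPointed? p v) h

  self∈block : (x : SemiPointed n p) → ∀ i → i ∈ support (blockAt x i)
  self∈block x = IsSemiPointed.contains (isSemiPointed x)

  sameBlock : (x : SemiPointed n p) → ∀ {i j} → j ∈ support (blockAt x i) → blockAt x j ≡ blockAt x i
  sameBlock x {i} {j} = IsSemiPointed.constant (isSemiPointed x) i j

  ⊑-refl : ∀ {x} → x ⊑ x
  ⊑-refl {x} i = (λ j j∈ {k} → subst (λ b → k ∈ support b) (sameBlock x j∈)) , i , self∈block x i , refl

  ⊑-trans : ∀ {x y z} → x ⊑ y → y ⊑ z → x ⊑ z
  ⊑-trans {x} {y} {z} x⊑y y⊑z i with x⊑y i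
  ... | sub , j , j∈ , eq with y⊑z j
  ... | _ , k , k∈ , eq′ = (λ m m∈ {_} t → sub m m∈ (proj₁ (y⊑z m) m (self∈block y m) t))
                         , k , sub j j∈ k∈ , trans eq′ eq

  ⊑-antisym : ∀ {x y} → x ⊑ y → y ⊑ x → x ≡ y
  ⊑-antisym {x} {y} x⊑y y⊑x = value-injective
    (trans (sym (Vec.tabulate∘lookup (value x)))
    (trans (Vec.tabulate-cong same) (Vec.tabulate∘lookup (value y))))
    where
    supports : ∀ i → support (blockAt x i) ≡ support (blockAt y i)
    supports i = ⊆-antisym (proj₁ (y⊑x i) i (self∈block y i)) (proj₁ (x⊑y i) i (self∈block x i))
    same : ∀ i → blockAt x i ≡ blockAt y i
    same i with x⊑y i
    ... | _ , j , j∈ , eq = cong₂ _,_ (supports i)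
      (trans (sym eq) (cong point (sameBlock y (subst (j ∈_) (supports i) j∈))))

  ⊑-isDecPartialOrder : IsDecPartialOrder _≡_ _⊑_
  ⊑-isDecPartialOrder = record
    { isPartialOrder = record
      { isPreorder = record
        { isEquivalence = isEquivalence
        ; reflexive     = λ { {x} refl → ⊑-refl {x} }
        ; trans         = λ {x} {y} {z} → ⊑-trans {x} {y} {z}
        }
      ; antisym = ⊑-antisym
      }
    ; _≟_  = Data.Refinement._≟_ (Vec.≡-dec _≟ᵇ_)
    ; _≤?_ = _⊑?_
    }

record BlockPoset : Set₁ where
  field
    Carrier           : Set
    _⊴_               : Rel Carrier 0ℓ
    isDecPartialOrder : IsDecPartialOrder _≡_ _⊴_
    finite            : Finite Carrier
    #pointed          : Carrier → ℕ
    #unpointed        : Carrier → ℕ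

  open IsDecPartialOrder isDecPartialOrder public
    using () renaming (refl to ⊴-refl; trans to ⊴-trans; antisym to ⊴-antisym; _≟_ to _≟ₚ_; _≤?_ to _⊴?_)

record BoundedBlockPoset : Set₁ where
  field
    blockPoset : BlockPoset
  open BlockPoset blockPoset public
  field
    0̂ 1̂     : Carrier
    minimum : Minimum _⊴_ 0̂
    maximum : Maximum _⊴_ 1̂

Π : ℕ → ℕ → BlockPoset
Π n p = record
  { Carrier           = SemiPointed n p
  ; _⊴_               = _⊑_
  ; isDecPartialOrder = ⊑-isDecPartialOrder
  ; finite            = SemiPointed-finite n p
  ; #pointed          = pointedBlocks
  ; #unpointed        = unpointedBlocks
  }

module _ (X : BlockPoset) where
  open BlockPoset X

  Between : Carrier → Carrier → Carrier → Set
  Between a b x = a ⊴ x × x ⊴ b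

  closedInterval : ∀ a b → .(a ⊴ b) → BoundedBlockPoset
  closedInterval a b a⊴b = record
    { blockPoset = record
      { Carrier           = Refinement Carrier (Between a b)
      ; _⊴_               = λ x y → value x ⊴ value y
      ; isDecPartialOrder = record
        { isPartialOrder = record
          { isPreorder = record
            { isEquivalence = isEquivalence
            ; reflexive     = λ { refl → ⊴-refl }
            ; trans         = ⊴-trans
            }
          ; antisym = λ r s → value-injective (⊴-antisym r s)
          }
        ; _≟_  = Data.Refinement._≟_ _≟ₚ_
        ; _≤?_ = λ x y → value x ⊴? value y
        }
      ; finite     = refinement-finite (λ x → a ⊴? x ×-dec x ⊴? b) finite
      ; #pointed   = λ x → #pointed (value x)
      ; #unpointed = λ x → #unpointed (value x)
      }
    ; 0̂       = a , [ ⊴-refl , a⊴b ]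
    ; 1̂       = b , [ a⊴b , ⊴-refl ]
    ; minimum = λ { (x , [ h ]) → recompute (a ⊴? x) (proj₁ h) }
    ; maximum = λ { (x , [ h ]) → recompute (x ⊴? b) (proj₂ h) }
    }

dual : BoundedBlockPoset → BoundedBlockPoset
dual X = record
  { blockPoset = record
    { Carrier           = Carrier
    ; _⊴_               = flip _⊴_
    ; isDecPartialOrder = record
      { isPartialOrder = record
        { isPreorder = record
          { isEquivalence = isEquivalence
          ; reflexive     = λ { refl → ⊴-refl }
          ; trans         = λ r s → ⊴-trans s r
          }
        ; antisym = λ r s → ⊴-antisym s r
        }
      ; _≟_  = _≟ₚ_
      ; _≤?_ = flip _⊴?_
      }
    ; finite     = finite
    ; #pointed   = #pointed
    ; #unpointed = #unpointed
    }
  ; 0̂       = 1̂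
  ; 1̂       = 0̂
  ; minimum = maximum
  ; maximum = minimum
  }
  where open BoundedBlockPoset X

-- The blocks of (x , y) are the blocks of x together with those of y.

directProduct : BoundedBlockPoset → BoundedBlockPoset → BoundedBlockPoset
directProduct X Y = record
  { blockPoset = record
    { Carrier           = X.Carrier × Y.Carrier
    ; _⊴_               = λ (x , y) (x′ , y′) → x X.⊴ x′ × y Y.⊴ y′
    ; isDecPartialOrder = record
      { isPartialOrder = record
        { isPreorder = record
          { isEquivalence = isEquivalence
          ; reflexive     = λ { refl → X.⊴-refl , Y.⊴-refl }
          ; trans         = λ (r , s) (r′ , s′) → X.⊴-trans r r′ , Y.⊴-trans s s′
          }
        ; antisym = λ (r , s) (r′ , s′) → cong₂ _,_ (X.⊴-antisym r r′) (Y.⊴-antisym s s′)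
        }
      ; _≟_  = Product.≡-dec X._≟ₚ_ Y._≟ₚ_
      ; _≤?_ = λ (x , y) (x′ , y′) → x X.⊴? x′ ×-dec y Y.⊴? y′
      }
    ; finite     = ×-finite X.finite Y.finite
    ; #pointed   = λ (x , y) → X.#pointed x + Y.#pointed y
    ; #unpointed = λ (x , y) → X.#unpointed x + Y.#unpointed y
    }
  ; 0̂       = X.0̂ , Y.0̂
  ; 1̂       = X.1̂ , Y.1̂
  ; minimum = λ (x , y) → X.minimum x , Y.minimum y
  ; maximum = λ (x , y) → X.maximum x , Y.maximum y
  }
  where
  module X = BoundedBlockPoset X
  module Y = BoundedBlockPoset Y

emptyProduct : BoundedBlockPoset
emptyProduct = record
  { blockPoset = record
    { Carrier           = Unit
    ; _⊴_               = λ _ _ → Unit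
    ; isDecPartialOrder = record
      { isPartialOrder = record
        { isPreorder = record { isEquivalence = isEquivalence ; reflexive = λ _ → tt ; trans = λ _ _ → tt }
        ; antisym    = λ _ _ → refl
        }
      ; _≟_  = λ _ _ → yes refl
      ; _≤?_ = λ _ _ → yes tt
      }
    ; finite     = record { elements = tt ∷ [] ; complete = λ _ → here refl ; unique = [] ∷ [] }
    ; #pointed   = λ _ → 0
    ; #unpointed = λ _ → 0
    }
  ; 0̂       = tt
  ; 1̂       = tt
  ; minimum = λ _ → tt
  ; maximum = λ _ → tt
  }

Defined : ℕ → ℕ → Fin 2 → Set
Defined n p zero       = p < n
Defined n p (suc zero) = 1 ≤ p × p ≤ n

∈V₁⁺ : ∀ {n} p {i : Fin n} → toℕ i < p → i ∈ V₁ p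
∈V₁⁺ p {i} i<p = Vec.lookup⇒[]= i (V₁ p)
  (trans (Vec.lookup∘tabulate _ i) (dec-true (toℕ i <? p) i<p))

∈V₁⁻ : ∀ {n} p {i : Fin n} → i ∈ V₁ p → toℕ i < p
∈V₁⁻ p {i} i∈ = ℕ.<ᵇ⇒< (toℕ i) p (subst T
  (trans (sym (Vec.[]=⇒lookup i∈)) (Vec.lookup∘tabulate (λ i → does (toℕ i <? p)) i)) tt)

singletonBlock : ∀ {n} → ℕ → Fin n → Block n
singletonBlock p i with toℕ i <? p
... | yes _ = ⁅ i ⁆ , just i
... | no  _ = ⁅ i ⁆ , nothing

singletonsVec : ∀ n → ℕ → Vec (Block n) n
singletonsVec n p = tabulate (singletonBlock p)

lookup-singletons : ∀ n p i → lookup (singletonsVec n p) i ≡ singletonBlock p i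
lookup-singletons n p = Vec.lookup∘tabulate (singletonBlock p)

singletonBlock-support : ∀ {n} p (i : Fin n) → support (singletonBlock p i) ≡ ⁅ i ⁆
singletonBlock-support p i with toℕ i <? p
... | yes _ = refl
... | no  _ = refl

singletons-valid : ∀ n p → IsSemiPointed p (singletonsVec n p)
singletons-valid n p = record
  { contains = contains ; constant = constant ; pointed = pointed ; inside-V₁ = inV₁ ; inside-V₂ = inV₂ }
  where
  v = singletonsVec n p
  supp : ∀ i → support (lookup v i) ≡ ⁅ i ⁆
  supp i = trans (cong support (lookup-singletons n p i)) (singletonBlock-support p i)
  contains : ∀ i → i ∈ support (lookup v i)
  contains i = subst (i ∈_) (sym (supp i)) (x∈⁅x⁆ i)
  constant : ∀ i j → j ∈ support (lookup v i) → lookup v j ≡ lookup v i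
  constant i j j∈ = cong (lookup v) (x∈⁅y⁆⇒x≡y i (subst (j ∈_) (supp i) j∈))
  pointed : ∀ i e → point (lookup v i) ≡ just e → e ∈ support (lookup v i) ∩ V₁ p
  pointed i e eq rewrite lookup-singletons n p i with toℕ i <? p
  pointed i e refl | yes i<p = x∈p∩q⁺ (x∈⁅x⁆ i , ∈V₁⁺ p i<p)
  pointed i e ()   | no  _
  inV₁ : ∀ i → support (lookup v i) ⊆ V₁ p → point (lookup v i) ≢ nothing
  inV₁ i sub eq with ∈V₁⁻ p (sub (contains i))
  ... | i<p rewrite lookup-singletons n p i with toℕ i <? p
  inV₁ i sub () | i<p | yes _
  ... | no i≮p = i≮p i<p
  inV₂ : ∀ i → support (lookup v i) ⊆ V₂ p → point (lookup v i) ≡ nothing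
  inV₂ i sub with x∈∁p⇒x∉p (sub (contains i))
  ... | i∉ rewrite lookup-singletons n p i with toℕ i <? p
  ... | yes i<p = contradiction (∈V₁⁺ p i<p) i∉
  ... | no  _   = refl

singletons : ∀ n p → SemiPointed n p
singletons n p = singletonsVec n p , [ singletons-valid n p ]

-- The middle clause is never used: P_{0,p,1} is not defined.

rootPoint : ∀ n → Fin 2 → Maybe (Fin n)
rootPoint n       zero       = nothing
rootPoint zero    (suc zero) = nothing
rootPoint (suc _) (suc zero) = just zero

oneBlockVec : ∀ n → Fin 2 → Vec (Block n) n
oneBlockVec n o = replicate n (⊤ , rootPoint n o)

lookup-oneBlock : ∀ n o i → lookup (oneBlockVec n o) i ≡ (⊤ , rootPoint n o)
lookup-oneBlock n o i = Vec.lookup-replicate i (⊤ , rootPoint n o)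

oneBlock-valid : ∀ n p o → Defined n p o → IsSemiPointed p (oneBlockVec n o)
oneBlock-valid n p o d = record
  { contains  = λ i → full i
  ; constant  = λ i j _ → trans (lookup-oneBlock n o j) (sym (lookup-oneBlock n o i))
  ; pointed   = λ i e eq → x∈p∩q⁺ (full i , root∈V₁ n o d e (trans (sym (cong point (lookup-oneBlock n o i))) eq))
  ; inside-V₁ = λ i sub eq → pointed n o d (λ j → sub (full i)) (trans (sym (cong point (lookup-oneBlock n o i))) eq)
  ; inside-V₂ = λ i sub → trans (cong point (lookup-oneBlock n o i)) (unpointed n o d (λ j → sub (full i)))
  }
  where
  full : ∀ i {j} → j ∈ support (lookup (oneBlockVec n o) i)
  full i {j} = subst (j ∈_) (sym (cong support (lookup-oneBlock n o i))) ∈⊤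
  root∈V₁ : ∀ n o → Defined n p o → ∀ e → rootPoint n o ≡ just e → e ∈ V₁ p
  root∈V₁ (suc n) (suc zero) (1≤p , _) _ refl = ∈V₁⁺ p 1≤p
  root∈V₁ zero (suc zero) _ ()
  pointed : ∀ n o → Defined n p o → (∀ (j : Fin n) → j ∈ V₁ p) → rootPoint n o ≢ nothing
  pointed n zero p<n sub _ = ℕ.n≮n p (subst (_< p) (Fin.toℕ-fromℕ< p<n) (∈V₁⁻ p (sub (fromℕ< p<n))))
  pointed (suc n) (suc zero) _ _ ()
  pointed zero (suc zero) (1≤p , p≤0) _ _ = ℕ.n≮0 (ℕ.≤-trans 1≤p p≤0)
  unpointed : ∀ n o → Defined n p o → (∀ (j : Fin n) → j ∈ V₂ p) → rootPoint n o ≡ nothing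
  unpointed n zero _ _ = refl
  unpointed zero (suc zero) _ _ = refl
  unpointed (suc n) (suc zero) (1≤p , _) sub = contradiction (∈V₁⁺ p 1≤p) (x∈∁p⇒x∉p (sub zero))

oneBlock : ∀ n p o → .(Defined n p o) → SemiPointed n p
oneBlock n p o d = oneBlockVec n o , [ oneBlock-valid n p o d ]

oneBlock⊑singletons : ∀ n p o (d : Defined n p o) → oneBlock n p o d ⊑ singletons n p
oneBlock⊑singletons n p o d i rewrite lookup-oneBlock n o i =
  (λ _ _ _ → ∈⊤) , root n p o d
  where
  root : ∀ n p o → Defined n p o →
    ∃[ j ] j ∈ ⊤ × point (lookup (singletonsVec n p) j) ≡ rootPoint n o
  root n p zero p<n = fromℕ< p<n , ∈⊤ , eq
    where
    eq : point (lookup (singletonsVec n p) (fromℕ< p<n)) ≡ nothing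
    eq rewrite Vec.lookup∘tabulate (singletonBlock p) (fromℕ< p<n) with toℕ (fromℕ< p<n) <? p
    ... | yes lt = contradiction (subst (_< p) (Fin.toℕ-fromℕ< p<n) lt) (ℕ.n≮n p)
    ... | no  _  = refl
  root (suc n) (suc p) (suc zero) _ = zero , ∈⊤ , refl
  root zero (suc p) (suc zero) (_ , ())

basicPoset : ∀ n p o → .(Defined n p o) → BoundedBlockPoset
basicPoset n p o d = dual
  (closedInterval (Π n p) (oneBlock n p o d) (singletons n p) (oneBlock⊑singletons n p o d))

-- 𝓕 is generated by the P_{n,p,o} under direct products.  Every interval of a
-- product is again a product up to an isomorphism that preserves block
-- numbers, so the interval constructor adds no new classes; it makes intervals
-- members of 𝓕 on the nose.

mutual

  data 𝓕 : Set where
    P        : ∀ n p o → .(Defined n p o) → 𝓕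
    𝟙        : 𝓕
    _⊠_      : 𝓕 → 𝓕 → 𝓕
    interval : (X : 𝓕) (x y : BoundedBlockPoset.Carrier ⟦ X ⟧) → .(BoundedBlockPoset._⊴_ ⟦ X ⟧ x y) → 𝓕

  ⟦_⟧ : 𝓕 → BoundedBlockPoset
  ⟦ P n p o d ⟧          = basicPoset n p o d
  ⟦ 𝟙 ⟧                  = emptyProduct
  ⟦ X ⊠ Y ⟧              = directProduct ⟦ X ⟧ ⟦ Y ⟧
  ⟦ interval X x y x⊴y ⟧ = closedInterval (BoundedBlockPoset.blockPoset ⟦ X ⟧) x y x⊴y

∣_∣ : 𝓕 → Set
∣ X ∣ = BoundedBlockPoset.Carrier ⟦ X ⟧

record _≅_ (X Y : 𝓕) : Set where
  private
    module X = BoundedBlockPoset ⟦ X ⟧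
    module Y = BoundedBlockPoset ⟦ Y ⟧
  field
    to                 : ∣ X ∣ → ∣ Y ∣
    isOrderIsomorphism : IsOrderIsomorphism _≡_ _≡_ X._⊴_ Y._⊴_ to
    #pointed-0̂         : X.#pointed   X.0̂ ≡ Y.#pointed   Y.0̂
    #unpointed-0̂       : X.#unpointed X.0̂ ≡ Y.#unpointed Y.0̂
    #pointed-1̂         : X.#pointed   X.1̂ ≡ Y.#pointed   Y.1̂
    #unpointed-1̂       : X.#unpointed X.1̂ ≡ Y.#unpointed Y.1̂

-- Classes [X] and [Y] are equal when X ∼ Y.  Closure under _⊠_ is what lets
-- the direct product induce a product of classes with unit [𝟙].

data _∼_ : Rel 𝓕 0ℓ where
  iso        : ∀ {X Y} → X ≅ Y → X ∼ Y
  oneElement : ∀ {X} → (∀ (x y : ∣ X ∣) → x ≡ y) → X ∼ 𝟙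
  ⊠-cong     : ∀ {X X′ Y Y′} → X ∼ X′ → Y ∼ Y′ → (X ⊠ Y) ∼ (X′ ⊠ Y′)
  ∼-refl     : ∀ {X} → X ∼ X
  ∼-sym      : ∀ {X Y} → X ∼ Y → Y ∼ X
  ∼-trans    : ∀ {X Y Z} → X ∼ Y → Y ∼ Z → X ∼ Z

∼-setoid : Setoid 0ℓ 0ℓ
∼-setoid = record
  { Carrier       = 𝓕
  ; _≈_           = _∼_
  ; isEquivalence = record { refl = ∼-refl ; sym = ∼-sym ; trans = ∼-trans }
  }

-- The ℚ-vector space whose basis is the set of classes of a setoid: finite
-- formal combinations, modulo the least congruence making _++_ commutative,
-- equal basis elements interchangeable, and coefficients additive.

module FreeVectorSpace (B : Setoid 0ℓ 0ℓ) where
  open Setoid B using () renaming (Carrier to ∣B∣; _≈_ to _≈ᴮ_)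

  Combination : Set
  Combination = List (ℚ × ∣B∣)

  infix 4 _≈_
  data _≈_ : Rel Combination 0ℓ where
    ≈-refl  : ∀ {u} → u ≈ u
    ≈-sym   : ∀ {u v} → u ≈ v → v ≈ u
    ≈-trans : ∀ {u v w} → u ≈ v → v ≈ w → u ≈ w
    ++-cong : ∀ {u u′ v v′} → u ≈ u′ → v ≈ v′ → u ++ v ≈ u′ ++ v′
    ++-comm : ∀ u v → u ++ v ≈ v ++ u
    basis   : ∀ c {x y} → x ≈ᴮ y → (c , x) ∷ [] ≈ (c , y) ∷ []
    add     : ∀ c d x → (c , x) ∷ (d , x) ∷ [] ≈ (c ℚ.+ d , x) ∷ []
    zero    : ∀ x → (0ℚ , x) ∷ [] ≈ []

scale : ∀ {B : Set} → ℚ → List (ℚ × B) → List (ℚ × B)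
scale c = map (λ (d , x) → c ℚ.* d , x)

linear : ∀ {B C : Set} → (B → List (ℚ × C)) → List (ℚ × B) → List (ℚ × C)
linear f = concatMap (λ (c , x) → scale c (f x))

bilinear : ∀ {A B C : Set} → (A → B → C) → List (ℚ × A) → List (ℚ × B) → List (ℚ × C)
bilinear f = cartesianProductWith (λ (c , x) (d , y) → c ℚ.* d , f x y)

∑ : ∀ {I B : Set} → Finite I → (I → List (ℚ × B)) → List (ℚ × B)
∑ I f = concatMap f (elements I)

-- Elements of 𝓘 are combinations of representatives X of the classes [X], up
-- to _≈_; 𝓘 ⊗ 𝓘 is the space with basis the pairs [X] ⊗ [Y].

open FreeVectorSpace ∼-setoid public
  using (_≈_) renaming (Combination to 𝓘)
open FreeVectorSpace (×-setoid ∼-setoid ∼-setoid) public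
  using () renaming (Combination to 𝓘⊗𝓘; _≈_ to _≈⊗_)

infixr 8 _•_
infixl 7 _·_
infixl 6 _⊗_

cls : 𝓕 → 𝓘
cls X = (1ℚ , X) ∷ []

_•_ : ℚ → 𝓘 → 𝓘
_•_ = scale

_·_ : 𝓘 → 𝓘 → 𝓘
_·_ = bilinear _⊠_

_⊗_ : 𝓘 → 𝓘 → 𝓘⊗𝓘
_⊗_ = bilinear _,_

∏ : ∀ {m} → (Fin m → 𝓘) → 𝓘
∏ f = foldr _·_ (cls 𝟙) (List.tabulate f)

Δ : 𝓘 → 𝓘⊗𝓘
Δ = linear λ X → let open BoundedBlockPoset ⟦ X ⟧ in
  ∑ finite λ x → cls (interval X 0̂ x (minimum x)) ⊗ cls (interval X x 1̂ (maximum x))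

1/_! : ℕ → ℚ
1/ n ! = (ℤ.+ 1 ℚ./ n !) {{n !≢0}}

Tuples : Set
Tuples = Σ ℕ λ p → Σ ℕ λ q → Vec ℕ (p + q) × Vec ℕ (p + q)

-- The terms with o = 0 and q = 0 would involve the undefined P_{p,p,0}; the
-- third conjunct leaves them out.

Admissible : ℕ → ℕ → Fin 2 → Tuples → Set
Admissible k l o (p , q , ls , ks) =
    1 ≤ p + q
  × toℕ o ≤ p
  × Defined (p + q) p o
  × (∀ (i : Fin q) → 1 ≤ lookup ls (p ↑ʳ i))
  × Vec.sum ls ≡ l
  × (∀ (i : Fin p) → 1 ≤ lookup ks (i ↑ˡ q))
  × Vec.sum ks ≡ k

defined? : ∀ n p o → Dec (Defined n p o)
defined? n p zero       = p <? n
defined? n p (suc zero) = 1 ≤? p ×-dec p ≤? n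

admissible? : ∀ k l o → Decidable (Admissible k l o)
admissible? k l o (p , q , ls , ks) =
        1 ≤? p + q
  ×-dec toℕ o ≤? p
  ×-dec defined? (p + q) p o
  ×-dec Fin.all? (λ i → 1 ≤? lookup ls (p ↑ʳ i))
  ×-dec Vec.sum ls ℕ.≟ l
  ×-dec Fin.all? (λ i → 1 ≤? lookup ks (i ↑ˡ q))
  ×-dec Vec.sum ks ℕ.≟ k

record Index (k l : ℕ) (o : Fin 2) : Set where
  constructor index
  field
    tuples : Refinement Tuples (Admissible k l o)

  p q : ℕ
  p = proj₁ (value tuples)
  q = proj₁ (proj₂ (value tuples))

  ls ks : Fin (p + q) → ℕ
  ls = lookup (proj₁ (proj₂ (proj₂ (value tuples))))
  ks = lookup (proj₂ (proj₂ (proj₂ (value tuples))))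

  private
    admissible : Admissible k l o (value tuples)
    admissible with tuples
    ... | t , [ h ] = recompute (admissible? k l o t) h

  rootDefined : Defined (p + q) p o
  rootDefined = proj₁ (proj₂ (proj₂ admissible))

  pointedDefined : ∀ (i : Fin p) → Defined (ls (i ↑ˡ q) + ks (i ↑ˡ q)) (ks (i ↑ˡ q)) (suc zero)
  pointedDefined i = proj₁ (proj₂ (proj₂ (proj₂ (proj₂ (proj₂ admissible))))) i , ℕ.m≤n+m _ _

  unpointedDefined : ∀ (i : Fin q) → Defined (ls (p ↑ʳ i) + ks (p ↑ʳ i)) (ks (p ↑ʳ i)) zero
  unpointedDefined i = ℕ.+-monoˡ-≤ _ (proj₁ (proj₂ (proj₂ (proj₂ admissible))) i)

-- Finiteness: k₁,…,k_p ≥ 1 forces p ≤ k, and l_{p+1},…,l_{p+q} ≥ 1 forces q ≤ l.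

lookup≤sum : ∀ {n} (v : Vec ℕ n) i → lookup v i ≤ Vec.sum v
lookup≤sum (x ∷ v) zero    = ℕ.m≤m+n x _
lookup≤sum (x ∷ v) (suc i) = ℕ.≤-trans (lookup≤sum v i) (ℕ.m≤n+m _ x)

p≤sum : ∀ p q (v : Vec ℕ (p + q)) → (∀ (i : Fin p) → 1 ≤ lookup v (i ↑ˡ q)) → p ≤ Vec.sum v
p≤sum zero    q v       h = z≤n
p≤sum (suc p) q (x ∷ v) h = ℕ.+-mono-≤ (h zero) (p≤sum p q v (h ∘ suc))

q≤sum : ∀ p q (v : Vec ℕ (p + q)) → (∀ (i : Fin q) → 1 ≤ lookup v (p ↑ʳ i)) → q ≤ Vec.sum v
q≤sum zero    zero    v       h = z≤n
q≤sum zero    (suc q) (x ∷ v) h = ℕ.+-mono-≤ (h zero) (q≤sum zero q v (h ∘ suc))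
q≤sum (suc p) q       (x ∷ v) h = ℕ.≤-trans (q≤sum p q v h) (ℕ.m≤n+m _ x)

boundedVectors : ℕ → ℕ → ∀ p q → List (Vec ℕ (p + q) × Vec ℕ (p + q))
boundedVectors k l p q = cartesianProduct (vectors (upTo (suc l)) (p + q)) (vectors (upTo (suc k)) (p + q))

boundedTuples : ℕ → ℕ → List Tuples
boundedTuples k l = pairs (upTo (suc k)) λ p → pairs (upTo (suc l)) (boundedVectors k l p)

boundedTuples-complete : ∀ {k l o} t → Admissible k l o t → t ∈ₗ boundedTuples k l
boundedTuples-complete {k} {l} (p , q , ls , ks) (_ , _ , _ , hl , refl , hk , refl) =
  ∈-pairs (λ p → pairs (upTo (suc l)) (boundedVectors k l p)) (∈-upTo⁺ (s≤s (p≤sum p q ks hk)))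
    (∈-pairs (boundedVectors k l p) (∈-upTo⁺ (s≤s (q≤sum p q ls hl)))
      (∈-cartesianProduct⁺
        (vectors-complete ls (λ i → ∈-upTo⁺ (s≤s (lookup≤sum ls i))))
        (vectors-complete ks (λ i → ∈-upTo⁺ (s≤s (lookup≤sum ks i))))))

boundedTuples-unique : ∀ k l → Unique (boundedTuples k l)
boundedTuples-unique k l =
  pairs-unique {xs = upTo (suc k)} {ys = λ p → pairs (upTo (suc l)) (boundedVectors k l p)} (Unique.upTo⁺ (suc k)) λ p →
    pairs-unique {xs = upTo (suc l)} {ys = boundedVectors k l p} (Unique.upTo⁺ (suc l)) λ q →
      Unique.cartesianProduct⁺
        (vectors-unique (Unique.upTo⁺ (suc l)) (p + q)) (vectors-unique (Unique.upTo⁺ (suc k)) (p + q))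

Index-finite : ∀ k l o → Finite (Index k l o)
Index-finite k l o = record
  { elements = map index (refineList (admissible? k l o) (boundedTuples k l))
  ; complete = λ { (index t@(v , [ h ])) → ∈-map⁺ index (refineList-complete (admissible? k l o) t
                     (boundedTuples-complete {o = o} v (recompute (admissible? k l o v) h))) }
  ; unique   = Unique.map⁺ (λ { refl → refl }) (refineList-unique (admissible? k l o) (boundedTuples-unique k l))
  }

{-# OPTIONS --safe #-}
-- Fix a partition x in P_{k+l,k,o} with p pointed and q unpointed blocks, and
-- number its pointed blocks by Fin p (the block of the root first if o = 1) and
-- its unpointed blocks by Fin q.  Such a labelling identifies the partitions
-- coarser than x with P_{p+q,p,o}, and the partitions finer than x with the
-- product over the blocks of x of posets P_{l_i+k_i,k_i,·}.
--
-- It remains to count labelled partitions in two ways.  Every x has q!(p-o)!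
-- labellings.  On the other hand a labelled partition is a pair of words: on
-- V₂ the word of labels, on V₁ the word of labels in which the letter of a
-- point carries a mark.  In these words the marked letter of each pointed block
-- occurs once and its unmarked letter k_i - 1 times, so multinomial coefficients
-- count the labelled partitions with given block sizes; for o = 1 the first
-- letter of the word on V₁ is prescribed, which turns k! into (k-1)!.
module Submission where

open import Defs
open import Data.Fin using (Fin; zero; suc; toℕ; _↑ˡ_; _↑ʳ_)
open import Data.Nat using (ℕ; _+_; _∸_)
open import Data.Rational using (_*_)
open import Data.Bool using (Bool; true; false; if_then_else_)
import Data.Bool.Properties as Bool
open import Data.Empty using (⊥)
open import Data.Fin using (splitAt; join; cast; punchIn; punchOut; fromℕ<)
import Data.Fin.Properties as Fin
open import Data.Fin.Subset using (_∈_; _⊆_)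
open import Data.Fin.Subset.Properties using (_∈?_; x∈p∩q⁻; x∈p∩q⁺; x∈∁p⇒x∉p; x∈⁅y⁆⇒x≡y; ∈⊤)
import Data.Integer as ℤ
import Data.Integer.Properties as ℤ
open import Data.Irrelevant using ([_])
open import Data.List as List using (List; []; _∷_; _++_; map; concatMap; length; filter; deduplicate; allFin)
open import Data.List.Membership.Propositional using () renaming (_∈_ to _∈ₗ_)
open import Data.List.Membership.Propositional.Properties using (∈-map⁺; ∈-map⁻; ∈-lookup; ∈-filter⁺; ∈-filter⁻; ∈-deduplicate⁺; ∈-deduplicate⁻; ∈-++⁺ˡ; ∈-++⁺ʳ)
open import Data.List.Membership.Propositional.Properties.WithK using (unique∧set⇒bag)
import Data.List.Properties as List
open import Data.List.Relation.Binary.BagAndSetEquality using (∼bag⇒↭)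
open import Data.List.Relation.Binary.Permutation.Propositional as Permutation using (_↭_)
open import Data.List.Relation.Binary.Permutation.Propositional.Properties as Permutation using (↭-length)
open import Data.List.Relation.Unary.All as All using (All; []; _∷_)
open import Data.List.Relation.Unary.AllPairs using ([]; _∷_)
open import Data.List.Relation.Unary.Any as Any using (here; there)
import Data.List.Relation.Unary.Any.Properties as Any
open import Data.List.Relation.Unary.Unique.DecPropositional.Properties using (deduplicate-!)
open import Data.List.Relation.Unary.Unique.Propositional using (Unique)
import Data.List.Relation.Unary.Unique.Propositional.Properties as Unique
open import Data.Maybe as Maybe using (Maybe; just; nothing)
open import Data.Maybe.Properties as Maybe using (just-injective)
open import Data.Nat as ℕ using (zero; suc; _≤_; _<_; _<?_; _≤?_; _!; z≤n; s≤s; NonZero)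
open import Data.Nat.ListAction using (sum; product)
open import Data.Nat.ListAction.Properties using (sum-↭; product-↭; sum-++; product-++)
open import Data.Nat.Properties as ℕ using (_!≢0)
open import Data.Nat.Solver using (module +-*-Solver)
open import Data.Product using (Σ; ∃-syntax; _×_; _,_; proj₁; proj₂; uncurry)
import Data.Product.Properties as Product
open import Data.Product.Relation.Binary.Pointwise.NonDependent using (×-setoid)
open import Data.Rational as ℚ using (ℚ; 0ℚ; 1ℚ)
import Data.Rational.Properties as ℚ
import Data.Rational.Solver
open import Data.Rational.Unnormalised as ℚᵘ using (mkℚᵘ; *≡*)
import Data.Rational.Unnormalised.Properties as ℚᵘ
open import Data.Refinement using (Refinement; _,_; value; value-injective)
open import Data.Sum as Sum using (_⊎_; inj₁; inj₂; [_,_]′)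
open import Data.Sum.Properties as Sum using (inj₁-injective; inj₂-injective)
open import Data.Unit using (tt) renaming (⊤ to Unit)
open import Data.Vec as Vec using (Vec; lookup; tabulate; []; _∷_; toList)
open import Data.Vec.Membership.Propositional.Properties using (∈-toList⁺; ∈-toList⁻) renaming (∈-lookup to ∈-lookupᵥ)
import Data.Vec.Properties as Vec
import Data.Vec.Relation.Unary.Any as VecAny
import Data.Vec.Relation.Unary.Any.Properties as VecAny
open import Function using (_∘_; mk⇔; const; id)
open import Level using (0ℓ)
open import Relation.Binary using (Setoid; DecidableEquality)
open import Relation.Binary.PropositionalEquality using (_≡_; refl; sym; trans; cong; cong₂; subst; module ≡-Reasoning; _≢_; subst₂)
open import Relation.Nullary using (Dec; yes; no; contradiction; _→-dec_; does; ¬?; _×-dec_)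
open import Relation.Nullary.Decidable using (dec-true; dec-false; recompute; map′)
open import Relation.Unary using (Decidable)

-- Finite sums

-- The obstacle is that the right-hand side orders the blocks, while the coproduct runs over
-- partitions whose blocks are unordered and whose block numbers vary. Terms therefore do not
-- correspond one to one. The two sides are instead compared over a bijection of dependent pairs: a
-- partition with permutations of its blocks, against an index with a pair of words. Permutations of
-- one canonical labelling stand in for labellings, because a labelling includes a choice of
-- representatives and cannot itself be counted. On the other side the index is read off from the
-- letter counts of the words, so that equality of the words settles equality of the whole dependent
-- pair. The passage from k! to (k-1)! for o = 1 has a simple cause: the prescribed first letter is
-- a marked one, of multiplicity one. Deleting it shortens the word by one letter but leaves the
-- product of the factorials of the multiplicities unchanged, so the numerator of the multinomial
-- coefficient drops and the denominator stays.

size : ∀ {A : Set} → Finite A → ℕ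
size I = length (elements I)

Σ-finite : ∀ {A : Set} {B : A → Set} → Finite A → (∀ a → Finite (B a)) → Finite (Σ A B)
Σ-finite I J = record
  { elements = pairs (elements I) (λ a → elements (J a))
  ; complete = λ (a , b) → ∈-pairs (λ a → elements (J a)) (complete I a) (complete (J a) b)
  ; unique   = pairs-unique (unique I) (λ a → unique (J a))
  }

pairWith : ∀ {A : Set} {B : A → Set} a → B a → Σ A B
pairWith a b = a , b

size-Σ : ∀ {A : Set} {B : A → Set} (I : Finite A) (J : ∀ a → Finite (B a)) →
  size (Σ-finite I J) ≡ sum (map (λ a → size (J a)) (elements I))
size-Σ {B = B} I J = go (elements I)
  where
  go : ∀ xs → length (pairs xs (λ a → elements (J a))) ≡ sum (map (λ a → size (J a)) xs)
  go []       = refl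
  go (x ∷ xs) = trans (List.length-++ (map (pairWith {B = B} x) (elements (J x))))
    (cong₂ _+_ (List.length-map (pairWith {B = B} x) (elements (J x))) (go xs))

size-× : ∀ {A B : Set} (I : Finite A) (J : Finite B) → size (×-finite I J) ≡ size I ℕ.* size J
size-× I J = go (elements I)
  where
  go : ∀ xs → length (List.cartesianProduct xs (elements J)) ≡ length xs ℕ.* size J
  go []       = refl
  go (x ∷ xs) = trans (List.length-++ (map (x ,_) (elements J)))
    (cong₂ _+_ (List.length-map (x ,_) (elements J)) (go xs))

module _ {A B : Set} (I : Finite A) (J : Finite B) (φ : A → B)
         (injective : ∀ {x y} → φ x ≡ φ y → x ≡ y) (surjective : ∀ y → ∃[ x ] φ x ≡ y) where

  -- Both lists are free of duplicates and have the same members, hence agree as bags. Cardinalities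
  -- and formal sums see a list only up to permutation, so this gives both `size-bijection` and
  -- `∑-reindex`.
  elements-↭ : map φ (elements I) ↭ elements J
  elements-↭ = ∼bag⇒↭ (unique∧set⇒bag (Unique.map⁺ injective (unique I)) (unique J)
    (λ {y} → mk⇔ (λ _ → complete J y) λ _ → let x , eq = surjective y in
      subst (_∈ₗ map φ (elements I)) eq (∈-map⁺ φ (complete I x))))

  size-bijection : size I ≡ size J
  size-bijection = trans (sym (List.length-map φ (elements I))) (↭-length elements-↭)

-- Recursive rather than a fraction, so that `concatMap-const` adds one equal term per unfolding.
-- The link with the quotients `1/ n !` is `fromℕ-inverse`.
fromℕ : ℕ → ℚ
fromℕ zero    = 0ℚ
fromℕ (suc n) = 1ℚ ℚ.+ fromℕ n

module Sums (S : Setoid 0ℓ 0ℓ) where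
  open FreeVectorSpace S renaming (_≈_ to _≃_)

  ≡⇒≃ : ∀ {u v} → u ≡ v → u ≃ v
  ≡⇒≃ refl = ≈-refl

  module _ {I : Set} where

    concatMap-cong-≃ : ∀ {f g : I → Combination} → (∀ i → f i ≃ g i) → ∀ is → concatMap f is ≃ concatMap g is
    concatMap-cong-≃ h []       = ≈-refl
    concatMap-cong-≃ h (i ∷ is) = ++-cong (h i) (concatMap-cong-≃ h is)

    concatMap-↭ : ∀ (f : I → Combination) {is js} → is ↭ js → concatMap f is ≃ concatMap f js
    concatMap-↭ f Permutation.refl         = ≈-refl
    concatMap-↭ f (Permutation.prep i r)   = ++-cong (≈-refl {f i}) (concatMap-↭ f r)
    concatMap-↭ f (Permutation.swap {xs} {ys} i j r) = ≈-trans
      (≡⇒≃ (sym (List.++-assoc (f i) (f j) (concatMap f xs))))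
      (≈-trans (++-cong (++-comm (f i) (f j)) (concatMap-↭ f r))
               (≡⇒≃ (List.++-assoc (f j) (f i) (concatMap f ys))))
    concatMap-↭ f (Permutation.trans r s)  = ≈-trans (concatMap-↭ f r) (concatMap-↭ f s)

    -- Where a term is constant on a fibre, the fibre enters only through its size. Both countings
    -- of labelled partitions reach the coefficients this way.
    concatMap-const : ∀ c x (is : List I) →
      concatMap (λ _ → (c , x) ∷ []) is ≃ (fromℕ (length is) ℚ.* c , x) ∷ []
    concatMap-const c x []       = ≈-trans (≈-sym (zero x)) (≡⇒≃ (cong (λ d → (d , x) ∷ []) (sym (ℚ.*-zeroˡ c))))
    concatMap-const c x (i ∷ is) = ≈-trans
      (++-cong (≈-refl {(c , x) ∷ []}) (concatMap-const c x is))
      (≈-trans (add c (fromℕ (length is) ℚ.* c) x) (≡⇒≃ (cong (λ d → (d , x) ∷ []) eq)))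
      where
      eq : c ℚ.+ fromℕ (length is) ℚ.* c ≡ (1ℚ ℚ.+ fromℕ (length is)) ℚ.* c
      eq = trans (cong (ℚ._+ fromℕ (length is) ℚ.* c) (sym (ℚ.*-identityˡ c)))
                 (sym (ℚ.*-distribʳ-+ c 1ℚ (fromℕ (length is))))

  ∑-reindex : ∀ {A B : Set} (I : Finite A) (J : Finite B) (φ : A → B) →
    (∀ {x y} → φ x ≡ φ y → x ≡ y) → (∀ y → ∃[ x ] φ x ≡ y) →
    ∀ f → ∑ I (f ∘ φ) ≃ ∑ J f
  ∑-reindex I J φ inj sur f = ≈-trans
    (≡⇒≃ (sym (List.concatMap-map f φ (elements I)))) (concatMap-↭ f (elements-↭ I J φ inj sur))

  ∑-Σ : ∀ {A : Set} {B : A → Set} (I : Finite A) (J : ∀ a → Finite (B a)) (f : Σ A B → Combination) →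
    ∑ (Σ-finite I J) f ≡ ∑ I (λ a → ∑ (J a) (λ b → f (a , b)))
  ∑-Σ {B = B} I J f = go (elements I)
    where
    go : ∀ xs → concatMap f (pairs xs (λ a → elements (J a))) ≡ concatMap (λ a → ∑ (J a) (λ b → f (a , b))) xs
    go []       = refl
    go (x ∷ xs) = trans (List.concatMap-++ f (map (pairWith {B = B} x) (elements (J x))) _)
      (cong₂ _++_ (List.concatMap-map f (pairWith {B = B} x) (elements (J x))) (go xs))

-- Semi-pointed partitions as equivalence relations

module _ {n p : ℕ} where

  Same : SemiPointed n p → Fin n → Fin n → Set
  Same x i j = j ∈ support (blockAt x i)

  pointAt : SemiPointed n p → Fin n → Maybe (Fin n)
  pointAt x i = point (blockAt x i)

  module _ (x : SemiPointed n p) where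

    open IsSemiPointed (isSemiPointed x)

    same? : ∀ i j → Dec (Same x i j)
    same? i j = j ∈? support (blockAt x i)

    same-refl : ∀ {i} → Same x i i
    same-refl = self∈block x _

    same-sym : ∀ {i j} → Same x i j → Same x j i
    same-sym {i} {j} s = subst (λ b → i ∈ support b) (sym (sameBlock x s)) (self∈block x i)

    same-trans : ∀ {i j k} → Same x i j → Same x j k → Same x i k
    same-trans {k = k} s t = subst (λ b → k ∈ support b) (sameBlock x s) t

    same-reflexive : ∀ {i j} → i ≡ j → Same x i j
    same-reflexive refl = same-refl

    pointAt-cong : ∀ {i j} → Same x i j → pointAt x i ≡ pointAt x j
    pointAt-cong s = cong point (sym (sameBlock x s))

    point-same : ∀ {i e} → pointAt x i ≡ just e → Same x i e
    point-same {i} {e} eq = proj₁ (x∈p∩q⁻ _ _ (pointed i e eq))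

    point-fixed : ∀ {i e} → pointAt x i ≡ just e → pointAt x e ≡ just e
    point-fixed eq = trans (sym (pointAt-cong (point-same eq))) eq

    point<p : ∀ {i e} → pointAt x i ≡ just e → toℕ e < p
    point<p {i} {e} eq = ∈V₁⁻ p (proj₂ (x∈p∩q⁻ (support (blockAt x i)) _ (pointed i e eq)))

    -- A block avoiding V₂ would lie in V₁ and would have to be pointed. Since the ground set is
    -- finite and membership decidable, this refutation yields a witness.
    unpointed-V₂ : ∀ {i} → pointAt x i ≡ nothing → ∃[ j ] Same x i j × p ≤ toℕ j
    unpointed-V₂ {i} eq with Fin.¬∀⟶∃¬ n (λ j → Same x i j → toℕ j < p) (λ j → same? i j →-dec toℕ j <? p)
                               (λ all → inside-V₁ i (λ {j} s → ∈V₁⁺ p (all j s)) eq)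
    ... | j , ¬imp with same? i j
    ... | yes s = j , s , ℕ.≮⇒≥ (λ lt → ¬imp (λ _ → lt))
    ... | no ¬s = contradiction (λ s → contradiction s ¬s) ¬imp

  module _ {x y : SemiPointed n p} where

    ⊑-intro : (∀ {i j} → Same y i j → Same x i j) → (∀ i → ∃[ j ] Same x i j × pointAt y j ≡ pointAt x i) → x ⊑ y
    ⊑-intro h r i = (λ j s t → same-trans x s (h t)) , r i

    ⊑-same : x ⊑ y → ∀ {i j} → Same y i j → Same x i j
    ⊑-same x⊑y {i} s = proj₁ (x⊑y i) i (same-refl x) s

    ⊑-point : x ⊑ y → ∀ i → ∃[ j ] Same x i j × pointAt y j ≡ pointAt x i
    ⊑-point x⊑y i = proj₂ (x⊑y i)

    ⊑-pointed : x ⊑ y → ∀ {i e} → pointAt x i ≡ just e → pointAt y e ≡ just e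
    ⊑-pointed x⊑y {i} eq = let j , _ , eq′ = ⊑-point x⊑y i in point-fixed y (trans eq′ eq)

    semiPointed-ext : (∀ {i j} → Same x i j → Same y i j) → (∀ {i j} → Same y i j → Same x i j) →
      (∀ i → pointAt x i ≡ pointAt y i) → x ≡ y
    semiPointed-ext f g e = ⊑-antisym {x = x} {y = y}
      (λ i → (λ j s t → same-trans x s (g t)) , i , same-refl x , sym (e i))
      (λ i → (λ j s t → same-trans y s (f t)) , i , same-refl y , e i)

-- The interface through which partitions are constructed. `unpt` is a positive form of `inside-V₁`,
-- while `inside-V₂` follows from `pt-in` and `pt<p`.
record PartitionData (n p : ℕ) : Set₁ where
  field
    _≋_     : Fin n → Fin n → Set
    _≋?_    : ∀ i j → Dec (i ≋ j)
    ≋-refl  : ∀ {i} → i ≋ i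
    ≋-sym   : ∀ {i j} → i ≋ j → j ≋ i
    ≋-trans : ∀ {i j k} → i ≋ j → j ≋ k → i ≋ k
    pt      : Fin n → Maybe (Fin n)
    pt-cong : ∀ {i j} → i ≋ j → pt i ≡ pt j
    pt-in   : ∀ {i e} → pt i ≡ just e → i ≋ e
    pt<p    : ∀ {i e} → pt i ≡ just e → toℕ e < p
    unpt    : ∀ {i} → pt i ≡ nothing → ∃[ j ] i ≋ j × p ≤ toℕ j

does-≡ : ∀ {A B : Set} (a? : Dec A) (b? : Dec B) → (A → B) → (B → A) → does a? ≡ does b?
does-≡ (yes a) b? f g = sym (dec-true b? (f a))
does-≡ (no ¬a) b? f g = sym (dec-false b? (¬a ∘ g))

does⇒ : ∀ {A : Set} (a? : Dec A) → does a? ≡ true → A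
does⇒ (yes a) _ = a

module _ {n p : ℕ} (D : PartitionData n p) where
  open PartitionData D

  private
    block : Fin n → Block n
    block i = tabulate (λ j → does (i ≋? j)) , pt i

    v : Vec (Block n) n
    v = tabulate block

    ∈-block : ∀ {i j} → i ≋ j → j ∈ support (block i)
    ∈-block {i} {j} s = Vec.lookup⇒[]= j _ (trans (Vec.lookup∘tabulate _ j) (dec-true (i ≋? j) s))

    ∈-block⁻ : ∀ {i j} → j ∈ support (block i) → i ≋ j
    ∈-block⁻ {i} {j} s = does⇒ (i ≋? j) (trans (sym (Vec.lookup∘tabulate _ j)) (Vec.[]=⇒lookup s))

    at : ∀ i → lookup v i ≡ block i
    at = Vec.lookup∘tabulate block

    ∈-at : ∀ {i j} → i ≋ j → j ∈ support (lookup v i)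
    ∈-at {i} {j} s = subst (λ b → j ∈ support b) (sym (at i)) (∈-block s)

    ∈-at⁻ : ∀ {i j} → j ∈ support (lookup v i) → i ≋ j
    ∈-at⁻ {i} {j} s = ∈-block⁻ (subst (λ b → j ∈ support b) (at i) s)

    pt-at : ∀ i → point (lookup v i) ≡ pt i
    pt-at i = cong point (at i)

    inside₁ : ∀ i → support (lookup v i) ⊆ V₁ p → point (lookup v i) ≢ nothing
    inside₁ i sub eq with unpt (trans (sym (pt-at i)) eq)
    ... | j , s , p≤j = ℕ.<⇒≱ (∈V₁⁻ p (sub (∈-at s))) p≤j

    inside₂ : ∀ i → support (lookup v i) ⊆ V₂ p → point (lookup v i) ≡ nothing
    inside₂ i sub with point (lookup v i) in eq
    ... | nothing = refl
    ... | just e  = contradiction (∈V₁⁺ p (pt<p (trans (sym (pt-at i)) eq)))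
                      (x∈∁p⇒x∉p (sub (∈-at (pt-in (trans (sym (pt-at i)) eq)))))

    valid : IsSemiPointed p v
    valid = record
      { contains  = λ i → ∈-at ≋-refl
      ; constant  = λ i j s → let s′ = ∈-at⁻ s in trans (at j) (trans (cong₂ _,_
                      (Vec.tabulate-cong λ k → does-≡ (j ≋? k) (i ≋? k) (≋-trans s′) (≋-trans (≋-sym s′)))
                      (sym (pt-cong s′))) (sym (at i)))
      ; pointed   = λ i e eq → let eq′ = trans (sym (pt-at i)) eq in
                      x∈p∩q⁺ (∈-at (pt-in eq′) , ∈V₁⁺ p (pt<p eq′))
      ; inside-V₁ = inside₁
      ; inside-V₂ = inside₂
      }

  build : SemiPointed n p
  build = v , [ valid ]

  same-build⁺ : ∀ {i j} → i ≋ j → Same build i j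
  same-build⁺ = ∈-at

  same-build⁻ : ∀ {i j} → Same build i j → i ≋ j
  same-build⁻ = ∈-at⁻

  pointAt-build : ∀ i → pointAt build i ≡ pt i
  pointAt-build = pt-at

module _ {n p : ℕ} where

  same-singletons : ∀ {i j} → Same (singletons n p) i j → i ≡ j
  same-singletons {i} {j} s = sym (x∈⁅y⁆⇒x≡y i (subst (j ∈_)
    (trans (cong support (lookup-singletons n p i)) (singletonBlock-support p i)) s))

  pointAt-singletons-< : ∀ {i} → toℕ i < p → pointAt (singletons n p) i ≡ just i
  pointAt-singletons-< {i} i<p rewrite lookup-singletons n p i with toℕ i <? p
  ... | yes _  = refl
  ... | no i≮p = contradiction i<p i≮p

  pointAt-singletons-≥ : ∀ {i} → p ≤ toℕ i → pointAt (singletons n p) i ≡ nothing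
  pointAt-singletons-≥ {i} p≤i rewrite lookup-singletons n p i with toℕ i <? p
  ... | yes i<p = contradiction p≤i (ℕ.<⇒≱ i<p)
  ... | no _    = refl

  ⊑-singletons : ∀ {x} → x ⊑ singletons n p
  ⊑-singletons {x} = ⊑-intro {x = x} {y = singletons n p} (λ s → same-reflexive x (same-singletons s)) root
    where
    root : ∀ i → ∃[ j ] Same x i j × pointAt (singletons n p) j ≡ pointAt x i
    root i with pointAt x i in eq
    ... | just e  = e , point-same x eq , pointAt-singletons-< (point<p x eq)
    ... | nothing = let j , s , p≤j = unpointed-V₂ x eq in j , s , pointAt-singletons-≥ p≤j

  module _ {o : Fin 2} .(d : Defined n p o) where

    same-oneBlock : ∀ {i j} → Same (oneBlock n p o d) i j
    same-oneBlock {i} {j} = subst (λ b → j ∈ support b) (sym (lookup-oneBlock n o i)) ∈⊤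

    pointAt-oneBlock : ∀ i → pointAt (oneBlock n p o d) i ≡ rootPoint n o
    pointAt-oneBlock i = cong point (lookup-oneBlock n o i)

    -- Every block lies in the single block, so membership in the maximal interval amounts to some
    -- block of `x` carrying the pointing of the root.
    oneBlock-⊑ : ∀ {x} → ∃[ j ] pointAt x j ≡ rootPoint n o → oneBlock n p o d ⊑ x
    oneBlock-⊑ {x} (j , eq) = ⊑-intro {x = oneBlock n p o d} {y = x} (λ _ → same-oneBlock)
      (λ i → j , same-oneBlock , trans eq (sym (pointAt-oneBlock i)))

    oneBlock-⊑⁻ : Fin n → ∀ {x} → oneBlock n p o d ⊑ x → ∃[ j ] pointAt x j ≡ rootPoint n o
    oneBlock-⊑⁻ i {x} le = let j , _ , eq = ⊑-point {x = oneBlock n p o d} {y = x} le i in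
      j , trans eq (pointAt-oneBlock i)

firstElement : ∀ {n p} o → Defined n p o → Fin n
firstElement {suc n} o          d       = zero
firstElement {zero}  zero       ()
firstElement {zero}  (suc zero) (1≤p , p≤0) = contradiction (ℕ.≤-trans 1≤p p≤0) (λ ())

rootPoint-1 : ∀ {n} {e : Fin n} → toℕ e ≡ 0 → rootPoint n (suc zero) ≡ just e
rootPoint-1 {suc n} {zero} refl = refl

-- Enumerations and labellings of blocks

-- By `enumeration-size` the number `m` is determined by `Q`. Lengths of filtered block lists and
-- letter counts are computed by exhibiting a second enumeration.
record Enumeration {A : Set} (Q : A → Set) (m : ℕ) : Set where
  field
    at         : Fin m → A
    at-∈       : ∀ i → Q (at i)
    injective  : ∀ {i j} → at i ≡ at j → i ≡ j
    surjective : ∀ {a} → Q a → ∃[ i ] at i ≡ a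

open Enumeration

enumeration-≤ : ∀ {A : Set} {Q : A → Set} {m m′} → Enumeration Q m → Enumeration Q m′ → m ≤ m′
enumeration-≤ E E′ = Fin.injective⇒≤ {f = λ i → proj₁ (surjective E′ (at-∈ E i))} λ {i} {j} eq →
  injective E (trans (sym (proj₂ (surjective E′ (at-∈ E i))))
    (trans (cong (at E′) eq) (proj₂ (surjective E′ (at-∈ E j)))))

enumeration-size : ∀ {A : Set} {Q : A → Set} {m m′} → Enumeration Q m → Enumeration Q m′ → m ≡ m′
enumeration-size E E′ = ℕ.≤-antisym (enumeration-≤ E E′) (enumeration-≤ E′ E)

lookup-injective : ∀ {A : Set} {xs : List A} → Unique xs → ∀ {i j} → List.lookup xs i ≡ List.lookup xs j → i ≡ j
lookup-injective (_ ∷ _)  {zero}  {zero}  eq = refl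
lookup-injective (x∉ ∷ _) {zero}  {suc j} eq = contradiction eq (All.lookup x∉ (∈-lookup j))
lookup-injective (x∉ ∷ _) {suc i} {zero}  eq = contradiction (sym eq) (All.lookup x∉ (∈-lookup i))
lookup-injective (_ ∷ u)  {suc i} {suc j} eq = cong suc (lookup-injective u eq)

enumerate : ∀ {A : Set} {xs : List A} → Unique xs → Enumeration (_∈ₗ xs) (length xs)
enumerate {xs = xs} u = record
  { at         = List.lookup xs
  ; at-∈       = ∈-lookup
  ; injective  = lookup-injective u
  ; surjective = λ a∈ → Any.index a∈ , sym (Any.lookup-index a∈)
  }

Label : ℕ → ℕ → Set
Label p q = Fin p ⊎ Fin q

_≟ᵘ_ : ∀ {p q} → DecidableEquality (Label p q)
_≟ᵘ_ = Sum.≡-dec Fin._≟_ Fin._≟_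

-- `rep-pointed` forces the representative of a pointed block to be its point, so points travel
-- between `x` and the set of labels through `rep` alone. The representative of an unpointed block
-- is a free choice.
record Labelling {n k : ℕ} (x : SemiPointed n k) (p q : ℕ) : Set where
  field
    label         : Fin n → Label p q
    same⇒label    : ∀ {i j} → Same x i j → label i ≡ label j
    label⇒same    : ∀ {i j} → label i ≡ label j → Same x i j
    rep           : Label p q → Fin n
    label-rep     : ∀ u → label (rep u) ≡ u
    rep-pointed   : ∀ a → pointAt x (rep (inj₁ a)) ≡ just (rep (inj₁ a))
    rep-unpointed : ∀ b → pointAt x (rep (inj₂ b)) ≡ nothing

  rep-same : ∀ {i u} → label i ≡ u → Same x i (rep u)
  rep-same {u = u} eq = label⇒same (trans eq (sym (label-rep u)))

  label-pointed : ∀ {i a} → label i ≡ inj₁ a → pointAt x i ≡ just (rep (inj₁ a))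
  label-pointed {a = a} eq = trans (pointAt-cong x (rep-same eq)) (rep-pointed a)

  label-unpointed : ∀ {i b} → label i ≡ inj₂ b → pointAt x i ≡ nothing
  label-unpointed {b = b} eq = trans (pointAt-cong x (rep-same eq)) (rep-unpointed b)

  pointed-label : ∀ {i e} → pointAt x i ≡ just e → ∃[ a ] label i ≡ inj₁ a × rep (inj₁ a) ≡ e
  pointed-label {i} eq with label i in eqₗ
  ... | inj₁ a = a , refl , just-injective (trans (sym (label-pointed eqₗ)) eq)
  ... | inj₂ b = contradiction (trans (sym (label-unpointed eqₗ)) eq) λ ()

  unpointed-label : ∀ {i} → pointAt x i ≡ nothing → ∃[ b ] label i ≡ inj₂ b
  unpointed-label {i} eq with label i in eqₗ
  ... | inj₁ a = contradiction (trans (sym (label-pointed eqₗ)) eq) λ ()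
  ... | inj₂ b = b , refl

  rep-fixed : ∀ {e} → pointAt x e ≡ just e → rep (label e) ≡ e
  rep-fixed eq = let a , eqₗ , r = pointed-label eq in trans (cong rep eqₗ) r

isPointed? : ∀ {n} → Decidable (λ (b : Block n) → point b ≢ nothing)
isPointed? b = ¬? (point b ≟ᵐ nothing)

isUnpointed? : ∀ {n} → Decidable (λ (b : Block n) → point b ≡ nothing)
isUnpointed? b = point b ≟ᵐ nothing

module _ {n k : ℕ} (x : SemiPointed n k) where

  ∈-blocks : ∀ i → blockAt x i ∈ₗ blocks x
  ∈-blocks i = ∈-deduplicate⁺ _≟ᵇ_ (∈-toList⁺ (∈-lookupᵥ i (value x)))

  ∈-blocks⁻ : ∀ {b} → b ∈ₗ blocks x → ∃[ i ] blockAt x i ≡ b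
  ∈-blocks⁻ b∈ = let b∈ᵥ = ∈-toList⁻ (∈-deduplicate⁻ _≟ᵇ_ (toList (value x)) b∈) in
    VecAny.index b∈ᵥ , sym (VecAny.lookup-index b∈ᵥ)

  sameBlock⁻ : ∀ {i j} → blockAt x i ≡ blockAt x j → Same x i j
  sameBlock⁻ {i} {j} eq = subst (λ b → j ∈ support b) (sym eq) (same-refl x)

  module _ {P : Block n → Set} (P? : Decidable P) where

    enumerateBlocks : Enumeration (_∈ₗ filter P? (blocks x)) (length (filter P? (blocks x)))
    enumerateBlocks = enumerate (Unique.filter⁺ P? (deduplicate-! _≟ᵇ_ (toList (value x))))

    -- Representatives of pairwise different blocks give a second enumeration of the selected
    -- blocks, to be compared with the one coming from the list.
    blockCount : ∀ {m} (rep : Fin m → Fin n) → (∀ a → P (blockAt x (rep a))) →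
      (∀ {a b} → Same x (rep a) (rep b) → a ≡ b) → (∀ {i} → P (blockAt x i) → ∃[ a ] Same x (rep a) i) →
      length (filter P? (blocks x)) ≡ m
    blockCount rep P-rep inj sur = enumeration-size enumerateBlocks record
      { at         = blockAt x ∘ rep
      ; at-∈       = λ a → ∈-filter⁺ P? (∈-blocks (rep a)) (P-rep a)
      ; injective  = λ eq → inj (sameBlock⁻ eq)
      ; surjective = λ {b} b∈ → let b∈′ , Pb = ∈-filter⁻ P? {xs = blocks x} b∈
                                    i , eq = ∈-blocks⁻ b∈′
                                    a , s = sur (subst P (sym eq) Pb)
                                in a , trans (sym (sameBlock x s)) eq
      }

  module _ {p q : ℕ} (L : Labelling x p q) where
    open Labelling L

    labelling-pointed : pointedBlocks x ≡ p
    labelling-pointed = blockCount isPointed? (rep ∘ inj₁)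
      (λ a eq → contradiction (trans (sym (rep-pointed a)) eq) λ ())
      (λ s → inj₁-injective (trans (sym (label-rep _)) (trans (same⇒label s) (label-rep _))))
      sur
      where
      sur : ∀ {i} → pointAt x i ≢ nothing → ∃[ a ] Same x (rep (inj₁ a)) i
      sur {i} ne with label i in eq
      ... | inj₁ a = a , same-sym x (rep-same eq)
      ... | inj₂ b = contradiction (label-unpointed eq) ne

    labelling-unpointed : unpointedBlocks x ≡ q
    labelling-unpointed = blockCount isUnpointed? (rep ∘ inj₂) rep-unpointed
      (λ s → inj₂-injective (trans (sym (label-rep _)) (trans (same⇒label s) (label-rep _))))
      (λ eq → let b , eqₗ = unpointed-label eq in b , same-sym x (rep-same eqₗ))

  private
    EP = enumerateBlocks isPointed?
    EU = enumerateBlocks isUnpointed?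

    atBlock : Label (pointedBlocks x) (unpointedBlocks x) → Block n
    atBlock (inj₁ a) = at EP a
    atBlock (inj₂ b) = at EU b

    EP-pointed : ∀ a → point (at EP a) ≢ nothing
    EP-pointed a = proj₂ (∈-filter⁻ isPointed? {xs = blocks x} (at-∈ EP a))

    EU-unpointed : ∀ b → point (at EU b) ≡ nothing
    EU-unpointed b = proj₂ (∈-filter⁻ isUnpointed? {xs = blocks x} (at-∈ EU b))

    atBlock-injective : ∀ {u v} → atBlock u ≡ atBlock v → u ≡ v
    atBlock-injective {inj₁ a} {inj₁ b} eq = cong inj₁ (injective EP eq)
    atBlock-injective {inj₁ a} {inj₂ b} eq = contradiction (trans (cong point eq) (EU-unpointed b)) (EP-pointed a)
    atBlock-injective {inj₂ a} {inj₁ b} eq = contradiction (trans (cong point (sym eq)) (EU-unpointed a)) (EP-pointed b)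
    atBlock-injective {inj₂ a} {inj₂ b} eq = cong inj₂ (injective EU eq)

    labelOf : ∀ i → ∃[ u ] atBlock u ≡ blockAt x i
    labelOf i with isUnpointed? (blockAt x i)
    ... | yes u = let b , eq = surjective EU (∈-filter⁺ isUnpointed? (∈-blocks i) u) in inj₂ b , eq
    ... | no ¬u = let a , eq = surjective EP (∈-filter⁺ isPointed? (∈-blocks i) ¬u) in inj₁ a , eq

    member : ∀ u → ∃[ i ] blockAt x i ≡ atBlock u
    member (inj₁ a) = ∈-blocks⁻ (proj₁ (∈-filter⁻ isPointed? {xs = blocks x} (at-∈ EP a)))
    member (inj₂ b) = ∈-blocks⁻ (proj₁ (∈-filter⁻ isUnpointed? {xs = blocks x} (at-∈ EU b)))

    repOf : ∀ u → ∃[ i ] blockAt x i ≡ atBlock u × (∀ {e} → pointAt x i ≡ just e → i ≡ e)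
    repOf u with member u
    ... | i , eq with pointAt x i in eqₚ
    ... | nothing = i , eq , λ eq′ → contradiction (trans (sym eqₚ) eq′) λ ()
    -- An arbitrary member of a pointed block is traded for the point of that block.
    ... | just e  = e , trans (sameBlock x (point-same x eqₚ)) eq ,
                    λ eq′ → just-injective (trans (sym (point-fixed x eqₚ)) eq′)

    rep-pointed′ : ∀ a → pointAt x (proj₁ (repOf (inj₁ a))) ≡ just (proj₁ (repOf (inj₁ a)))
    rep-pointed′ a with repOf (inj₁ a)
    ... | i , eq , fixed with pointAt x i in eqₚ
    ... | nothing = contradiction (trans (sym (cong point eq)) eqₚ) (EP-pointed a)
    ... | just e  = cong just (sym (fixed refl))

  canonicalLabelling : Labelling x (pointedBlocks x) (unpointedBlocks x)
  canonicalLabelling = record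
    { label         = λ i → proj₁ (labelOf i)
    ; same⇒label    = λ {i} {j} s → atBlock-injective
                        (trans (proj₂ (labelOf i)) (trans (sym (sameBlock x s)) (sym (proj₂ (labelOf j)))))
    ; label⇒same    = λ {i} {j} eq → sameBlock⁻ (trans (sym (proj₂ (labelOf i))) (trans (cong atBlock eq) (proj₂ (labelOf j))))
    ; rep           = λ u → proj₁ (repOf u)
    ; label-rep     = λ u → atBlock-injective (trans (proj₂ (labelOf _)) (proj₁ (proj₂ (repOf u))))
    ; rep-pointed   = rep-pointed′
    ; rep-unpointed = λ b → trans (cong point (proj₁ (proj₂ (repOf (inj₂ b))))) (EU-unpointed b)
    }

  private
    firstBlock : ∀ {P : Block n → Set} (P? : Decidable P) {m} (v : Vec (Block n) m) {e : Fin m} →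
      toℕ e ≡ 0 → P (lookup v e) →
      ∃[ a ] toℕ a ≡ 0 × List.lookup (filter P? (deduplicate _≟ᵇ_ (toList v))) a ≡ lookup v e
    firstBlock P? (b ∷ v) {zero} refl Pb with P? b
    ... | yes _ = zero , refl , refl
    ... | no ¬p = contradiction Pb ¬p

  -- blocks x lists the block of the first element first.
  canonicalLabelling-root : ∀ {e} → toℕ e ≡ 0 → pointAt x e ≡ just e →
    ∃[ a ] Labelling.label canonicalLabelling e ≡ inj₁ a × toℕ a ≡ 0
  canonicalLabelling-root {e} e≡0 eq with firstBlock isPointed? (value x) e≡0 (λ eq′ → contradiction (trans (sym eq) eq′) λ ())
  ... | a , a≡0 , eqₐ = a , atBlock-injective (trans (proj₂ (labelOf e)) (sym eqₐ)) , a≡0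

-- The interval above a partition

module _ {A B : Set} {f : A → B} where

  map-just⁻ : ∀ {m b} → Maybe.map f m ≡ just b → ∃[ a ] m ≡ just a × f a ≡ b
  map-just⁻ {just a} eq = a , refl , Maybe.just-injective eq

  map-nothing⁻ : ∀ {m} → Maybe.map f m ≡ nothing → m ≡ nothing
  map-nothing⁻ {nothing} eq = refl

toℕ-join-inj₁ : ∀ p q (a : Fin p) → toℕ (join p q (inj₁ a)) ≡ toℕ a
toℕ-join-inj₁ p q a = Fin.toℕ-↑ˡ a q

join-inj₁-< : ∀ p q a → toℕ (join p q (inj₁ a)) < p
join-inj₁-< p q a = subst (_< p) (sym (toℕ-join-inj₁ p q a)) (Fin.toℕ<n a)

join-inj₂-≥ : ∀ p q b → p ≤ toℕ (join p q (inj₂ b))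
join-inj₂-≥ p q b = subst (p ≤_) (sym (Fin.toℕ-↑ʳ p b)) (ℕ.m≤m+n p (toℕ b))

splitAt-cases : ∀ p q (u : Fin (p + q)) →
  (∃[ a ] u ≡ join p q (inj₁ a)) ⊎ (∃[ b ] u ≡ join p q (inj₂ b))
splitAt-cases p q u with splitAt p u | Fin.join-splitAt p q u
... | inj₁ a | eq = inj₁ (a , sym eq)
... | inj₂ b | eq = inj₂ (b , sym eq)

module _ {n p : ℕ} where

  singletonsLabelling : ∀ q → Labelling (singletons (p + q) p) p q
  singletonsLabelling q = record
    { label         = splitAt p
    ; same⇒label    = λ s → cong (splitAt p) (same-singletons s)
    ; label⇒same    = λ {i} {j} eq → same-reflexive (singletons (p + q) p)
        (trans (sym (Fin.join-splitAt p q i)) (trans (cong (join p q) eq) (Fin.join-splitAt p q j)))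
    ; rep           = join p q
    ; label-rep     = Fin.splitAt-join p q
    ; rep-pointed   = λ a → pointAt-singletons-< (join-inj₁-< p q a)
    ; rep-unpointed = λ b → pointAt-singletons-≥ (join-inj₂-≥ p q b)
    }

  singletons-pointed : ∀ {q} → n ≡ p + q → pointedBlocks (singletons n p) ≡ p
  singletons-pointed {q} refl = labelling-pointed (singletons n p) (singletonsLabelling q)

  singletons-unpointed : ∀ {q} → n ≡ p + q → unpointedBlocks (singletons n p) ≡ q
  singletons-unpointed {q} refl = labelling-unpointed (singletons n p) (singletonsLabelling q)

oneBlockLabelling : ∀ {n p} o (d : Defined n p o) → Labelling (oneBlock n p o d) (toℕ o) (1 ∸ toℕ o)
oneBlockLabelling {n} {p} zero d = record
  { label         = λ _ → inj₂ zero
  ; same⇒label    = λ _ → refl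
  ; label⇒same    = λ {i} {j} _ → same-oneBlock {p = p} d {i} {j}
  ; rep           = λ _ → firstElement zero d
  ; label-rep     = λ { (inj₂ zero) → refl }
  ; rep-pointed   = λ ()
  ; rep-unpointed = λ _ → pointAt-oneBlock {p = p} d (firstElement zero d)
  }
oneBlockLabelling {suc n} {p} (suc zero) d = record
  { label         = λ _ → inj₁ zero
  ; same⇒label    = λ _ → refl
  ; label⇒same    = λ {i} {j} _ → same-oneBlock {p = p} d {i} {j}
  ; rep           = λ _ → zero
  ; label-rep     = λ { (inj₁ zero) → refl }
  ; rep-pointed   = λ _ → pointAt-oneBlock {p = p} d zero
  ; rep-unpointed = λ ()
  }
oneBlockLabelling {zero} (suc zero) d = contradiction (firstElement (suc zero) d) λ ()

∣P∣-⊑ : ∀ {n k o d} (x : ∣ P n k o d ∣) → oneBlock n k o d ⊑ value x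
∣P∣-⊑ {n} {k} {o} {d} (x , [ h ]) = recompute (oneBlock n k o d ⊑? x) (proj₁ h)

module Quotient {n k p q : ℕ} {x : SemiPointed n k} (L : Labelling x p q) where
  open Labelling L

  blk : Fin n → Fin (p + q)
  blk i = join p q (label i)

  srep : Fin (p + q) → Fin n
  srep u = rep (splitAt p u)

  blk-srep : ∀ u → blk (srep u) ≡ u
  blk-srep u = trans (cong (join p q) (label-rep (splitAt p u))) (Fin.join-splitAt p q u)

  srep-injective : ∀ {u v} → srep u ≡ srep v → u ≡ v
  srep-injective {u} {v} eq = trans (sym (blk-srep u)) (trans (cong blk eq) (blk-srep v))

  srep-blk : ∀ i → srep (blk i) ≡ rep (label i)
  srep-blk i = cong rep (Fin.splitAt-join p q (label i))

  same-srep-blk : ∀ i → Same x i (srep (blk i))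
  same-srep-blk i = subst (Same x i) (sym (srep-blk i)) (rep-same refl)

  same⇒blk : ∀ {i j} → Same x i j → blk i ≡ blk j
  same⇒blk s = cong (join p q) (same⇒label s)

  srep-fixed : ∀ {e} → pointAt x e ≡ just e → srep (blk e) ≡ e
  srep-fixed {e} eq = trans (srep-blk e) (rep-fixed eq)

  srep-< : ∀ {u} → toℕ u < p → pointAt x (srep u) ≡ just (srep u)
  srep-< {u} u<p with splitAt-cases p q u
  ... | inj₁ (a , refl) rewrite Fin.splitAt-↑ˡ p a q = rep-pointed a
  ... | inj₂ (b , refl) = contradiction (join-inj₂-≥ p q b) (ℕ.<⇒≱ u<p)

  srep-≥ : ∀ {u} → p ≤ toℕ u → pointAt x (srep u) ≡ nothing
  srep-≥ {u} p≤u with splitAt-cases p q u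
  ... | inj₁ (a , refl) = contradiction p≤u (ℕ.<⇒≱ (join-inj₁-< p q a))
  ... | inj₂ (b , refl) rewrite Fin.splitAt-↑ʳ p q b = rep-unpointed b

  blk-< : ∀ {i e} → pointAt x i ≡ just e → toℕ (blk i) < p
  blk-< eq = let a , eqₗ , _ = pointed-label eq in
    subst (λ u → toℕ (join p q u) < p) (sym eqₗ) (join-inj₁-< p q a)

  blk-≥ : ∀ {i} → pointAt x i ≡ nothing → p ≤ toℕ (blk i)
  blk-≥ eq = let b , eqₗ = unpointed-label eq in
    subst (λ u → p ≤ toℕ (join p q u)) (sym eqₗ) (join-inj₂-≥ p q b)

  module _ (y : SemiPointed (p + q) p) where

    -- Labels are merged as `y` prescribes. Points pass through `srep`, which sends a pointed label
    -- to the point of its block in `x`; so a merged block is pointed where one of its constituents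
    -- is, as the order requires.
    pullData : PartitionData n k
    pullData = record
      { _≋_     = λ i j → Same y (blk i) (blk j)
      ; _≋?_    = λ i j → same? y (blk i) (blk j)
      ; ≋-refl  = same-refl y
      ; ≋-sym   = same-sym y
      ; ≋-trans = same-trans y
      ; pt      = λ i → Maybe.map srep (pointAt y (blk i))
      ; pt-cong = λ s → cong (Maybe.map srep) (pointAt-cong y s)
      ; pt-in   = λ {i} eq → let u , eq′ , r = map-just⁻ eq in
                    subst (Same y (blk i)) (trans (sym (blk-srep u)) (cong blk r)) (point-same y eq′)
      ; pt<p    = λ eq → let u , eq′ , r = map-just⁻ eq in
                    subst (λ e → toℕ e < k) r (point<p x (srep-< (point<p y eq′)))
      ; unpt    = λ {i} eq → let u , s , p≤u = unpointed-V₂ y (map-nothing⁻ {m = pointAt y (blk i)} eq)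
                                 j , s′ , k≤j = unpointed-V₂ x (srep-≥ p≤u)
                             in j , subst (Same y (blk i)) (trans (sym (blk-srep u)) (same⇒blk s′)) s , k≤j
      }

    pull : SemiPointed n k
    pull = build pullData

    same-pull : ∀ {i j} → Same y (blk i) (blk j) → Same pull i j
    same-pull = same-build⁺ pullData

    same-pull⁻ : ∀ {i j} → Same pull i j → Same y (blk i) (blk j)
    same-pull⁻ = same-build⁻ pullData

    pointAt-pull : ∀ i → pointAt pull i ≡ Maybe.map srep (pointAt y (blk i))
    pointAt-pull = pointAt-build pullData

    pull-⊑ : pull ⊑ x
    pull-⊑ = ⊑-intro {x = pull} {y = x} (λ s → same-pull (same-reflexive y (same⇒blk s))) root
      where
      root : ∀ i → ∃[ j ] Same pull i j × pointAt x j ≡ pointAt pull i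
      root i with pointAt y (blk i) in eq
      ... | just u  = srep u , same-pull (subst (Same y (blk i)) (sym (blk-srep u)) (point-same y eq)) ,
                      trans (srep-< (point<p y eq)) (sym (trans (pointAt-pull i) (cong (Maybe.map srep) eq)))
      ... | nothing = let u , s , p≤u = unpointed-V₂ y eq in
                      srep u , same-pull (subst (Same y (blk i)) (sym (blk-srep u)) s) ,
                      trans (srep-≥ p≤u) (sym (trans (pointAt-pull i) (cong (Maybe.map srep) eq)))

  pull-mono : ∀ {y y′} → y ⊑ y′ → pull y ⊑ pull y′
  pull-mono {y} {y′} le = ⊑-intro {x = pull y} {y = pull y′}
    (λ s → same-pull y (⊑-same {x = y} {y = y′} le (same-pull⁻ y′ s)))
    (λ i → let u , s , eq = ⊑-point {x = y} {y = y′} le (blk i) in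
      srep u , same-pull y (subst (Same y (blk i)) (sym (blk-srep u)) s) ,
      trans (pointAt-pull y′ (srep u)) (trans (cong (Maybe.map srep) (trans (cong (pointAt y′) (blk-srep u)) eq))
        (sym (pointAt-pull y i))))

  pull-cancel : ∀ {y y′} → pull y ⊑ pull y′ → y ⊑ y′
  pull-cancel {y} {y′} le = ⊑-intro {x = y} {y = y′}
    (λ {u} {v} s → subst₂ (Same y) (blk-srep u) (blk-srep v) (same-pull⁻ y (⊑-same {x = pull y} {y = pull y′} le
      (same-pull y′ (subst₂ (Same y′) (sym (blk-srep u)) (sym (blk-srep v)) s)))))
    (λ u → let j , s , eq = ⊑-point {x = pull y} {y = pull y′} le (srep u) in
      blk j , subst (λ v → Same y v (blk j)) (blk-srep u) (same-pull⁻ y s) ,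
      Maybe.map-injective srep-injective (trans (sym (pointAt-pull y′ j)) (trans eq
        (trans (pointAt-pull y (srep u)) (cong (λ v → Maybe.map srep (pointAt y v)) (blk-srep u))))))

  module _ (z : SemiPointed n k) (z⊑x : z ⊑ x) where

    private
      x⇒z : ∀ {i j} → Same x i j → Same z i j
      x⇒z = ⊑-same {x = z} {y = x} z⊑x

      z-srep : ∀ i → Same z i (srep (blk i))
      z-srep i = x⇒z (same-srep-blk i)

    -- By `⊑-pointed` a point of the coarser `z` is already a point of `x`. Its label is therefore
    -- below `p`, and `srep` recovers the point from the label, which makes `pull` a left inverse on
    -- points too.
    pushData : PartitionData (p + q) p
    pushData = record
      { _≋_     = λ u v → Same z (srep u) (srep v)
      ; _≋?_    = λ u v → same? z (srep u) (srep v)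
      ; ≋-refl  = same-refl z
      ; ≋-sym   = same-sym z
      ; ≋-trans = same-trans z
      ; pt      = λ u → Maybe.map blk (pointAt z (srep u))
      ; pt-cong = λ s → cong (Maybe.map blk) (pointAt-cong z s)
      ; pt-in   = λ {u} eq → let e , eq′ , r = map-just⁻ eq in
                    same-trans z (point-same z eq′) (subst (λ v → Same z e (srep v)) r (z-srep e))
      ; pt<p    = λ eq → let e , eq′ , r = map-just⁻ eq in
                    subst (λ u → toℕ u < p) r (blk-< (⊑-pointed {x = z} {y = x} z⊑x eq′))
      ; unpt    = λ {u} eq → let j , s , eq′ = ⊑-point {x = z} {y = x} z⊑x (srep u) in
                    blk j , same-trans z s (z-srep j) ,
                    blk-≥ (trans eq′ (map-nothing⁻ {m = pointAt z (srep u)} eq))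
      }

    push : SemiPointed (p + q) p
    push = build pushData

    pointAt-push : ∀ i → pointAt push (blk i) ≡ Maybe.map blk (pointAt z i)
    pointAt-push i = trans (pointAt-build pushData (blk i))
      (cong (Maybe.map blk) (sym (pointAt-cong z (z-srep i))))

    pull-push : pull push ≡ z
    pull-push = semiPointed-ext {x = pull push} {y = z}
      (λ {i} {j} s → same-trans z (z-srep i) (same-trans z (same-build⁻ pushData (same-pull⁻ push s)) (same-sym z (z-srep j))))
      (λ {i} {j} s → same-pull push (same-build⁺ pushData
        (same-trans z (same-sym z (z-srep i)) (same-trans z s (z-srep j)))))
      (λ i → trans (pointAt-pull push i) (trans (cong (Maybe.map srep) (pointAt-push i)) (fixed i)))
      where
      fixed : ∀ i → Maybe.map srep (Maybe.map blk (pointAt z i)) ≡ pointAt z i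
      fixed i with pointAt z i in eq
      ... | nothing = refl
      ... | just e  = cong just (srep-fixed (⊑-pointed {x = z} {y = x} z⊑x eq))

module _ {n k p q o} (d : Defined n k o) (d′ : Defined (p + q) p o) (x : ∣ P n k o d ∣)
         (L : Labelling (value x) p q)
         (root : Maybe.map (Quotient.blk L) (rootPoint n o) ≡ rootPoint (p + q) o) where

  private
    module I = BoundedBlockPoset ⟦ P n k o d ⟧
    module J = BoundedBlockPoset ⟦ P (p + q) p o d′ ⟧
    module K = BoundedBlockPoset ⟦ interval (P n k o d) x I.1̂ (I.maximum x) ⟧
    open Quotient L

    x-root : ∃[ j ] pointAt (value x) j ≡ rootPoint n o
    x-root = oneBlock-⊑⁻ d (firstElement o d) {value x} (∣P∣-⊑ {d = d} x)

    srep-root : Maybe.map srep (rootPoint (p + q) o) ≡ rootPoint n o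
    srep-root = trans (cong (Maybe.map srep) (sym root)) (fixed (proj₂ x-root))
      where
      fixed : ∀ {j m} → pointAt (value x) j ≡ m → Maybe.map srep (Maybe.map blk m) ≡ m
      fixed {m = nothing} _  = refl
      fixed {m = just e}  eq = cong just (srep-fixed (point-fixed (value x) eq))

    pull-root : ∀ {y} → ∃[ u ] pointAt y u ≡ rootPoint (p + q) o → ∃[ i ] pointAt (pull y) i ≡ rootPoint n o
    pull-root {y} (u , eq) = srep u , trans (pointAt-pull y (srep u))
      (trans (cong (λ v → Maybe.map srep (pointAt y v)) (blk-srep u)) (trans (cong (Maybe.map srep) eq) srep-root))

    push-root : ∀ z (le : z ⊑ value x) → ∃[ i ] pointAt z i ≡ rootPoint n o → ∃[ u ] pointAt (push z le) u ≡ rootPoint (p + q) o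
    push-root z le (i , eq) = blk i , trans (pointAt-push z le i) (trans (cong (Maybe.map blk) eq) root)

    to-root : ∀ (y : J.Carrier) → ∃[ i ] pointAt (pull (value y)) i ≡ rootPoint n o
    to-root y = pull-root {value y} (oneBlock-⊑⁻ d′ (firstElement o d′) {value y} (∣P∣-⊑ {d = d′} y))

    to : J.Carrier → K.Carrier
    to y = (pull (value y) , [ oneBlock-⊑ d {pull (value y)} (to-root y) , ⊑-singletons {x = pull (value y)} ])
         , [ pull-⊑ (value y) , oneBlock-⊑ d {pull (value y)} (to-root y) ]

    to-surjective : ∀ z → ∃[ y ] to y ≡ z
    to-surjective (z , [ h ]) = (push (value z) le , [ oneBlock-⊑ d′ {push (value z) le} (push-root (value z) le
                                             (oneBlock-⊑⁻ d (firstElement o d) {value z} (∣P∣-⊑ {d = d} z)))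
                                           , ⊑-singletons {x = push (value z) le} ])
      , value-injective (value-injective (pull-push (value z) le))
      where
      le : value z ⊑ value x
      le = recompute (value z ⊑? value x) (proj₁ h)

  -- Merging blocks of `x` is the same as partitioning its labels. The hypothesis `root` matches the
  -- prescribed points of the two maximal intervals: for o = 1 the block of the root must carry the
  -- first label. Arguments of `pull-mono` and `pull-cancel` are swapped because the order is
  -- dualised.
  quotient-≅ : P (p + q) p o d′ ≅ interval (P n k o d) x I.1̂ (I.maximum x)
  quotient-≅ = record
    { to                 = to
    ; isOrderIsomorphism = record
      { isOrderMonomorphism = record
        { isOrderHomomorphism = record { cong = cong to ; mono = λ {y} {y′} → pull-mono {value y′} {value y} }
        ; injective           = λ {y} {y′} eq → J.⊴-antisym {y} {y′}
            (pull-cancel {value y′} {value y} (subst (λ w → value (value w) ⊑ pull (value y)) eq (⊑-refl {x = pull (value y)})))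
            (pull-cancel {value y} {value y′} (subst (λ w → pull (value y) ⊑ value (value w)) eq (⊑-refl {x = pull (value y)})))
        ; cancel              = λ {y} {y′} → pull-cancel {value y′} {value y}
        }
      ; surjective = λ z → let y , eq = to-surjective z in y , λ { refl → eq }
      }
    ; #pointed-0̂         = trans (singletons-pointed {p = p} {q} refl) (sym (labelling-pointed (value x) L))
    ; #unpointed-0̂       = trans (singletons-unpointed {p = p} {q} refl) (sym (labelling-unpointed (value x) L))
    ; #pointed-1̂         = trans (labelling-pointed (oneBlock (p + q) p o d′) (oneBlockLabelling o d′))
                             (sym (labelling-pointed (oneBlock n k o d) (oneBlockLabelling o d)))
    ; #unpointed-1̂       = trans (labelling-unpointed (oneBlock (p + q) p o d′) (oneBlockLabelling o d′))
                             (sym (labelling-unpointed (oneBlock n k o d) (oneBlockLabelling o d)))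
    }

-- The interval below a partition

module Poset (X : 𝓕) = BoundedBlockPoset ⟦ X ⟧

-- Nested to the right and ending in `𝟙`, exactly as the fold in `∏` multiplies classes; this is
-- what makes `∏-cls` a short induction.
∏ᶠ : ∀ {m} → (Fin m → 𝓕) → 𝓕
∏ᶠ {zero}  X = 𝟙
∏ᶠ {suc m} X = X zero ⊠ ∏ᶠ (X ∘ suc)

component : ∀ {m} (X : Fin m → 𝓕) → ∣ ∏ᶠ X ∣ → ∀ i → ∣ X i ∣
component X (a , as) zero    = a
component X (a , as) (suc i) = component (X ∘ suc) as i

tuple : ∀ {m} (X : Fin m → 𝓕) → (∀ i → ∣ X i ∣) → ∣ ∏ᶠ X ∣
tuple {zero}  X f = tt
tuple {suc m} X f = f zero , tuple (X ∘ suc) (f ∘ suc)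

tuple-ext : ∀ {m} (X : Fin m → 𝓕) {f} as → (∀ i → f i ≡ component X as i) → tuple X f ≡ as
tuple-ext {zero}  X as       eq = refl
tuple-ext {suc m} X (a , as) eq = cong₂ _,_ (eq zero) (tuple-ext (X ∘ suc) as (eq ∘ suc))

tuple-mono : ∀ {m} (X : Fin m → 𝓕) {f g} → (∀ i → Poset._⊴_ (X i) (f i) (g i)) → Poset._⊴_ (∏ᶠ X) (tuple X f) (tuple X g)
tuple-mono {zero}  X h = tt
tuple-mono {suc m} X h = h zero , tuple-mono (X ∘ suc) (h ∘ suc)

tuple-cancel : ∀ {m} (X : Fin m → 𝓕) {f g} → Poset._⊴_ (∏ᶠ X) (tuple X f) (tuple X g) → ∀ i → Poset._⊴_ (X i) (f i) (g i)
tuple-cancel {suc m} X (h , hs) zero    = h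
tuple-cancel {suc m} X (h , hs) (suc i) = tuple-cancel (X ∘ suc) hs i

module _ (# : ∀ X → ∣ X ∣ → ℕ) (a : ∀ X → ∣ X ∣)
         (#-𝟙 : # 𝟙 (a 𝟙) ≡ 0) (#-⊠ : ∀ X Y → # (X ⊠ Y) (a (X ⊠ Y)) ≡ # X (a X) + # Y (a Y)) where

  -- Abstracting over the statistic and the distinguished element lets one induction serve pointed
  -- and unpointed counts at both the least and the greatest element.
  count-∏ᶠ : ∀ {m} (X : Fin m → 𝓕) {c} → (∀ i → # (X i) (a (X i)) ≡ c i) → # (∏ᶠ X) (a (∏ᶠ X)) ≡ Vec.sum (tabulate c)
  count-∏ᶠ {zero}  X h = #-𝟙
  count-∏ᶠ {suc m} X h = trans (#-⊠ (X zero) (∏ᶠ (X ∘ suc))) (cong₂ _+_ (h zero) (count-∏ᶠ (X ∘ suc) (h ∘ suc)))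

sum-tabulate-const : ∀ m {c} → Vec.sum (tabulate {n = m} (const c)) ≡ m ℕ.* c
sum-tabulate-const zero        = refl
sum-tabulate-const (suc m) {c} = cong (c +_) (sum-tabulate-const m)

-- By `ι-<` and `ι-≥` the numbering of the block respects the splitting into V₁ and V₂, so
-- semi-pointed partitions of the block become elements of `SemiPointed N K`.
record Frame {n p q : ℕ} (k : ℕ) (label : Fin n → Label p q) (u : Label p q) (N K : ℕ) : Set where
  field
    -- ι identifies Fin N with the block u; outside that block ρ is arbitrary.
    ι       : Fin N → Fin n
    ρ       : Fin n → Fin N
    ρ-ι     : ∀ a → ρ (ι a) ≡ a
    ι-ρ     : ∀ {i} → label i ≡ u → ι (ρ i) ≡ i
    label-ι : ∀ a → label (ι a) ≡ u
    ι-<     : ∀ {a} → toℕ a < K → toℕ (ι a) < k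
    ι-≥     : ∀ {a} → K ≤ toℕ a → k ≤ toℕ (ι a)

  ι-<⁻ : ∀ {a} → toℕ (ι a) < k → toℕ a < K
  ι-<⁻ {a} lt with toℕ a <? K
  ... | yes a<K = a<K
  ... | no  a≮K = contradiction (ι-≥ (ℕ.≮⇒≥ a≮K)) (ℕ.<⇒≱ lt)

  ι-≥⁻ : ∀ {a} → k ≤ toℕ (ι a) → K ≤ toℕ a
  ι-≥⁻ {a} le with toℕ a <? K
  ... | yes a<K = contradiction le (ℕ.<⇒≱ (ι-< a<K))
  ... | no  a≮K = ℕ.≮⇒≥ a≮K

  ι-injective : ∀ {a b} → ι a ≡ ι b → a ≡ b
  ι-injective {a} {b} eq = trans (sym (ρ-ι a)) (trans (cong ρ eq) (ρ-ι b))

kind : ∀ {p q} → Label p q → Fin 2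
kind (inj₁ _) = suc zero
kind (inj₂ _) = zero

module Gluing {n k p q : ℕ} (x : SemiPointed n k) (L : Labelling x p q) {N K : Label p q → ℕ}
              (F : ∀ u → Frame k (Labelling.label L) u (N u) (K u)) where
  open Labelling L
  module F u = Frame (F u)
  open F

  module _ (z : SemiPointed n k) (x⊑z : x ⊑ z) where

    z⇒label : ∀ {i j} → Same z i j → label i ≡ label j
    z⇒label s = same⇒label (⊑-same {x = x} {y = z} x⊑z s)

    -- As `z` refines `x`, the block of `z` through `ι u a` stays inside block `u` of `x`, where `ρ`
    -- inverts `ι`.
    ι-ρ-same : ∀ {u a j} → Same z (ι u a) j → ι u (ρ u j) ≡ j
    ι-ρ-same {u} {a} s = ι-ρ u (trans (sym (z⇒label s)) (label-ι u a))

    restrictData : ∀ u → PartitionData (N u) (K u)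
    restrictData u = record
      { _≋_     = λ a b → Same z (ι u a) (ι u b)
      ; _≋?_    = λ a b → same? z (ι u a) (ι u b)
      ; ≋-refl  = same-refl z
      ; ≋-sym   = same-sym z
      ; ≋-trans = same-trans z
      ; pt      = λ a → Maybe.map (ρ u) (pointAt z (ι u a))
      ; pt-cong = λ s → cong (Maybe.map (ρ u)) (pointAt-cong z s)
      ; pt-in   = λ {a} eq → let e , eq′ , r = map-just⁻ eq
                                 s = point-same z eq′
                             in subst (Same z (ι u a)) (trans (sym (ι-ρ-same s)) (cong (ι u) r)) s
      ; pt<p    = λ {a} eq → let e , eq′ , r = map-just⁻ eq in
                    subst (λ b → toℕ b < K u) r (ι-<⁻ u (subst (λ j → toℕ j < k)
                      (sym (ι-ρ-same (point-same z eq′))) (point<p z eq′)))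
      ; unpt    = λ {a} eq → let j , s , k≤j = unpointed-V₂ z (map-nothing⁻ {m = pointAt z (ι u a)} eq)
                                 r = sym (ι-ρ-same s)
                             in ρ u j , subst (Same z (ι u a)) r s , ι-≥⁻ u (subst (λ i → k ≤ toℕ i) r k≤j)
      }

    restrict : ∀ u → SemiPointed (N u) (K u)
    restrict u = build (restrictData u)

    ι-pointAt-restrict : ∀ u a → Maybe.map (ι u) (pointAt (restrict u) a) ≡ pointAt z (ι u a)
    ι-pointAt-restrict u a = trans (cong (Maybe.map (ι u)) (pointAt-build (restrictData u) a)) fixed
      where
      fixed : Maybe.map (ι u) (Maybe.map (ρ u) (pointAt z (ι u a))) ≡ pointAt z (ι u a)
      fixed with pointAt z (ι u a) in eq
      ... | nothing = refl
      ... | just e  = cong just (ι-ρ-same (point-same z eq))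

  restrict-mono : ∀ {z z′ x⊑z x⊑z′} → z ⊑ z′ → ∀ u → restrict z x⊑z u ⊑ restrict z′ x⊑z′ u
  restrict-mono {z} {z′} {x⊑z} {x⊑z′} le u = ⊑-intro {x = restrict z x⊑z u} {y = restrict z′ x⊑z′ u}
    (λ s → same-build⁺ (restrictData z x⊑z u) (⊑-same {x = z} {y = z′} le (same-build⁻ (restrictData z′ x⊑z′ u) s)))
    (λ a → let j , s , eq = ⊑-point {x = z} {y = z′} le (ι u a)
               r = ι-ρ-same z x⊑z s
           in ρ u j , same-build⁺ (restrictData z x⊑z u) (subst (Same z (ι u a)) (sym r) s) ,
              trans (pointAt-build (restrictData z′ x⊑z′ u) (ρ u j)) (trans (cong (Maybe.map (ρ u))
                (trans (cong (pointAt z′) r) eq)) (sym (pointAt-build (restrictData z x⊑z u) a))))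

  -- Every block of `z′` lies inside one block of `x`, so each instance of the order can be tested
  -- after restriction to that block.
  restrict-cancel : ∀ {z z′ x⊑z x⊑z′} → (∀ u → restrict z x⊑z u ⊑ restrict z′ x⊑z′ u) → z ⊑ z′
  restrict-cancel {z} {z′} {x⊑z} {x⊑z′} le = ⊑-intro {x = z} {y = z′} same root
    where
    Rz : ∀ u → SemiPointed (N u) (K u)
    Rz = restrict z x⊑z
    Rz′ : ∀ u → SemiPointed (N u) (K u)
    Rz′ = restrict z′ x⊑z′
    same : ∀ {i j} → Same z′ i j → Same z i j
    same {i} {j} s = subst₂ (Same z) ri rj (same-build⁻ (restrictData z x⊑z (label i))
      (⊑-same {x = Rz (label i)} {y = Rz′ (label i)} (le (label i)) (same-build⁺ (restrictData z′ x⊑z′ (label i))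
        (subst₂ (Same z′) (sym ri) (sym rj) s))))
      where
      ri = ι-ρ (label i) {i} refl
      rj = ι-ρ (label i) {j} (sym (z⇒label z′ x⊑z′ s))
    root : ∀ i → ∃[ j ] Same z i j × pointAt z′ j ≡ pointAt z i
    root i with label i in eqₗ
    ... | u with ⊑-point {x = Rz u} {y = Rz′ u} (le u) (ρ u i)
    ... | b , s , eq = ι u b , subst (λ j → Same z j (ι u b)) r (same-build⁻ (restrictData z x⊑z u) s) ,
      trans (sym (ι-pointAt-restrict z′ x⊑z′ u b)) (trans (cong (Maybe.map (ι u)) eq)
        (trans (ι-pointAt-restrict z x⊑z u (ρ u i)) (cong (pointAt z) r)))
      where
      r = ι-ρ u eqₗ

  module _ (zs : ∀ u → SemiPointed (N u) (K u)) where

    -- The label `u` is a parameter of its own, in place of `label i`, so that the relation can be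
    -- transported along an equation of labels by `move`.
    Glued : Label p q → Fin n → Fin n → Set
    Glued u i j = label j ≡ u × Same (zs u) (ρ u i) (ρ u j)

    move : ∀ {i j u} → label i ≡ u → Glued (label i) i j → Glued u i j
    move refl g = g

    glue-pt : ∀ {i} u → label i ≡ u → Maybe.map (ι (label i)) (pointAt (zs (label i)) (ρ (label i) i))
      ≡ Maybe.map (ι u) (pointAt (zs u) (ρ u i))
    glue-pt u refl = refl

    glueData : PartitionData n k
    glueData = record
      { _≋_     = λ i j → Glued (label i) i j
      ; _≋?_    = λ i j → label j ≟ᵘ label i ×-dec same? (zs (label i)) (ρ (label i) i) (ρ (label i) j)
      ; ≋-refl  = λ {i} → refl , same-refl (zs (label i))
      ; ≋-sym   = λ { {i} {j} (eq , s) → sym eq , subst (λ u → Same (zs u) (ρ u j) (ρ u i)) (sym eq) (same-sym (zs (label i)) s) }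
      ; ≋-trans = λ { {i} {j} {m} (eq , s) g → let eq′ , s′ = move eq g in eq′ , same-trans (zs (label i)) s s′ }
      ; pt      = λ i → Maybe.map (ι (label i)) (pointAt (zs (label i)) (ρ (label i) i))
      ; pt-cong = λ { {i} {j} (eq , s) → trans (cong (Maybe.map (ι (label i))) (pointAt-cong (zs (label i)) s))
                                               (sym (glue-pt (label i) eq)) }
      ; pt-in   = λ {i} eq → let a , eq′ , r = map-just⁻ eq in
                    subst (Glued (label i) i) r (label-ι (label i) a ,
                      subst (Same (zs (label i)) _) (sym (ρ-ι (label i) a)) (point-same (zs (label i)) eq′))
      ; pt<p    = λ {i} eq → let a , eq′ , r = map-just⁻ eq in
                    subst (λ e → toℕ e < k) r (ι-< (label i) (point<p (zs (label i)) eq′))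
      ; unpt    = λ {i} eq → let a , s , K≤a = unpointed-V₂ (zs (label i)) (map-nothing⁻ {m = pointAt (zs (label i)) (ρ (label i) i)} eq) in
                    ι (label i) a , (label-ι (label i) a ,
                      subst (Same (zs (label i)) _) (sym (ρ-ι (label i) a)) s) , ι-≥ (label i) K≤a
      }

    glue : SemiPointed n k
    glue = build glueData

    pointAt-glue : ∀ u a → pointAt glue (ι u a) ≡ Maybe.map (ι u) (pointAt (zs u) a)
    pointAt-glue u a = trans (pointAt-build glueData (ι u a)) (trans (glue-pt u (label-ι u a))
      (cong (λ b → Maybe.map (ι u) (pointAt (zs u) b)) (ρ-ι u a)))

    restrict-glue : ∀ x⊑g u → restrict glue x⊑g u ≡ zs u
    restrict-glue x⊑g u = semiPointed-ext {x = restrict glue x⊑g u} {y = zs u}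
      (λ {a} {b} s → subst₂ (Same (zs u)) (ρ-ι u a) (ρ-ι u b)
        (proj₂ (move (label-ι u a) (same-build⁻ glueData (same-build⁻ (restrictData glue x⊑g u) s)))))
      (λ {a} {b} s → same-build⁺ (restrictData glue x⊑g u) (same-build⁺ glueData
        (subst (λ v → Glued v (ι u a) (ι u b)) (sym (label-ι u a))
          (label-ι u b , subst₂ (Same (zs u)) (sym (ρ-ι u a)) (sym (ρ-ι u b)) s))))
      (λ a → Maybe.map-injective (ι-injective u) (trans (ι-pointAt-restrict glue x⊑g u a) (pointAt-glue u a)))

    -- Glued elements share a label, which is the inclusion half of the order. The other half asks
    -- each block of `x` to pass its pointing on to a piece, and `roots` provides that piece.
    ⊑-glue : (∀ u → ∃[ a ] Maybe.map (ι u) (pointAt (zs u) a) ≡ pointAt x (rep u)) → x ⊑ glue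
    ⊑-glue roots = ⊑-intro {x = x} {y = glue}
      (λ s → label⇒same (sym (proj₁ (same-build⁻ glueData s))))
      (λ i → let a , eq = roots (label i) in ι (label i) a , label⇒same (sym (label-ι (label i) a)) ,
        trans (pointAt-glue (label i) a) (trans eq (sym (pointAt-cong x (rep-same refl)))))

module _ {n k l p q o} (n≡k+l : n ≡ k + l) (d : Defined n k o) (x : ∣ P n k o d ∣) (L : Labelling (value x) p q)
         (M K : Label p q → ℕ) (ds : ∀ u → Defined (M u + K u) (K u) (kind u))
         (F : ∀ u → Frame k (Labelling.label L) u (M u + K u) (K u))
         (root : ∀ u → Maybe.map (Frame.ι (F u)) (rootPoint (M u + K u) (kind u)) ≡ pointAt (value x) (Labelling.rep L u))
         (sum-K : Vec.sum (tabulate (K ∘ inj₁)) + Vec.sum (tabulate (K ∘ inj₂)) ≡ k)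
         (sum-M : Vec.sum (tabulate (M ∘ inj₁)) + Vec.sum (tabulate (M ∘ inj₂)) ≡ l) where

  private
    open Labelling L
    open Gluing (value x) L F
    open F

    X : Label p q → 𝓕
    X u = P (M u + K u) (K u) (kind u) (ds u)

    X₁ = ∏ᶠ (X ∘ inj₁)
    X₂ = ∏ᶠ (X ∘ inj₂)

    module I = BoundedBlockPoset ⟦ P n k o d ⟧
    module J = BoundedBlockPoset ⟦ interval (P n k o d) I.0̂ x (I.minimum x) ⟧

    below : ∀ (z : J.Carrier) → value x ⊑ value (value z)
    below (z , [ h ]) = recompute (value x ⊑? value z) (proj₂ h)

    restrict-root : ∀ z x⊑z u → ∃[ a ] pointAt (restrict z x⊑z u) a ≡ rootPoint (M u + K u) (kind u)
    restrict-root z x⊑z u with ⊑-point {x = value x} {y = z} x⊑z (rep u)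
    ... | j , s , eq = ρ u j , Maybe.map-injective (ι-injective u)
      (trans (ι-pointAt-restrict z x⊑z u (ρ u j)) (trans (cong (pointAt z)
        (ι-ρ u (trans (sym (same⇒label s)) (label-rep u)))) (trans eq (sym (root u)))))

    part : J.Carrier → ∀ u → ∣ X u ∣
    part z u = r , [ oneBlock-⊑ (ds u) {r} (restrict-root (value (value z)) (below z) u) , ⊑-singletons {x = r} ]
      where r = restrict (value (value z)) (below z) u

    to : J.Carrier → ∣ X₁ ⊠ X₂ ∣
    to z = tuple (X ∘ inj₁) (part z ∘ inj₁) , tuple (X ∘ inj₂) (part z ∘ inj₂)

    mono : ∀ {z z′} → z J.⊴ z′ → Poset._⊴_ (X₁ ⊠ X₂) (to z) (to z′)
    mono {z} {z′} le = tuple-mono (X ∘ inj₁) (part-mono ∘ inj₁) , tuple-mono (X ∘ inj₂) (part-mono ∘ inj₂)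
      where
      part-mono : ∀ u → value (part z′ u) ⊑ value (part z u)
      part-mono = restrict-mono {value (value z′)} {value (value z)} {below z′} {below z} le

    cancel : ∀ {z z′} → Poset._⊴_ (X₁ ⊠ X₂) (to z) (to z′) → z J.⊴ z′
    cancel {z} {z′} (le₁ , le₂) = restrict-cancel {value (value z′)} {value (value z)} {below z′} {below z}
      λ { (inj₁ a) → tuple-cancel (X ∘ inj₁) {part z ∘ inj₁} {part z′ ∘ inj₁} le₁ a
        ; (inj₂ b) → tuple-cancel (X ∘ inj₂) {part z ∘ inj₂} {part z′ ∘ inj₂} le₂ b }

    parts : ∣ X₁ ⊠ X₂ ∣ → ∀ u → ∣ X u ∣
    parts (zs₁ , zs₂) (inj₁ a) = component (X ∘ inj₁) zs₁ a
    parts (zs₁ , zs₂) (inj₂ b) = component (X ∘ inj₂) zs₂ b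

    glue-root : ∀ zs u → ∃[ a ] Maybe.map (ι u) (pointAt (value (parts zs u)) a) ≡ pointAt (value x) (rep u)
    glue-root zs u = let a , eq = oneBlock-⊑⁻ (ds u) (firstElement (kind u) (ds u)) {value (parts zs u)}
                                    (∣P∣-⊑ {d = ds u} (parts zs u))
                     in a , trans (cong (Maybe.map (ι u)) eq) (root u)

    to-surjective : ∀ zs → ∃[ z ] to z ≡ zs
    to-surjective zs@(zs₁ , zs₂) = z , cong₂ _,_
      (tuple-ext (X ∘ inj₁) zs₁ (λ a → value-injective (restrict-glue (value ∘ parts zs) (below z) (inj₁ a))))
      (tuple-ext (X ∘ inj₂) zs₂ (λ b → value-injective (restrict-glue (value ∘ parts zs) (below z) (inj₂ b))))
      where
      g : SemiPointed n k
      g = glue (value ∘ parts zs)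
      x⊑g : value x ⊑ g
      x⊑g = ⊑-glue (value ∘ parts zs) (glue-root zs)
      z : J.Carrier
      z = (g , [ ⊑-trans {x = oneBlock n k o d} {y = value x} {z = g} (∣P∣-⊑ {d = d} x) x⊑g , ⊑-singletons {x = g} ])
        , [ ⊑-singletons {x = g} , x⊑g ]

    split : ∀ u → M u + K u ≡ K u + M u
    split u = ℕ.+-comm (M u) (K u)

  -- Refining `x` means refining its blocks independently. The condition of staying above `x`
  -- becomes, on each block, membership in the maximal interval of its kind; `root` makes the
  -- prescribed points agree, the point of a pointed block being the first element of its frame. The
  -- sums of `K` and `M` give the block numbers of the singletons.
  blocks-≅ : interval (P n k o d) I.0̂ x (I.minimum x) ≅ (X₁ ⊠ X₂)
  blocks-≅ = record
    { to                 = to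
    ; isOrderIsomorphism = record
      { isOrderMonomorphism = record
        { isOrderHomomorphism = record { cong = cong to ; mono = λ {z} {z′} → mono {z} {z′} }
        ; injective           = λ {z} {z′} eq → J.⊴-antisym {z} {z′}
            (cancel {z} {z′} (subst (Poset._⊴_ (X₁ ⊠ X₂) (to z)) eq (Poset.⊴-refl (X₁ ⊠ X₂) {to z})))
            (cancel {z′} {z} (subst (λ w → Poset._⊴_ (X₁ ⊠ X₂) w (to z)) eq (Poset.⊴-refl (X₁ ⊠ X₂) {to z})))
        ; cancel              = λ {z} {z′} → cancel {z} {z′}
        }
      ; surjective = λ zs → let z , eq = to-surjective zs in z , λ { refl → eq }
      }
    ; #pointed-0̂         = trans (trans (singletons-pointed {p = k} {l} n≡k+l) (sym sum-K)) (sym (cong₂ _+_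
        (count-∏ᶠ Poset.#pointed Poset.0̂ refl (λ _ _ → refl) (X ∘ inj₁) λ a → singletons-pointed {p = K (inj₁ a)} (split (inj₁ a)))
        (count-∏ᶠ Poset.#pointed Poset.0̂ refl (λ _ _ → refl) (X ∘ inj₂) λ b → singletons-pointed {p = K (inj₂ b)} (split (inj₂ b)))))
    ; #unpointed-0̂       = trans (trans (singletons-unpointed {p = k} {l} n≡k+l) (sym sum-M)) (sym (cong₂ _+_
        (count-∏ᶠ Poset.#unpointed Poset.0̂ refl (λ _ _ → refl) (X ∘ inj₁) λ a → singletons-unpointed {p = K (inj₁ a)} (split (inj₁ a)))
        (count-∏ᶠ Poset.#unpointed Poset.0̂ refl (λ _ _ → refl) (X ∘ inj₂) λ b → singletons-unpointed {p = K (inj₂ b)} (split (inj₂ b)))))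
    ; #pointed-1̂         = trans (labelling-pointed (value x) L) (sym (trans (cong₂ _+_
        (trans (count-∏ᶠ Poset.#pointed Poset.1̂ refl (λ _ _ → refl) (X ∘ inj₁) λ a → oneBlock-#pointed (inj₁ a)) (sum-tabulate-const p))
        (trans (count-∏ᶠ Poset.#pointed Poset.1̂ refl (λ _ _ → refl) (X ∘ inj₂) λ b → oneBlock-#pointed (inj₂ b)) (sum-tabulate-const q)))
        (trans (cong₂ _+_ (ℕ.*-identityʳ p) (ℕ.*-zeroʳ q)) (ℕ.+-identityʳ p))))
    ; #unpointed-1̂       = trans (labelling-unpointed (value x) L) (sym (trans (cong₂ _+_
        (trans (count-∏ᶠ Poset.#unpointed Poset.1̂ refl (λ _ _ → refl) (X ∘ inj₁) λ a → oneBlock-#unpointed (inj₁ a)) (sum-tabulate-const p))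
        (trans (count-∏ᶠ Poset.#unpointed Poset.1̂ refl (λ _ _ → refl) (X ∘ inj₂) λ b → oneBlock-#unpointed (inj₂ b)) (sum-tabulate-const q)))
        (cong₂ _+_ (ℕ.*-zeroʳ p) (ℕ.*-identityʳ q))))
    }
    where
    oneBlock-#pointed : ∀ u → pointedBlocks (oneBlock (M u + K u) (K u) (kind u) (ds u)) ≡ toℕ (kind u)
    oneBlock-#pointed u = labelling-pointed (oneBlock (M u + K u) (K u) (kind u) (ds u)) (oneBlockLabelling (kind u) (ds u))
    oneBlock-#unpointed : ∀ u → unpointedBlocks (oneBlock (M u + K u) (K u) (kind u) (ds u)) ≡ 1 ∸ toℕ (kind u)
    oneBlock-#unpointed u = labelling-unpointed (oneBlock (M u + K u) (K u) (kind u) (ds u)) (oneBlockLabelling (kind u) (ds u))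

-- Words of given content

-- Bringing the only occurrence of `x` to the front lets sums and products of a function altered at
-- `x` alone be compared factor by factor.
remove : ∀ {A : Set} {x : A} {xs} → Unique xs → x ∈ₗ xs → ∃[ ys ] xs ↭ x ∷ ys × All (x ≢_) ys
remove {xs = y ∷ ys} (y∉ ∷ _) (here refl) = ys , Permutation.refl , y∉
remove {xs = y ∷ _}  (y∉ ∷ u) (there x∈) with remove u x∈
... | ys , r , x∉ = y ∷ ys , Permutation.trans (Permutation.prep y r) (Permutation.swap y _ Permutation.refl) ,
                    (λ x≡y → contradiction (sym x≡y) (All.lookup y∉ x∈)) ∷ x∉

map-cong-All : ∀ {A B : Set} {P : A → Set} {f g : A → B} → (∀ {x} → P x → f x ≡ g x) →
  ∀ {xs} → All P xs → map f xs ≡ map g xs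
map-cong-All h []       = refl
map-cong-All h (p ∷ ps) = cong₂ _∷_ (h p) (map-cong-All h ps)

sum-map-+ : ∀ {A : Set} (f g : A → ℕ) xs → sum (map (λ x → f x + g x) xs) ≡ sum (map f xs) + sum (map g xs)
sum-map-+ f g []       = refl
sum-map-+ f g (x ∷ xs) = trans (cong (f x + g x +_) (sum-map-+ f g xs))
  (solve 4 (λ a b c d → a :+ b :+ (c :+ d) := a :+ c :+ (b :+ d)) refl (f x) (g x) (sum (map f xs)) (sum (map g xs)))
  where open +-*-Solver

sum-map-* : ∀ {A : Set} (f : A → ℕ) d xs → sum (map (λ x → f x ℕ.* d) xs) ≡ sum (map f xs) ℕ.* d
sum-map-* f d []       = refl
sum-map-* f d (x ∷ xs) = trans (cong (f x ℕ.* d +_) (sum-map-* f d xs)) (sym (ℕ.*-distribʳ-+ d (f x) _))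

sum-map-0 : ∀ {A : Set} (xs : List A) → sum (map (λ _ → 0) xs) ≡ 0
sum-map-0 []       = refl
sum-map-0 (x ∷ xs) = sum-map-0 xs

sum≡0 : ∀ {A : Set} {f : A → ℕ} {xs x} → sum (map f xs) ≡ 0 → x ∈ₗ xs → f x ≡ 0
sum≡0 {f = f} {y ∷ ys} eq (here refl) = ℕ.m+n≡0⇒m≡0 (f y) eq
sum≡0 {f = f} {y ∷ ys} eq (there x∈)  = sum≡0 {f = f} {ys} (ℕ.m+n≡0⇒n≡0 (f y) eq) x∈

refineList-const : ∀ {A : Set} {Q : Set} (Q? : Dec Q) (xs : List A) →
  length (refineList {Q = λ _ → Q} (λ _ → Q?) xs) ≡ (if does Q? then length xs else 0)
refineList-const (yes q) []       = refl
refineList-const (yes q) (x ∷ xs) = cong suc (refineList-const (yes q) xs)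
refineList-const (no ¬q) []       = refl
refineList-const (no ¬q) (x ∷ xs) = refineList-const (no ¬q) xs

Finite-all? : ∀ {A : Set} {Q : A → Set} → Finite A → Decidable Q → Dec (∀ a → Q a)
Finite-all? I Q? = map′ (λ h a → All.lookup h (complete I a)) (λ h → All.universal h _) (All.all? Q? (elements I))

module Words {C : Set} (I : Finite C) (_≟_ : DecidableEquality C) where

  δ : C → C → ℕ
  δ c c′ = if does (c ≟ c′) then 1 else 0

  δ-refl : ∀ c → δ c c ≡ 1
  δ-refl c rewrite dec-true (c ≟ c) refl = refl

  δ-≢ : ∀ {c c′} → c ≢ c′ → δ c c′ ≡ 0
  δ-≢ {c} {c′} ne rewrite dec-false (c ≟ c′) ne = refl

  count : ∀ {n} → C → Vec C n → ℕ
  count c []      = 0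
  count c (x ∷ v) = δ x c + count c v

  -- Turns a multiplicity into actual places. From these come the point of a pointed block, an
  -- element of V₂ in an unpointed one, and the numbering of a block.
  positions : ∀ {n} (v : Vec C n) c → Enumeration (λ i → lookup v i ≡ c) (count c v)
  positions []      c = record { at = λ () ; at-∈ = λ () ; injective = λ { {()} } ; surjective = λ { {()} } }
  positions (x ∷ v) c with x ≟ c | positions v c
  ... | yes x≡c | E = record
    { at         = λ { zero → zero ; (suc i) → suc (Enumeration.at E i) }
    ; at-∈       = λ { zero → x≡c ; (suc i) → Enumeration.at-∈ E i }
    ; injective  = λ { {zero} {zero} _ → refl ; {suc i} {suc j} eq → cong suc (Enumeration.injective E (Fin.suc-injective eq)) }
    ; surjective = λ { {zero} _ → zero , refl
                     ; {suc i} eq → let j , eq′ = Enumeration.surjective E eq in suc j , cong suc eq′ }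
    }
  ... | no x≢c | E = record
    { at         = suc ∘ Enumeration.at E
    ; at-∈       = Enumeration.at-∈ E
    ; injective  = λ eq → Enumeration.injective E (Fin.suc-injective eq)
    ; surjective = λ { {zero} x≡c → contradiction x≡c x≢c
                     ; {suc i} eq → let j , eq′ = Enumeration.surjective E eq in j , cong suc eq′ }
    }

  HasContent : ∀ {n} → (C → ℕ) → Vec C n → Set
  HasContent κ v = ∀ c → count c v ≡ κ c

  hasContent? : ∀ {n} κ → Decidable (HasContent {n} κ)
  hasContent? κ v = Finite-all? I (λ c → count c v ℕ.≟ κ c)

  Words : (C → ℕ) → ℕ → Set
  Words κ n = Refinement (Vec C n) (HasContent κ)

  words-finite : ∀ κ n → Finite (Words κ n)
  words-finite κ n = refinement-finite (hasContent? κ) (Vec-finite I n)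

  total : (C → ℕ) → ℕ
  total κ = sum (map κ (elements I))

  total! : (C → ℕ) → ℕ
  total! κ = product (map (λ c → κ c !) (elements I))

  total-count : ∀ {n} (v : Vec C n) → total (λ c → count c v) ≡ n
  total-count []      = sum-map-0 (elements I)
  total-count (x ∷ v) = trans (sum-map-+ (δ x) (λ c → count c v) (elements I)) (cong₂ _+_ total-δ (total-count v))
    where
    total-δ : total (δ x) ≡ 1
    total-δ with remove (unique I) (complete I x)
    ... | ys , r , x∉ = trans (sum-↭ (Permutation.map⁺ (δ x) r)) (cong₂ _+_ (δ-refl x)
      (trans (cong sum (map-cong-All δ-≢ x∉)) (sum-map-0 ys)))

  -- The content left to the tail once `c` has been used as first letter. Truncation at 0 does no
  -- harm: `tails` admits no word when `c` has multiplicity 0.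
  _⊖_ : (C → ℕ) → C → C → ℕ
  (κ ⊖ c) c′ = κ c′ ∸ δ c c′

  module _ (κ : C → ℕ) (c : C) (1≤κc : 1 ≤ κ c) where

    private
      ⊖-self : suc ((κ ⊖ c) c) ≡ κ c
      ⊖-self rewrite δ-refl c = ℕ.m+[n∸m]≡n 1≤κc

      ⊖-other : ∀ {c′} → c ≢ c′ → (κ ⊖ c) c′ ≡ κ c′
      ⊖-other ne rewrite δ-≢ ne = refl

    total-⊖ : suc (total (κ ⊖ c)) ≡ total κ
    total-⊖ with remove (unique I) (complete I c)
    ... | ys , r , c∉ = trans (cong suc (sum-↭ (Permutation.map⁺ (κ ⊖ c) r)))
      (trans (cong₂ _+_ ⊖-self (cong sum (map-cong-All ⊖-other c∉))) (sym (sum-↭ (Permutation.map⁺ κ r))))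

    total!-⊖ : κ c ℕ.* total! (κ ⊖ c) ≡ total! κ
    total!-⊖ with remove (unique I) (complete I c)
    ... | ys , r , c∉ = begin
      κ c ℕ.* total! (κ ⊖ c)
        ≡⟨ cong (κ c ℕ.*_) (product-↭ (Permutation.map⁺ (λ c → (κ ⊖ c₀) c !) r)) ⟩
      κ c ℕ.* ((κ ⊖ c) c ! ℕ.* product (map (λ c → (κ ⊖ c₀) c !) ys))
        ≡⟨ ℕ.*-assoc (κ c) ((κ ⊖ c) c !) _ ⟨
      κ c ℕ.* (κ ⊖ c) c ! ℕ.* product (map (λ c → (κ ⊖ c₀) c !) ys)
        ≡⟨ cong₂ ℕ._*_ fact (cong product (map-cong-All (λ ne → cong _! (⊖-other ne)) c∉)) ⟩
      κ c ! ℕ.* product (map (λ c → κ c !) ys)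
        ≡⟨ product-↭ (Permutation.map⁺ (λ c → κ c !) r) ⟨
      total! κ ∎
      where
      open ≡-Reasoning
      c₀ = c
      fact : κ c ℕ.* (κ ⊖ c) c ! ≡ κ c !
      fact = trans (cong (ℕ._* (κ ⊖ c) c !) (sym ⊖-self)) (cong _! ⊖-self)

  module _ (κ : C → ℕ) {n} (c : C) (v : Vec C n) where

    cons-content : 1 ≤ κ c → HasContent (κ ⊖ c) v → HasContent κ (c ∷ v)
    cons-content 1≤κc h c′ with c ≟ c′ | h c′
    ... | yes refl | eq = trans (cong suc eq) (ℕ.m+[n∸m]≡n 1≤κc)
    ... | no _     | eq = eq

    cons-content⁻ : HasContent κ (c ∷ v) → HasContent (κ ⊖ c) v
    cons-content⁻ h c′ = trans (sym (ℕ.m+n∸m≡n (δ c c′) (count c′ v))) (cong (_∸ δ c c′) (h c′))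

    cons-positive : HasContent κ (c ∷ v) → 1 ≤ κ c
    cons-positive h = subst (1 ≤_) (h c) (subst (λ d → 1 ≤ d + count c v) (sym (δ-refl c)) (s≤s z≤n))

  private
    -- The refining condition does not mention the word. It empties the set for a letter of
    -- multiplicity 0, so that the sum over the first letter may run over the whole alphabet.
    tails : (C → ℕ) → ℕ → C → Set
    tails κ n c = Refinement (Words (κ ⊖ c) n) (λ _ → 1 ≤ κ c)

    tails-finite : ∀ κ n c → Finite (tails κ n c)
    tails-finite κ n c = refinement-finite (λ _ → 1 ≤? κ c) (words-finite (κ ⊖ c) n)

    cons : ∀ κ n → Σ C (tails κ n) → Words κ (suc n)
    cons κ n (c , ((v , [ h ]) , [ 1≤κc ])) = c ∷ v , [ cons-content κ c v 1≤κc h ]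

    cons-injective : ∀ κ n {a b} → cons κ n a ≡ cons κ n b → a ≡ b
    cons-injective κ n {c , ((v , _) , _)} {c′ , ((v′ , _) , _)} eq with cong value eq
    ... | refl = refl

    cons-surjective : ∀ κ n v → ∃[ a ] cons κ n a ≡ v
    cons-surjective κ n (c ∷ v , [ h ]) = (c , ((v , [ cons-content⁻ κ c v h ]) , [ cons-positive κ c v h ])) , refl

  -- The multinomial coefficient n! / ∏ κ(c)!, by its recurrence on the first letter.
  size-words : ∀ n κ → total κ ≡ n → size (words-finite κ n) ℕ.* total! κ ≡ n !
  size-words zero κ eq = cong₂ ℕ._*_ one
    (trans (cong product (List.map-cong (λ c → cong _! (sum≡0 eq (complete I c))) (elements I))) (ones (elements I)))
    where
    one : size (words-finite κ 0) ≡ 1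
    one with hasContent? κ []
    ... | yes _ = refl
    ... | no ¬h = contradiction (λ c → sym (sum≡0 eq (complete I c))) ¬h
    ones : ∀ (cs : List C) → product (map (λ _ → 1) cs) ≡ 1
    ones []       = refl
    ones (_ ∷ cs) = trans (ℕ.*-identityˡ _) (ones cs)
  size-words (suc n) κ eq = begin
    size (words-finite κ (suc n)) ℕ.* total! κ
      ≡⟨ cong (ℕ._* total! κ) (size-bijection (Σ-finite I (tails-finite κ n)) (words-finite κ (suc n)) (cons κ n)
           (cons-injective κ n) (cons-surjective κ n)) ⟨
    size (Σ-finite I (tails-finite κ n)) ℕ.* total! κ
      ≡⟨ cong (ℕ._* total! κ) (size-Σ I (tails-finite κ n)) ⟩
    sum (map (λ c → size (tails-finite κ n c)) (elements I)) ℕ.* total! κ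
      ≡⟨ sum-map-* (λ c → size (tails-finite κ n c)) (total! κ) (elements I) ⟨
    sum (map (λ c → size (tails-finite κ n c) ℕ.* total! κ) (elements I))
      -- The factor `κ c` comes from comparing `total! κ` with `total! (κ ⊖ c)`; a letter of
      -- multiplicity 0 contributes 0 on both sides.
      ≡⟨ cong sum (List.map-cong step (elements I)) ⟩
    sum (map (λ c → κ c ℕ.* n !) (elements I))
      ≡⟨ sum-map-* κ (n !) (elements I) ⟩
    total κ ℕ.* n !
      ≡⟨ cong (ℕ._* n !) eq ⟩
    suc n ℕ.* n ! ∎
    where
    open ≡-Reasoning
    size-tails : ∀ c → size (tails-finite κ n c) ≡ (if does (1 ≤? κ c) then size (words-finite (κ ⊖ c) n) else 0)
    size-tails c = refineList-const (1 ≤? κ c) (elements (words-finite (κ ⊖ c) n))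
    positive : ∀ c → 1 ≤ κ c → size (words-finite (κ ⊖ c) n) ℕ.* total! κ ≡ κ c ℕ.* n !
    positive c 1≤κc = begin
      size (words-finite (κ ⊖ c) n) ℕ.* total! κ
        ≡⟨ cong (size (words-finite (κ ⊖ c) n) ℕ.*_) (total!-⊖ κ c 1≤κc) ⟨
      size (words-finite (κ ⊖ c) n) ℕ.* (κ c ℕ.* total! (κ ⊖ c))
        ≡⟨ solve 3 (λ a b c → a :* (b :* c) := b :* (a :* c)) refl (size (words-finite (κ ⊖ c) n)) (κ c) (total! (κ ⊖ c)) ⟩
      κ c ℕ.* (size (words-finite (κ ⊖ c) n) ℕ.* total! (κ ⊖ c))
        ≡⟨ cong (κ c ℕ.*_) (size-words n (κ ⊖ c) (ℕ.suc-injective (trans (total-⊖ κ c 1≤κc) eq))) ⟩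
      κ c ℕ.* n ! ∎
      where open +-*-Solver
    byCases : ∀ c (1≤κc? : Dec (1 ≤ κ c)) →
      (if does 1≤κc? then size (words-finite (κ ⊖ c) n) else 0) ℕ.* total! κ ≡ κ c ℕ.* n !
    byCases c (yes 1≤κc) = positive c 1≤κc
    byCases c (no  1≰κc) = cong (ℕ._* n !) (sym (ℕ.n≤0⇒n≡0 (ℕ.s≤s⁻¹ (ℕ.≰⇒> 1≰κc))))
    step : ∀ c → size (tails-finite κ n c) ℕ.* total! κ ≡ κ c ℕ.* n !
    step c = trans (cong (ℕ._* total! κ) (size-tails c)) (byCases c (1 ≤? κ c))

-- Permutations

-- Lehmer codes: the image of 0, followed by a permutation of the remaining values.
Perm : ℕ → Set
Perm zero    = Unit
Perm (suc m) = Fin (suc m) × Perm m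

Perm-finite : ∀ m → Finite (Perm m)
Perm-finite zero    = record { elements = tt ∷ [] ; complete = λ _ → here refl ; unique = [] ∷ [] }
Perm-finite (suc m) = ×-finite (Fin-finite (suc m)) (Perm-finite m)

size-Perm : ∀ m → size (Perm-finite m) ≡ m !
size-Perm zero    = refl
size-Perm (suc m) = trans (size-× (Fin-finite (suc m)) (Perm-finite m))
  (cong₂ ℕ._*_ (List.length-tabulate {n = suc m} (λ i → i)) (size-Perm m))

act : ∀ {m} → Perm m → Fin m → Fin m
act {suc m} (j , π) zero    = j
act {suc m} (j , π) (suc i) = punchIn j (act π i)

act-surjective : ∀ {m} (π : Perm m) i → ∃[ j ] act π j ≡ i
act-surjective {suc m} (j , π) i with j Fin.≟ i
... | yes j≡i = zero , j≡i
... | no  j≢i = let i′ , eq = act-surjective π (punchOut j≢i) in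
                suc i′ , trans (cong (punchIn j) eq) (Fin.punchIn-punchOut j≢i)

act-injective : ∀ {m} (π : Perm m) {i j} → act π i ≡ act π j → i ≡ j
act-injective {suc m} (a , π) {zero}  {zero}  eq = refl
act-injective {suc m} (a , π) {zero}  {suc j} eq = contradiction (sym eq) (Fin.punchInᵢ≢i a (act π j))
act-injective {suc m} (a , π) {suc i} {zero}  eq = contradiction eq (Fin.punchInᵢ≢i a (act π i))
act-injective {suc m} (a , π) {suc i} {suc j} eq = cong suc (act-injective π (Fin.punchIn-injective a _ _ eq))

act-faithful : ∀ {m} (π π′ : Perm m) → (∀ i → act π i ≡ act π′ i) → π ≡ π′
act-faithful {zero}  π       π′        eq = refl
act-faithful {suc m} (j , π) (j′ , π′) eq with eq zero
... | refl = cong (j ,_) (act-faithful π π′ (λ i → Fin.punchIn-injective j _ _ (eq (suc i))))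

-- An injection is coded by its value at 0 followed by the code of the remaining values, with that
-- first value punched out.
act-full : ∀ {m} (f : Fin m → Fin m) → (∀ {i j} → f i ≡ f j → i ≡ j) → ∃[ π ] (∀ i → act π i ≡ f i)
act-full {zero}  f inj = tt , λ ()
act-full {suc m} f inj = (f zero , proj₁ rec) , λ
  { zero    → refl
  ; (suc i) → trans (cong (punchIn (f zero)) (proj₂ rec i)) (Fin.punchIn-punchOut (ne i)) }
  where
  ne : ∀ i → f zero ≢ f (suc i)
  ne i eq with () ← inj eq
  rec : ∃[ π ] (∀ i → act π i ≡ punchOut (ne i))
  rec = act-full (λ i → punchOut (ne i)) (λ {i} {j} eq → Fin.suc-injective (inj (Fin.punchOut-injective (ne i) (ne j) eq)))

-- The permutations of the p pointed blocks; for o = 1 those fixing the block of the root.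
actₒ : ∀ (o : Fin 2) {p} → Perm (p ∸ toℕ o) → Fin p → Fin p
actₒ zero       π i       = act π i
actₒ (suc zero) π zero    = zero
actₒ (suc zero) π (suc i) = suc (act π i)

actₒ-surjective : ∀ (o : Fin 2) {p} (π : Perm (p ∸ toℕ o)) i → ∃[ j ] actₒ o π j ≡ i
actₒ-surjective zero       π i       = act-surjective π i
actₒ-surjective (suc zero) π zero    = zero , refl
actₒ-surjective (suc zero) π (suc i) = let j , eq = act-surjective π i in suc j , cong suc eq

actₒ-injective : ∀ (o : Fin 2) {p} (π : Perm (p ∸ toℕ o)) {i j} → actₒ o π i ≡ actₒ o π j → i ≡ j
actₒ-injective zero       π                 eq = act-injective π eq
actₒ-injective (suc zero) π {zero}  {zero}  eq = refl
actₒ-injective (suc zero) π {suc i} {suc j} eq = cong suc (act-injective π (Fin.suc-injective eq))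

actₒ-faithful : ∀ (o : Fin 2) {p} (π π′ : Perm (p ∸ toℕ o)) → (∀ i → actₒ o π i ≡ actₒ o π′ i) → π ≡ π′
actₒ-faithful zero               π π′ eq = act-faithful π π′ eq
actₒ-faithful (suc zero) {zero}  π π′ eq = refl
actₒ-faithful (suc zero) {suc p} π π′ eq = act-faithful π π′ (λ i → Fin.suc-injective (eq (suc i)))

actₒ-fixes-0 : ∀ (o : Fin 2) {p} (π : Perm (p ∸ toℕ o)) {i : Fin p} → o ≡ suc zero → toℕ i ≡ 0 → toℕ (actₒ o π i) ≡ 0
actₒ-fixes-0 (suc zero) π {zero} _ _ = refl

actₒ-full : ∀ (o : Fin 2) {p} (f : Fin p → Fin p) → (∀ {i j} → f i ≡ f j → i ≡ j) →
  (o ≡ suc zero → ∀ {i} → toℕ i ≡ 0 → toℕ (f i) ≡ 0) → ∃[ π ] (∀ i → actₒ o π i ≡ f i)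
actₒ-full zero               f inj fix = act-full f inj
actₒ-full (suc zero) {zero}  f inj fix = tt , λ ()
actₒ-full (suc zero) {suc p} f inj fix = proj₁ rec , λ
  { zero    → sym f0
  ; (suc i) → trans (cong suc (proj₂ rec i)) (Fin.punchIn-punchOut (ne i)) }
  where
  f0 : f zero ≡ zero
  f0 = Fin.toℕ-injective (fix refl {zero} refl)
  ne : ∀ i → zero ≢ f (suc i)
  ne i eq with () ← inj (trans f0 eq)
  rec : ∃[ π ] (∀ i → act π i ≡ punchOut (ne i))
  rec = act-full (λ i → punchOut (ne i)) (λ {i} {j} eq → Fin.suc-injective (inj (Fin.punchOut-injective (ne i) (ne j) eq)))

-- Labelled partitions as words

⊎-finite : ∀ {A B : Set} → Finite A → Finite B → Finite (A ⊎ B)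
⊎-finite I J = record
  { elements = map inj₁ (elements I) ++ map inj₂ (elements J)
  ; complete = λ { (inj₁ a) → ∈-++⁺ˡ (∈-map⁺ inj₁ (complete I a))
                 ; (inj₂ b) → ∈-++⁺ʳ (map inj₁ (elements I)) (∈-map⁺ inj₂ (complete J b)) }
  ; unique   = Unique.++⁺ (Unique.map⁺ Sum.inj₁-injective (unique I)) (Unique.map⁺ Sum.inj₂-injective (unique J))
                 (λ (i , j) → disjoint (∈-map⁻ inj₁ i) (∈-map⁻ inj₂ j))
  }
  where
  disjoint : ∀ {u} → ∃[ a ] a ∈ₗ elements I × u ≡ inj₁ a → ∃[ b ] b ∈ₗ elements J × u ≡ inj₂ b → ⊥
  disjoint (_ , _ , refl) (_ , _ , ())

Letter : ℕ → ℕ → Set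
Letter p q = Label p q × Bool

Label-finite : ∀ p q → Finite (Label p q)
Label-finite p q = ⊎-finite (Fin-finite p) (Fin-finite q)

Letter-finite : ∀ p q → Finite (Letter p q)
Letter-finite p q = ×-finite (Label-finite p q) Bool-finite

_≟ᶜ_ : ∀ {p q} → DecidableEquality (Letter p q)
_≟ᶜ_ = Product.≡-dec _≟ᵘ_ Bool._≟_

module Letters p q = Words (Letter-finite p q) _≟ᶜ_
module Labels p q = Words (Label-finite p q) _≟ᵘ_

module _ {n k p q : ℕ} {x : SemiPointed n k} (o : Fin 2) (L : Labelling x p q) where
  open Labelling L

  -- For o = 1 the block of the root must have label 0. Only the other p - 1 pointed blocks can then
  -- be permuted, whence the factor (p - o)!.
  RootLabel : Set
  RootLabel = o ≡ suc zero → ∀ {e} → toℕ e ≡ 0 → ∃[ a ] label e ≡ inj₁ a × toℕ a ≡ 0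

  module _ (α : Perm (p ∸ toℕ o)) (β : Perm q) where

    permute : Label p q → Label p q
    permute = Sum.map (actₒ o α) (act β)

    permute-injective : ∀ {u v} → permute u ≡ permute v → u ≡ v
    permute-injective {inj₁ a} {inj₁ b} eq = cong inj₁ (actₒ-injective o α (Sum.inj₁-injective eq))
    permute-injective {inj₂ a} {inj₂ b} eq = cong inj₂ (act-injective β (Sum.inj₂-injective eq))

    relabel : Labelling x p q
    relabel = record
      { label         = permute ∘ label
      ; same⇒label    = λ s → cong permute (same⇒label s)
      ; label⇒same    = λ eq → label⇒same (permute-injective eq)
      ; rep           = λ { (inj₁ a) → rep (inj₁ (proj₁ (actₒ-surjective o α a)))
                          ; (inj₂ b) → rep (inj₂ (proj₁ (act-surjective β b))) }
      ; label-rep     = λ { (inj₁ a) → trans (cong permute (label-rep _)) (cong inj₁ (proj₂ (actₒ-surjective o α a)))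
                          ; (inj₂ b) → trans (cong permute (label-rep _)) (cong inj₂ (proj₂ (act-surjective β b))) }
      ; rep-pointed   = λ a → rep-pointed _
      ; rep-unpointed = λ b → rep-unpointed _
      }

    relabel-root : RootLabel → o ≡ suc zero → ∀ {e} → toℕ e ≡ 0 → ∃[ a ] permute (label e) ≡ inj₁ a × toℕ a ≡ 0
    relabel-root r o≡1 e≡0 = let a , eq , a≡0 = r o≡1 e≡0 in
      actₒ o α a , cong permute eq , actₒ-fixes-0 o α o≡1 a≡0

  -- Every label is attained, namely at its representative, so agreement on elements forces
  -- agreement on labels.
  relabel-faithful : ∀ {α α′ β β′} → (∀ i → permute α β (label i) ≡ permute α′ β′ (label i)) → α ≡ α′ × β ≡ β′
  relabel-faithful {α} {α′} {β} {β′} eq =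
    actₒ-faithful o α α′ (λ a → Sum.inj₁-injective (pointwise (inj₁ a))) ,
    act-faithful β β′ (λ b → Sum.inj₂-injective (pointwise (inj₂ b)))
    where
    pointwise : ∀ u → permute α β u ≡ permute α′ β′ u
    pointwise u = subst (λ v → permute α β v ≡ permute α′ β′ v) (label-rep u) (eq (rep u))

-- The permutation sends a label of `L` to the `L′`-label of its representative. It keeps pointed
-- and unpointed labels apart because being pointed is a property of the block, and for o = 1 it
-- fixes 0 because both labellings give 0 to the block of the root.
relabel-full : ∀ {n k p q} {x : SemiPointed n k} o (L L′ : Labelling x p q) → RootLabel o L → RootLabel o L′ →
  (∃[ e ] toℕ {n} e ≡ 0) →
  ∃[ αβ ] (∀ i → permute o L (proj₁ αβ) (proj₂ αβ) (Labelling.label L i) ≡ Labelling.label L′ i)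
relabel-full {x = x} o L L′ r r′ (e , e≡0) = (proj₁ A , proj₁ B) , eq
  where
  module L = Labelling L
  module L′ = Labelling L′
  f : ∀ a → ∃[ a′ ] L′.label (L.rep (inj₁ a)) ≡ inj₁ a′
  f a = let a′ , eq , _ = L′.pointed-label (L.rep-pointed a) in a′ , eq
  g : ∀ b → ∃[ b′ ] L′.label (L.rep (inj₂ b)) ≡ inj₂ b′
  g b = L′.unpointed-label (L.rep-unpointed b)
  back : ∀ {u v} → L′.label (L.rep u) ≡ L′.label (L.rep v) → u ≡ v
  back {u} {v} eq = trans (sym (L.label-rep u)) (trans (L.same⇒label (L′.label⇒same eq)) (L.label-rep v))
  via : ∀ {i u} → L.label i ≡ u → L′.label (L.rep u) ≡ L′.label i
  via eq = L′.same⇒label (same-sym x (L.rep-same eq))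
  fix : o ≡ suc zero → ∀ {a} → toℕ a ≡ 0 → toℕ (proj₁ (f a)) ≡ 0
  fix o≡1 {a} a≡0 = let a₀ , eq₀ , a₀≡0 = r o≡1 e≡0
                        a₁ , eq₁ , a₁≡0 = r′ o≡1 e≡0
                        eqₐ = trans eq₀ (cong inj₁ (Fin.toℕ-injective (trans a₀≡0 (sym a≡0))))
                    in trans (cong toℕ (Sum.inj₁-injective (trans (sym (proj₂ (f a))) (trans (via eqₐ) eq₁)))) a₁≡0
  A = actₒ-full o (proj₁ ∘ f) (λ {a} {b} eq → Sum.inj₁-injective (back
        (trans (proj₂ (f a)) (trans (cong inj₁ eq) (sym (proj₂ (f b))))))) fix
  B = act-full (proj₁ ∘ g) (λ {a} {b} eq → Sum.inj₂-injective (back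
        (trans (proj₂ (g a)) (trans (cong inj₂ eq) (sym (proj₂ (g b)))))))
  eq : ∀ i → permute o L (proj₁ A) (proj₁ B) (L.label i) ≡ L′.label i
  eq i with L.label i in eqₗ
  ... | inj₁ a = trans (cong inj₁ (proj₂ A a)) (trans (sym (proj₂ (f a))) (via eqₗ))
  ... | inj₂ b = trans (cong inj₂ (proj₂ B b)) (trans (sym (proj₂ (g b))) (via eqₗ))

firstElement≡0 : ∀ {n p} o (d : Defined n p o) → toℕ (firstElement {n} {p} o d) ≡ 0
firstElement≡0 {suc n} o          d           = refl
firstElement≡0 {zero}  (suc zero) (1≤p , p≤0) = contradiction (ℕ.≤-trans 1≤p p≤0) (λ ())

module _ {p q : ℕ} where

  RootLetter : Letter p q → Set
  RootLetter (inj₁ a , true)  = toℕ a ≡ 0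
  RootLetter (inj₁ a , false) = ⊥
  RootLetter (inj₂ b , _)     = ⊥

  rootLetter? : Decidable RootLetter
  rootLetter? (inj₁ a , true)  = toℕ a ℕ.≟ 0
  rootLetter? (inj₁ a , false) = no λ ()
  rootLetter? (inj₂ b , _)     = no λ ()

  -- Phrased through positions of value 0 rather than the position `zero`, so that it also makes
  -- sense for a word of length 0.
  RootFirst : ∀ {k} → Fin 2 → Vec (Letter p q) k → Set
  RootFirst o w = o ≡ suc zero → ∀ i → toℕ i ≡ 0 → RootLetter (lookup w i)

  rootFirst? : ∀ {k} o → Decidable (RootFirst {k} o)
  rootFirst? o w = o Fin.≟ suc zero →-dec Fin.all? (λ i → toℕ i ℕ.≟ 0 →-dec rootLetter? (lookup w i))

  rootLetter⁻ : ∀ {c} → RootLetter c → ∃[ a ] c ≡ (inj₁ a , true) × toℕ a ≡ 0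
  rootLetter⁻ {inj₁ a , true} a≡0 = a , refl , a≡0

-- The letter of an element of V₁ is the label of its block, marked by true when
-- the element is the point of that block.
letterContent : ∀ {p q} → (Label p q → ℕ) → Letter p q → ℕ
letterContent K (inj₁ a , true)  = 1
letterContent K (inj₁ a , false) = K (inj₁ a) ∸ 1
letterContent K (inj₂ b , true)  = 0
letterContent K (inj₂ b , false) = K (inj₂ b)

sum-map-tabulate : ∀ {A : Set} {m} (f : A → ℕ) (g : Fin m → A) → sum (map f (List.tabulate g)) ≡ Vec.sum (tabulate (f ∘ g))
sum-map-tabulate {m = zero}  f g = refl
sum-map-tabulate {m = suc m} f g = cong (f (g zero) +_) (sum-map-tabulate f (g ∘ suc))

sum-labels : ∀ p q (f : Label p q → ℕ) →
  sum (map f (elements (Label-finite p q))) ≡ Vec.sum (tabulate (f ∘ inj₁)) + Vec.sum (tabulate (f ∘ inj₂))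
sum-labels p q f = trans (cong sum (List.map-++ f (map inj₁ (allFin p)) (map inj₂ (allFin q))))
  (trans (sum-++ (map f (map inj₁ (allFin p))) _) (cong₂ _+_ (part inj₁) (part inj₂)))
  where
  part : ∀ {m} (h : Fin m → Label p q) → sum (map f (map h (allFin m))) ≡ Vec.sum (tabulate (f ∘ h))
  part h = trans (cong sum (sym (List.map-∘ {g = f} {f = h} (allFin _)))) (sum-map-tabulate (f ∘ h) id)

sum-letters : ∀ {p q} (f : Letter p q → ℕ) us →
  sum (map f (List.cartesianProduct us (true ∷ false ∷ []))) ≡ sum (map (λ u → f (u , true) + f (u , false)) us)
sum-letters f []       = refl
sum-letters f (u ∷ us) = trans (cong (λ s → f (u , true) + (f (u , false) + s)) (sum-letters f us))
  (sym (ℕ.+-assoc (f (u , true)) (f (u , false)) _))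

sum-split : ∀ p q (f : Fin (p + q) → ℕ) →
  Vec.sum (tabulate f) ≡ Vec.sum (tabulate (f ∘ join p q ∘ inj₁)) + Vec.sum (tabulate (f ∘ join p q ∘ inj₂))
sum-split zero    q f = refl
sum-split (suc p) q f = trans (cong (f zero +_) (sum-split p q (f ∘ suc))) (sym (ℕ.+-assoc (f zero) _ _))

sum-splitAt : ∀ p q (f : Label p q → ℕ) →
  Vec.sum (tabulate (f ∘ splitAt p)) ≡ sum (map f (elements (Label-finite p q)))
sum-splitAt p q f = trans (sum-split p q (f ∘ splitAt p)) (trans (cong₂ _+_
  (cong Vec.sum (Vec.tabulate-cong λ a → cong f (Fin.splitAt-↑ˡ p a q)))
  (cong Vec.sum (Vec.tabulate-cong λ b → cong f (Fin.splitAt-↑ʳ p q b)))) (sym (sum-labels p q f)))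

Defined⇒1≤ : ∀ {n p} o → Defined n p o → 1 ≤ n
Defined⇒1≤ zero       p<n         = ℕ.≤-trans (s≤s z≤n) p<n
Defined⇒1≤ (suc zero) (1≤p , p≤n) = ℕ.≤-trans 1≤p p≤n

Defined⇒o≤p : ∀ {n p} o → Defined n p o → toℕ o ≤ p
Defined⇒o≤p zero       _         = z≤n
Defined⇒o≤p (suc zero) (1≤p , _) = 1≤p

-- Pairs of words and the index they determine

module Coding (k l : ℕ) (o : Fin 2) where

  -- What a pair of words must satisfy to describe a labelled partition, stated without an index:
  -- the block sizes are not prescribed but read off afterwards.
  record IsCode (p q : ℕ) (w : Vec (Letter p q) k) (g : Vec (Label p q) l) : Set where
    field
      marks   : ∀ a → Letters.count p q (inj₁ a , true) w ≡ 1
      nomarks : ∀ b → Letters.count p q (inj₂ b , true) w ≡ 0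
      hits    : ∀ b → 1 ≤ Labels.count p q (inj₂ b) g
      root    : RootFirst o w
      defined : Defined (p + q) p o

  module _ (t : Index k l o) where
    open Index t

    ks∘ ls∘ : Label p q → ℕ
    ks∘ u = ks (join p q u)
    ls∘ u = ls (join p q u)

    HasProfile : Vec (Letter p q) k × Vec (Label p q) l → Set
    HasProfile (w , g) = Letters.HasContent p q (letterContent ks∘) w × Labels.HasContent p q ls∘ g × RootFirst o w

    hasProfile? : Decidable HasProfile
    hasProfile? (w , g) = Letters.hasContent? p q (letterContent ks∘) w ×-dec Labels.hasContent? p q ls∘ g ×-dec rootFirst? o w

    Codes : Set
    Codes = Refinement (Vec (Letter p q) k × Vec (Label p q) l) HasProfile

    Codes-finite : Finite Codes
    Codes-finite = refinement-finite hasProfile? (×-finite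
      (Vec-finite (Letter-finite p q) k) (Vec-finite (Label-finite p q) l))

    profile : (c : Codes) → HasProfile (value c)
    profile (wg , [ h ]) = recompute (hasProfile? wg) h

    admissible : Admissible k l o (value tuples)
    admissible = go tuples
      where
      go : (t : Refinement Tuples (Admissible k l o)) → Admissible k l o (value t)
      go (t , [ h ]) = recompute (admissible? k l o t) h

    sum-ks : Vec.sum (tabulate (ks∘ ∘ inj₁)) + Vec.sum (tabulate (ks∘ ∘ inj₂)) ≡ k
    sum-ks = let _ , _ , _ , _ , _ , _ , eq = admissible in
      trans (sym (sum-split p q ks)) (trans (cong Vec.sum (Vec.tabulate∘lookup (proj₂ (proj₂ (proj₂ (value tuples)))))) eq)

    sum-ls : Vec.sum (tabulate (ls∘ ∘ inj₁)) + Vec.sum (tabulate (ls∘ ∘ inj₂)) ≡ l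
    sum-ls = let _ , _ , _ , _ , eq , _ , _ = admissible in
      trans (sym (sum-split p q ls)) (trans (cong Vec.sum (Vec.tabulate∘lookup (proj₁ (proj₂ (proj₂ (value tuples)))))) eq)

    1≤ks : ∀ a → 1 ≤ ks∘ (inj₁ a)
    1≤ks = let _ , _ , _ , _ , _ , h , _ = admissible in h

    letterContent-total : ∀ u → letterContent ks∘ (u , true) + letterContent ks∘ (u , false) ≡ ks∘ u
    letterContent-total (inj₁ a) = ℕ.m+[n∸m]≡n (1≤ks a)
    letterContent-total (inj₂ b) = refl

    isCode : (c : Codes) → IsCode p q (proj₁ (value c)) (proj₂ (value c))
    isCode c = let hw , hg , r = profile c
                   _ , _ , _ , 1≤l , _ = admissible in record
      { marks   = λ a → hw (inj₁ a , true)
      ; nomarks = λ b → hw (inj₂ b , true)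
      ; hits    = λ b → subst (1 ≤_) (sym (hg (inj₂ b))) (1≤l b)
      ; root    = r
      ; defined = rootDefined
      }

  module _ (p q : ℕ) (w : Vec (Letter p q) k) (g : Vec (Label p q) l) where

    private
      #V₁ #V₂ : Label p q → ℕ
      #V₁ u = Letters.count p q (u , true) w + Letters.count p q (u , false) w
      #V₂ u = Labels.count p q u g

      profileTuples : Tuples
      profileTuples = p , q , tabulate (#V₂ ∘ splitAt p) , tabulate (#V₁ ∘ splitAt p)

      #-join : ∀ (# : Label p q → ℕ) u → lookup (tabulate (# ∘ splitAt p)) (join p q u) ≡ # u
      #-join # u = trans (Vec.lookup∘tabulate (# ∘ splitAt p) (join p q u)) (cong # (Fin.splitAt-join p q u))

      isAdmissible : IsCode p q w g → Admissible k l o profileTuples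
      isAdmissible c = Defined⇒1≤ o defined , Defined⇒o≤p o defined , defined
        , (λ b → subst (1 ≤_) (sym (#-join #V₂ (inj₂ b))) (hits b))
        , trans (sum-splitAt p q #V₂) (Labels.total-count p q g)
        , (λ a → subst (1 ≤_) (sym (#-join #V₁ (inj₁ a)))
             (subst (λ m → 1 ≤ m + Letters.count p q (inj₁ a , false) w) (sym (marks a)) (s≤s z≤n)))
        , trans (sum-splitAt p q #V₁) (trans (sym (sum-letters (λ c → Letters.count p q c w) (elements (Label-finite p q))))
            (Letters.total-count p q w))
        where open IsCode c

      profileIndex : .(IsCode p q w g) → Index k l o
      profileIndex c = index (profileTuples , [ isAdmissible c ])

      hasProfile : (c : IsCode p q w g) → HasProfile (profileIndex c) (w , g)
      hasProfile c = letters , (λ u → sym (#-join #V₂ u)) , root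
        where
        open IsCode c
        letters : Letters.HasContent p q (letterContent (ks∘ (profileIndex c))) w
        letters (inj₁ a , true)  = marks a
        letters (inj₁ a , false) = sym (cong (_∸ 1) (trans (#-join #V₁ (inj₁ a))
          (cong (_+ Letters.count p q (inj₁ a , false) w) (marks a))))
        letters (inj₂ b , true)  = nomarks b
        letters (inj₂ b , false) = sym (trans (#-join #V₁ (inj₂ b)) (cong (_+ Letters.count p q (inj₂ b , false) w) (nomarks b)))

    -- The index is computed from the words and the validity proof is irrelevant, so for given `p`
    -- and `q` equal words give equal results.
    fromCode : .(IsCode p q w g) → Σ (Index k l o) Codes
    fromCode c = profileIndex c , ((w , g) , [ hasProfile c ])

  -- The letter counts of a code are prescribed by its index, so the index recomputed from them has
  -- the same two vectors. Once these are identified by `ext`, only irrelevant proofs remain.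
  fromCode-isCode : ∀ t (c : Codes t) → fromCode (Index.p t) (Index.q t) (proj₁ (value c)) (proj₂ (value c)) (isCode t c) ≡ (t , c)
  fromCode-isCode t@(index ((p , q , ls , ks) , [ h ])) c@((w , g) , [ h′ ]) = ext (vec-ext ls#) (vec-ext ks#)
    where
    ext : ∀ {ls′ ks′} .{h₁ : Admissible k l o (p , q , ls′ , ks′)} 
      .{h₂ : HasProfile (index ((p , q , ls′ , ks′) , [ h₁ ])) (w , g)} → ls′ ≡ ls → ks′ ≡ ks →
      _≡_ {A = Σ (Index k l o) Codes} (index ((p , q , ls′ , ks′) , [ h₁ ]) , ((w , g) , [ h₂ ])) (t , c)
    ext refl refl = refl
    vec-ext : ∀ {m} {f : Fin m → ℕ} {v : Vec ℕ m} → (∀ i → f i ≡ lookup v i) → tabulate f ≡ v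
    vec-ext {v = v} eq = trans (Vec.tabulate-cong eq) (Vec.tabulate∘lookup v)
    ls# : ∀ v → Labels.count p q (splitAt p v) g ≡ lookup ls v
    ls# v = trans (proj₁ (proj₂ (profile t c)) (splitAt p v)) (cong (lookup ls) (Fin.join-splitAt p q v))
    ks# : ∀ v → Letters.count p q (splitAt p v , true) w + Letters.count p q (splitAt p v , false) w ≡ lookup ks v
    ks# v = trans (cong₂ _+_ (proj₁ (profile t c) (splitAt p v , true)) (proj₁ (profile t c) (splitAt p v , false)))
      (trans (letterContent-total t (splitAt p v)) (cong (lookup ks) (Fin.join-splitAt p q v)))

-- The first component is recovered by `g`; after identifying it, injectivity on a single fibre
-- suffices. The intended `g` is `decode`.
Σ-injective : ∀ {A S : Set} {B : A → Set} (f : Σ A B → S) (g : S → A) → (∀ ab → g (f ab) ≡ proj₁ ab) →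
  (∀ a b b′ → f (a , b) ≡ f (a , b′) → b ≡ b′) → ∀ {ab ab′} → f ab ≡ f ab′ → ab ≡ ab′
Σ-injective f g g-f inj {a , b} {a′ , b′} eq with trans (sym (g-f (a , b))) (trans (cong g eq) (g-f (a′ , b′)))
... | refl = cong (a ,_) (inj a b b′ eq)

-- The bijection between ordered partitions and codes

module Bijection (k l : ℕ) (o : Fin 2) (d : Defined (k + l) k o) where
  open Coding k l o

  private
    n = k + l

  firstV₁ : o ≡ suc zero → ∃[ i ] toℕ {k} i ≡ 0
  firstV₁ refl = let 1≤k , _ = d in fromℕ< 1≤k , Fin.toℕ-fromℕ< 1≤k

  rootElement : ∀ {e : Fin n} → o ≡ suc zero → toℕ e ≡ 0 → ∃[ i ] e ≡ i ↑ˡ l × toℕ {k} i ≡ 0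
  rootElement {e} o≡1 e≡0 = let i , i≡0 = firstV₁ o≡1 in
    i , Fin.toℕ-injective (trans e≡0 (sym (trans (Fin.toℕ-↑ˡ i l) i≡0))) , i≡0

  module Decode {p q} (w : Vec (Letter p q) k) (g : Vec (Label p q) l) (c : IsCode p q w g) where
    open IsCode c

    label : Fin n → Label p q
    label i = [ proj₁ ∘ lookup w , lookup g ]′ (splitAt k i)

    label-↑ˡ : ∀ i → label (i ↑ˡ l) ≡ proj₁ (lookup w i)
    label-↑ˡ i = cong [ proj₁ ∘ lookup w , lookup g ]′ (Fin.splitAt-↑ˡ k i l)

    label-↑ʳ : ∀ j → label (k ↑ʳ j) ≡ lookup g j
    label-↑ʳ j = cong [ proj₁ ∘ lookup w , lookup g ]′ (Fin.splitAt-↑ʳ k l j)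

    private
      E : ∀ a → Enumeration (λ i → lookup w i ≡ (inj₁ a , true)) 1
      E a = subst (Enumeration _) (marks a) (Letters.positions p q w (inj₁ a , true))

    mark : Fin p → Fin k
    mark a = Enumeration.at (E a) zero

    lookup-mark : ∀ a → lookup w (mark a) ≡ (inj₁ a , true)
    lookup-mark a = Enumeration.at-∈ (E a) zero

    mark-unique : ∀ {a i} → lookup w i ≡ (inj₁ a , true) → i ≡ mark a
    mark-unique {a} eq with Enumeration.surjective (E a) eq
    ... | zero , eq′ = sym eq′

    mark-pointed : ∀ {b i} → lookup w i ≢ (inj₂ b , true)
    mark-pointed {b} eq with proj₁ (Enumeration.surjective (subst (Enumeration _) (nomarks b) (Letters.positions p q w (inj₂ b , true))) eq)
    ... | ()

    -- `hits b` reads as 0 < count, so this is the first occurrence of the label. An occurrence on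
    -- V₂ is what allows the block to stay unpointed.
    hit : Fin q → Fin l
    hit b = Enumeration.at (Labels.positions p q g (inj₂ b)) (fromℕ< (hits b))

    rep : Label p q → Fin n
    rep (inj₁ a) = mark a ↑ˡ l
    rep (inj₂ b) = k ↑ʳ hit b

    label-rep : ∀ u → label (rep u) ≡ u
    label-rep (inj₁ a) = trans (label-↑ˡ (mark a)) (cong proj₁ (lookup-mark a))
    label-rep (inj₂ b) = trans (label-↑ʳ (hit b)) (Enumeration.at-∈ (Labels.positions p q g (inj₂ b)) _)

    pointOf : Label p q → Maybe (Fin n)
    pointOf (inj₁ a) = just (rep (inj₁ a))
    pointOf (inj₂ b) = nothing

    pointOf-just : ∀ {u e} → pointOf u ≡ just e → ∃[ a ] u ≡ inj₁ a × e ≡ rep (inj₁ a)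
    pointOf-just {inj₁ a} refl = a , refl , refl

    pointOf-nothing : ∀ {u} → pointOf u ≡ nothing → ∃[ b ] u ≡ inj₂ b
    pointOf-nothing {inj₂ b} eq = b , refl

    partitionData : PartitionData n k
    partitionData = record
      { _≋_     = λ i j → label i ≡ label j
      ; _≋?_    = λ i j → label i ≟ᵘ label j
      ; ≋-refl  = refl
      ; ≋-sym   = sym
      ; ≋-trans = trans
      ; pt      = pointOf ∘ label
      ; pt-cong = cong pointOf
      ; pt-in   = λ eq → let a , eq′ , r = pointOf-just eq in trans eq′ (sym (trans (cong label r) (label-rep (inj₁ a))))
      ; pt<p    = λ eq → let a , _ , r = pointOf-just eq in subst (λ e → toℕ e < k) (sym r) (join-inj₁-< k l (mark a))
      ; unpt    = λ eq → let b , eq′ = pointOf-nothing eq in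
                    rep (inj₂ b) , trans eq′ (sym (label-rep (inj₂ b))) , join-inj₂-≥ k l (hit b)
      }

    partition : SemiPointed n k
    partition = build partitionData

    pointAt-partition : ∀ {i u} → label i ≡ u → pointAt partition i ≡ pointOf u
    pointAt-partition {i} eq = trans (pointAt-build partitionData i) (cong pointOf eq)

    labelling : Labelling partition p q
    labelling = record
      { label         = label
      ; same⇒label    = same-build⁻ partitionData
      ; label⇒same    = same-build⁺ partitionData
      ; rep           = rep
      ; label-rep     = label-rep
      ; rep-pointed   = λ a → pointAt-partition (label-rep (inj₁ a))
      ; rep-unpointed = λ b → pointAt-partition (label-rep (inj₂ b))
      }

    -- A marked letter sits only at the chosen position of its label by `mark-unique`, and that
    -- position is the point of the block; hence the mark can be read back from the partition.
    marked : ∀ i → does (pointAt partition (i ↑ˡ l) ≟ᵐ just (i ↑ˡ l)) ≡ proj₂ (lookup w i)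
    marked i with lookup w i in eq
    ... | inj₁ a , true = dec-true (_ ≟ᵐ _) (trans (pointAt-partition (trans (label-↑ˡ i) (cong proj₁ eq)))
                            (cong (λ j → just (j ↑ˡ l)) (sym (mark-unique eq))))
    ... | inj₂ b , true = contradiction eq mark-pointed
    ... | u , false     = dec-false (_ ≟ᵐ _) λ eqₚ →
      let a , _ , r = pointOf-just (trans (sym (pointAt-partition refl)) eqₚ)
          i≡mark = Fin.↑ˡ-injective l i (mark a) r
      in contradiction (trans (sym (cong proj₂ eq)) (cong proj₂ (trans (cong (lookup w) i≡mark) (lookup-mark a)))) λ ()

    labelling-root : RootLabel o labelling
    labelling-root o≡1 e≡0 with rootElement o≡1 e≡0
    ... | i , refl , i≡0 = let a , eq , a≡0 = rootLetter⁻ (root o≡1 i i≡0) in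
      a , trans (label-↑ˡ i) (cong proj₁ eq) , a≡0

    -- For o = 0, `defined` says p < p + q, so there is an unpointed block. For o = 1 the first
    -- letter is marked, so the root is the point of its block.
    partition-root : ∃[ j ] pointAt partition j ≡ rootPoint n o
    partition-root = go o refl
      where
      unpointed : ∀ q → p < p + q → Fin q
      unpointed zero    p<p = contradiction (subst (p <_) (ℕ.+-identityʳ p) p<p) (ℕ.n≮n p)
      unpointed (suc q) _   = zero
      go : ∀ o′ → o ≡ o′ → ∃[ j ] pointAt partition j ≡ rootPoint n o′
      go zero       refl = let b = unpointed q defined in rep (inj₂ b) , pointAt-partition (label-rep (inj₂ b))
      go (suc zero) refl = let i , i≡0 = firstV₁ refl
                               a , eq , _ = rootLetter⁻ (root refl i i≡0)
                           in i ↑ˡ l , trans (pointAt-partition (trans (label-↑ˡ i) (cong proj₁ eq)))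
                                (sym (rootPoint-1 (trans (Fin.toℕ-↑ˡ (mark a) l) (trans (cong toℕ (sym (mark-unique eq))) i≡0))))

    element : ∣ P n k o d ∣
    element = partition , [ oneBlock-⊑ d {partition} partition-root , ⊑-singletons {x = partition} ]

  module Encode (x : ∣ P n k o d ∣) {p q} (L : Labelling (value x) p q) where
    open Labelling L

    letters : Vec (Letter p q) k
    letters = tabulate λ i → label (i ↑ˡ l) , does (pointAt (value x) (i ↑ˡ l) ≟ᵐ just (i ↑ˡ l))

    labels : Vec (Label p q) l
    labels = tabulate λ j → label (k ↑ʳ j)

    lookup-letters : ∀ i → lookup letters i ≡ (label (i ↑ˡ l) , does (pointAt (value x) (i ↑ˡ l) ≟ᵐ just (i ↑ˡ l)))
    lookup-letters i = Vec.lookup∘tabulate _ i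

    lookup-labels : ∀ j → lookup labels j ≡ label (k ↑ʳ j)
    lookup-labels j = Vec.lookup∘tabulate _ j

    fixed⁺ : ∀ {i} → pointAt (value x) (i ↑ˡ l) ≡ just (i ↑ˡ l) → lookup letters i ≡ (label (i ↑ˡ l) , true)
    fixed⁺ {i} eq = trans (lookup-letters i) (cong (label (i ↑ˡ l) ,_) (dec-true (_ ≟ᵐ _) eq))

    fixed⁻ : ∀ {i u} → lookup letters i ≡ (u , true) → label (i ↑ˡ l) ≡ u × pointAt (value x) (i ↑ˡ l) ≡ just (i ↑ˡ l)
    fixed⁻ {i} eq = let eq′ = trans (sym (lookup-letters i)) eq in
      cong proj₁ eq′ , does⇒ (_ ≟ᵐ _) (cong proj₂ eq′)

    inV₁ : ∀ {e} → toℕ e < k → ∃[ i ] e ≡ i ↑ˡ l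
    inV₁ {e} e<k with splitAt-cases k l e
    ... | inj₁ r          = r
    ... | inj₂ (j , refl) = contradiction (join-inj₂-≥ k l j) (ℕ.<⇒≱ e<k)

    inV₂ : ∀ {e} → k ≤ toℕ e → ∃[ j ] e ≡ k ↑ʳ j
    inV₂ {e} k≤e with splitAt-cases k l e
    ... | inj₁ (i , refl) = contradiction k≤e (ℕ.<⇒≱ (join-inj₁-< k l i))
    ... | inj₂ r          = r

    private
      -- The point of the block lies in V₁ by `point<p`, so it has a letter, and any marked letter
      -- with this label sits at the same point.
      marks : ∀ a → Letters.count p q (inj₁ a , true) letters ≡ 1
      marks a with inV₁ (point<p (value x) (rep-pointed a))
      ... | i , eqᵢ = enumeration-size (Letters.positions p q letters (inj₁ a , true)) record
        { at         = const i
        ; at-∈       = λ _ → trans (fixed⁺ (subst (λ e → pointAt (value x) e ≡ just e) eqᵢ (rep-pointed a)))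
                              (cong (_, true) (trans (cong label (sym eqᵢ)) (label-rep (inj₁ a))))
        ; injective  = λ { {zero} {zero} _ → refl }
        ; surjective = λ {j} eq → zero , let eqₗ , fixed = fixed⁻ eq in
            Fin.↑ˡ-injective l i j (trans (sym eqᵢ) (Maybe.just-injective (trans (sym (label-pointed eqₗ)) fixed)))
        }

      nomarks : ∀ b → Letters.count p q (inj₂ b , true) letters ≡ 0
      nomarks b = enumeration-size (Letters.positions p q letters (inj₂ b , true)) record
        { at         = λ ()
        ; at-∈       = λ ()
        ; injective  = λ { {()} }
        ; surjective = λ eq → let eqₗ , fixed = fixed⁻ eq in contradiction (trans (sym (label-unpointed eqₗ)) fixed) λ ()
        }

      hits : ∀ b → 1 ≤ Labels.count p q (inj₂ b) labels
      hits b = let e , s , k≤e = unpointed-V₂ (value x) (rep-unpointed b)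
                   j , eqⱼ = inV₂ k≤e
                   i , _ = Enumeration.surjective (Labels.positions p q labels (inj₂ b))
                     (trans (lookup-labels j) (trans (cong label (sym eqⱼ)) (trans (sym (same⇒label s)) (label-rep (inj₂ b)))))
               in ℕ.≤-trans (s≤s z≤n) (Fin.toℕ<n i)

      x-root : ∃[ j ] pointAt (value x) j ≡ rootPoint n o
      x-root = oneBlock-⊑⁻ d (firstElement o d) {value x} (∣P∣-⊑ {d = d} x)

      root-fixed : o ≡ suc zero → ∀ {e} → toℕ e ≡ 0 → pointAt (value x) e ≡ just e
      root-fixed refl e≡0 = point-fixed (value x) (trans (proj₂ x-root) (rootPoint-1 e≡0))

      root : RootLabel o L → RootFirst o letters
      root r o≡1 i i≡0 = let e≡0 = trans (Fin.toℕ-↑ˡ i l) i≡0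
                             a , eq , a≡0 = r o≡1 e≡0
        in subst RootLetter (sym (trans (fixed⁺ (root-fixed o≡1 e≡0)) (cong (_, true) eq))) a≡0

      defined : RootLabel o L → Defined (p + q) p o
      defined r = go o refl
        where
        go : ∀ o′ → o ≡ o′ → Defined (p + q) p o′
        go zero refl = let b , _ = unpointed-label (proj₂ x-root) in
          subst (_≤ p + q) (ℕ.+-comm p 1) (ℕ.+-monoʳ-≤ p (ℕ.≤-trans (s≤s z≤n) (Fin.toℕ<n b)))
        go (suc zero) refl = let a , _ = r refl (firstElement≡0 o d) in
          ℕ.≤-trans (s≤s z≤n) (Fin.toℕ<n a) , ℕ.m≤m+n p q

    encoded : RootLabel o L → IsCode p q letters labels
    encoded r = record { marks = marks ; nomarks = nomarks ; hits = hits ; root = root r ; defined = defined r }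

    module _ (c : IsCode p q letters labels) where

      private
        module D = Decode letters labels c

      label-encoded : ∀ e → D.label e ≡ label e
      label-encoded e with splitAt-cases k l e
      ... | inj₁ (i , refl) = trans (D.label-↑ˡ i) (cong proj₁ (lookup-letters i))
      ... | inj₂ (j , refl) = trans (D.label-↑ʳ j) (lookup-labels j)

      -- Equal labels give equal equivalence relations. For the points, `fixed⁻` says that the
      -- marked position of a label is an element at which `x` is pointed.
      decode-encode : D.element ≡ x
      decode-encode = value-injective (semiPointed-ext {x = D.partition} {y = value x}
        (λ {i} {j} s → label⇒same (trans (sym (label-encoded i)) (trans (same-build⁻ D.partitionData s) (label-encoded j))))
        (λ {i} {j} s → same-build⁺ D.partitionData (trans (label-encoded i) (trans (same⇒label s) (sym (label-encoded j)))))
        point-eq)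
        where
        point-eq : ∀ e → pointAt D.partition e ≡ pointAt (value x) e
        point-eq e with label e in eq
        ... | inj₁ a = trans (D.pointAt-partition (trans (label-encoded e) eq))
          (let eqₗ , fixed = fixed⁻ (D.lookup-mark a) in
           trans (sym fixed) (pointAt-cong (value x) (label⇒same (trans eqₗ (sym eq)))))
        ... | inj₂ b = trans (D.pointAt-partition (trans (label-encoded e) eq)) (sym (label-unpointed eq))

  -- Permutations relative to the canonical labelling. Unlike labellings, which carry
  -- representatives and functions, they form a type whose elements can be listed and counted.
  Orderings : ∣ P n k o d ∣ → Set
  Orderings x = Perm (pointedBlocks (value x) ∸ toℕ o) × Perm (unpointedBlocks (value x))

  Orderings-finite : ∀ x → Finite (Orderings x)
  Orderings-finite x = ×-finite (Perm-finite _) (Perm-finite _)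

  private
    canonical : ∀ (x : ∣ P n k o d ∣) → Labelling (value x) (pointedBlocks (value x)) (unpointedBlocks (value x))
    canonical x = canonicalLabelling (value x)

    canonical-root : ∀ x → RootLabel o (canonical x)
    canonical-root x refl e≡0 = canonicalLabelling-root (value x) e≡0
      (point-fixed (value x) (trans (proj₂ (oneBlock-⊑⁻ d (firstElement o d) {value x} (∣P∣-⊑ {d = d} x))) (rootPoint-1 e≡0)))

  ordered : ∀ x (αβ : Orderings x) → Labelling (value x) (pointedBlocks (value x)) (unpointedBlocks (value x))
  ordered x (α , β) = relabel o (canonical x) α β

  ordered-root : ∀ x αβ → RootLabel o (ordered x αβ)
  ordered-root x (α , β) = relabel-root o (canonical x) α β (canonical-root x)

  encode : Σ ∣ P n k o d ∣ Orderings → Σ (Index k l o) Codes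
  encode (x , αβ) = fromCode _ _ letters labels (encoded (ordered-root x αβ))
    where open Encode x (ordered x αβ)

  decode : Σ (Index k l o) Codes → ∣ P n k o d ∣
  decode (t , c) = Decode.element (proj₁ (value c)) (proj₂ (value c)) (isCode t c)

  decode-encode : ∀ xαβ → decode (encode xαβ) ≡ proj₁ xαβ
  decode-encode (x , αβ) = let t , c = encode (x , αβ) in Encode.decode-encode x (ordered x αβ) (isCode t c)

  private
    -- Labels are compared as natural numbers, since p and q depend on the index.
    labelℕ : Σ (Index k l o) Codes → Fin n → ℕ ⊎ ℕ
    labelℕ (t , c) i = Sum.map toℕ toℕ (Decode.label (proj₁ (value c)) (proj₂ (value c)) (isCode t c) i)

    toℕ-label-injective : ∀ {p q} {u v : Label p q} → Sum.map toℕ toℕ u ≡ Sum.map toℕ toℕ v → u ≡ v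
    toℕ-label-injective {u = inj₁ a} {inj₁ b} eq = cong inj₁ (Fin.toℕ-injective (Sum.inj₁-injective eq))
    toℕ-label-injective {u = inj₂ a} {inj₂ b} eq = cong inj₂ (Fin.toℕ-injective (Sum.inj₂-injective eq))

    labelℕ-encode : ∀ x αβ i → labelℕ (encode (x , αβ)) i ≡ Sum.map toℕ toℕ (Labelling.label (ordered x αβ) i)
    labelℕ-encode x αβ i = let t , c = encode (x , αβ) in
      cong (Sum.map toℕ toℕ) (Encode.label-encoded x (ordered x αβ) (isCode t c) i)

  private
    orderings-injective : ∀ x αβ αβ′ → encode (x , αβ) ≡ encode (x , αβ′) → αβ ≡ αβ′
    orderings-injective x αβ αβ′ eq = uncurry (cong₂ _,_) (relabel-faithful o (canonical x) λ i → toℕ-label-injective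
      (trans (sym (labelℕ-encode x αβ i)) (trans (cong (λ s → labelℕ s i) eq) (labelℕ-encode x αβ′ i))))

  encode-injective : ∀ {a b} → encode a ≡ encode b → a ≡ b
  encode-injective = Σ-injective encode decode decode-encode orderings-injective

  private
    fromCode-cong : ∀ {p q w w′ g g′} .(c : IsCode p q w g) .(c′ : IsCode p q w′ g′) → w ≡ w′ → g ≡ g′ →
      fromCode p q w g c ≡ fromCode p q w′ g′ c′
    fromCode-cong c c′ refl refl = refl

    -- The block numbers are variables with equations. Matching on these puts `L` over the same
    -- labels as the canonical labelling, where `relabel-full` applies.
    encode-full : ∀ x {p q} (L : Labelling (value x) p q) (r : RootLabel o L) → pointedBlocks (value x) ≡ p → unpointedBlocks (value x) ≡ q →
      ∃[ αβ ] encode (x , αβ) ≡ fromCode p q (Encode.letters x L) (Encode.labels x L) (Encode.encoded x L r)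
    encode-full x L r refl refl =
      let αβ , eq = relabel-full o (canonical x) L (canonical-root x) r (firstElement o d , firstElement≡0 o d) in
      αβ , fromCode-cong (Encode.encoded x (ordered x αβ) (ordered-root x αβ)) (Encode.encoded x L r)
        (Vec.tabulate-cong (λ i → cong (_, _) (eq (i ↑ˡ l)))) (Vec.tabulate-cong (λ j → eq (k ↑ʳ j)))

  -- The labelling that comes with the decoded partition is some ordering of the canonical one, and
  -- it spells the given words again: labels by construction, marks by `D.marked`.
  encode-surjective : ∀ s → ∃[ a ] encode a ≡ s
  encode-surjective (t , c@((w , g) , _)) =
    let αβ , eq = encode-full D.element D.labelling D.labelling-root
                    (labelling-pointed D.partition D.labelling) (labelling-unpointed D.partition D.labelling) in
    (D.element , αβ) , trans eq (trans (fromCode-cong (Encode.encoded D.element D.labelling D.labelling-root) (isCode t c)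
      (trans (Vec.tabulate-cong (λ i → cong₂ _,_ (D.label-↑ˡ i) (D.marked i))) (Vec.tabulate∘lookup w))
      (trans (Vec.tabulate-cong D.label-↑ʳ) (Vec.tabulate∘lookup g))) (fromCode-isCode t c))
    where
    module D = Decode w g (isCode t c)

-- Numbering the blocks of a decoded partition

module _ {A : Set} where

  enumeration-map : ∀ {Q R : A → Set} {m} → (∀ {a} → Q a → R a) → (∀ {a} → R a → Q a) → Enumeration Q m → Enumeration R m
  enumeration-map f g E = record
    { at = at E ; at-∈ = λ i → f (at-∈ E i) ; injective = injective E ; surjective = λ r → surjective E (g r) }

  enumeration-image : ∀ {B : Set} {Q : A → Set} {m} (h : A → B) → (∀ {a b} → h a ≡ h b → a ≡ b) →
    Enumeration Q m → Enumeration (λ b → ∃[ a ] Q a × h a ≡ b) m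
  enumeration-image h inj E = record
    { at         = h ∘ at E
    ; at-∈       = λ i → at E i , at-∈ E i , refl
    ; injective  = λ eq → injective E (inj eq)
    ; surjective = λ (a , q , eq) → let i , eq′ = surjective E q in i , trans (cong h eq′) eq
    }

  enumeration-⊎ : ∀ {Q R : A → Set} {m m′} → (∀ {a} → Q a → R a → ⊥) →
    Enumeration Q m → Enumeration R m′ → Enumeration (λ a → Q a ⊎ R a) (m + m′)
  enumeration-⊎ {Q} {R} {m} {m′} disjoint E E′ = record
    { at         = at⊎ ∘ splitAt m
    ; at-∈       = λ i → ∈⊎ (splitAt m i)
    ; injective  = λ {i} {j} eq → trans (sym (Fin.join-splitAt m m′ i))
                     (trans (cong (join m m′) (inj (splitAt m i) (splitAt m j) eq)) (Fin.join-splitAt m m′ j))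
    ; surjective = λ { (inj₁ q) → let i , eq = surjective E q in
                                  i ↑ˡ m′ , trans (cong at⊎ (Fin.splitAt-↑ˡ m i m′)) eq
                     ; (inj₂ r) → let i , eq = surjective E′ r in
                                  m ↑ʳ i , trans (cong at⊎ (Fin.splitAt-↑ʳ m m′ i)) eq }
    }
    where
    at⊎ : Fin m ⊎ Fin m′ → A
    at⊎ = [ at E , at E′ ]′
    ∈⊎ : ∀ i → Q (at⊎ i) ⊎ R (at⊎ i)
    ∈⊎ (inj₁ i) = inj₁ (at-∈ E i)
    ∈⊎ (inj₂ i) = inj₂ (at-∈ E′ i)
    inj : ∀ i j → at⊎ i ≡ at⊎ j → i ≡ j
    inj (inj₁ i) (inj₁ j) eq = cong inj₁ (injective E eq)
    inj (inj₁ i) (inj₂ j) eq = contradiction (subst R (sym eq) (at-∈ E′ j)) (disjoint (at-∈ E i))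
    inj (inj₂ i) (inj₁ j) eq = contradiction (subst R eq (at-∈ E′ i)) (disjoint (at-∈ E j))
    inj (inj₂ i) (inj₂ j) eq = cong inj₂ (injective E′ eq)

  at-subst : ∀ {Q R : A → Set} {m m′} (eq : m ≡ m′) (E : Enumeration Q m) →
    (∀ e → toℕ e ≡ 0 → R (at E e)) → ∀ e → toℕ e ≡ 0 → R (at (subst (Enumeration Q) eq E) e)
  at-subst refl E h = h

module Profile (k l : ℕ) (o : Fin 2) (d : Defined (k + l) k o) where
  open Coding k l o
  open Bijection k l o d

  private
    n = k + l

  module _ (t : Index k l o) where
    open Index t using (p; q; pointedDefined; unpointedDefined)

    blockDefined : ∀ (u : Label p q) → Defined (ls∘ t u + ks∘ t u) (ks∘ t u) (kind u)
    blockDefined (inj₁ a) = pointedDefined a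
    blockDefined (inj₂ b) = unpointedDefined b

    blockPosets : Label p q → 𝓕
    blockPosets u = P (ls∘ t u + ks∘ t u) (ks∘ t u) (kind u) (blockDefined u)

  module _ (t : Index k l o) (c : Codes t) where
    open Index t using (p; q; rootDefined)

    private
      w : Vec (Letter p q) k
      w = proj₁ (value c)

      g : Vec (Label p q) l
      g = proj₂ (value c)

      module D = Decode w g (isCode t c)

      K M : Label p q → ℕ
      K = ks∘ t
      M = ls∘ t

    private
      letter : Label p q → Bool → ℕ
      letter u b = Letters.count p q (u , b) w

      letters≡K : ∀ u → letter u true + letter u false ≡ K u
      letters≡K u = trans (cong₂ _+_ (proj₁ (profile t c) (u , true)) (proj₁ (profile t c) (u , false))) (letterContent-total t u)

      -- Marked letters are listed before unmarked ones, so the point of a pointed block receives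
      -- number 0. This is the element at which the posets with o = 1 are pointed.
      E± : ∀ u → Enumeration (λ i → lookup w i ≡ (u , true) ⊎ lookup w i ≡ (u , false)) (letter u true + letter u false)
      E± u = enumeration-⊎ (λ eq eq′ → contradiction (trans (sym eq) eq′) λ ())
        (Letters.positions p q w (u , true)) (Letters.positions p q w (u , false))

      marked-or-not : ∀ {u} {c : Letter p q} → proj₁ c ≡ u → c ≡ (u , true) ⊎ c ≡ (u , false)
      marked-or-not {c = u , true}  refl = inj₁ refl
      marked-or-not {c = u , false} refl = inj₂ refl

      E₁ : ∀ u → Enumeration (λ i → proj₁ (lookup w i) ≡ u) (K u)
      E₁ u = enumeration-map [ cong proj₁ , cong proj₁ ]′ marked-or-not (subst (Enumeration _) (letters≡K u) (E± u))

      E₁-first : ∀ a e → toℕ e ≡ 0 → at (E₁ (inj₁ a)) e ≡ D.mark a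
      E₁-first a e e≡0 = D.mark-unique
        (at-subst {R = λ i → lookup w i ≡ (inj₁ a , true)} (letters≡K (inj₁ a)) (E± (inj₁ a)) first e e≡0)
        where
        m = letter (inj₁ a) true
        first : ∀ e → toℕ e ≡ 0 → lookup w (at (E± (inj₁ a)) e) ≡ (inj₁ a , true)
        first e e≡0 = let e<m = subst₂ _<_ (sym e≡0) (sym (IsCode.marks (isCode t c) a)) (s≤s z≤n) in
          trans (cong (λ s → lookup w ([ at (Letters.positions p q w (inj₁ a , true)) , at (Letters.positions p q w (inj₁ a , false)) ]′ s))
            (Fin.splitAt-< m e e<m)) (at-∈ (Letters.positions p q w (inj₁ a , true)) (fromℕ< e<m))

      E₂ : ∀ u → Enumeration (λ j → lookup g j ≡ u) (M u)
      E₂ u = subst (Enumeration _) (proj₁ (proj₂ (profile t c)) u) (Labels.positions p q g u)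

      InV₁ InV₂ : Label p q → Fin n → Set
      InV₁ u e = ∃[ i ] proj₁ (lookup w i) ≡ u × i ↑ˡ l ≡ e
      InV₂ u e = ∃[ j ] lookup g j ≡ u × k ↑ʳ j ≡ e

      disjoint : ∀ {u e} → InV₁ u e → InV₂ u e → ⊥
      disjoint (i , _ , refl) (j , _ , eq) = ℕ.<⇒≱ (join-inj₁-< k l i) (subst (λ e → k ≤ toℕ e) eq (join-inj₂-≥ k l j))

      E : ∀ u → Enumeration (λ e → InV₁ u e ⊎ InV₂ u e) (K u + M u)
      E u = enumeration-⊎ disjoint
        (enumeration-image (_↑ˡ l) (Fin.↑ˡ-injective l _ _) (E₁ u))
        (enumeration-image (k ↑ʳ_) (Fin.↑ʳ-injective k _ _) (E₂ u))

      inside : ∀ {u e} → InV₁ u e ⊎ InV₂ u e → D.label e ≡ u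
      inside (inj₁ (i , eq , refl)) = trans (D.label-↑ˡ i) eq
      inside (inj₂ (j , eq , refl)) = trans (D.label-↑ʳ j) eq

      inside⁻ : ∀ {u e} → D.label e ≡ u → InV₁ u e ⊎ InV₂ u e
      inside⁻ {u} {e} eq with splitAt-cases k l e
      ... | inj₁ (i , refl) = inj₁ (i , trans (sym (D.label-↑ˡ i)) eq , refl)
      ... | inj₂ (j , refl) = inj₂ (j , trans (sym (D.label-↑ʳ j)) eq , refl)

      M+K : ∀ u → M u + K u ≡ K u + M u
      M+K u = ℕ.+-comm (M u) (K u)

      -- `E` lists the V₁ part before the V₂ part and has length `K u + M u`, whereas the poset of
      -- the block has size l + k in the order of the theorem; the cast reconciles the two.
      ι : ∀ u → Fin (M u + K u) → Fin n
      ι u a = at (E u) (cast (M+K u) a)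

      at-split : ∀ u → Fin (K u) ⊎ Fin (M u) → Fin n
      at-split u = [ (λ a → at (E₁ u) a ↑ˡ l) , (λ a → k ↑ʳ at (E₂ u) a) ]′

      ι-inV₁ : ∀ u {a} (a<K : toℕ a < K u) → ι u a ≡ at (E₁ u) (fromℕ< a<K) ↑ˡ l
      ι-inV₁ u {a} a<K = trans (cong (at-split u) (Fin.splitAt-< (K u) (cast (M+K u) a)
          (subst (_< K u) (sym (Fin.toℕ-cast (M+K u) a)) a<K)))
        (cong (λ e → at (E₁ u) e ↑ˡ l) (Fin.toℕ-injective
          (trans (Fin.toℕ-fromℕ< _) (trans (Fin.toℕ-cast (M+K u) a) (sym (Fin.toℕ-fromℕ< a<K))))))

      ι-inV₂ : ∀ u {a} → K u ≤ toℕ a → k ≤ toℕ (ι u a)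
      ι-inV₂ u {a} K≤a = subst (λ s → k ≤ toℕ (at-split u s))
        (sym (Fin.splitAt-≥ (K u) (cast (M+K u) a) (subst (K u ≤_) (sym (Fin.toℕ-cast (M+K u) a)) K≤a))) (join-inj₂-≥ k l _)

      position : ∀ u {e} → D.label e ≡ u → ∃[ a ] ι u a ≡ e
      position u eq = let a , eq′ = surjective (E u) (inside⁻ eq) in
        cast (sym (M+K u)) a , trans (cong (at (E u)) (Fin.cast-involutive (M+K u) (sym (M+K u)) a)) eq′

      ι-injective : ∀ u {a b} → ι u a ≡ ι u b → a ≡ b
      ι-injective u {a} {b} eq = Fin.toℕ-injective (trans (sym (Fin.toℕ-cast (M+K u) a))
        (trans (cong toℕ (injective (E u) eq)) (Fin.toℕ-cast (M+K u) b)))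

      ρ : ∀ u → Fin n → Fin (M u + K u)
      ρ u e with D.label e ≟ᵘ u
      ... | yes eq = proj₁ (position u eq)
      -- A default value; the ground set is inhabited because the poset of the block is defined.
      ... | no  _  = firstElement (kind u) (blockDefined t u)

      ι-ρ : ∀ u {e} → D.label e ≡ u → ι u (ρ u e) ≡ e
      ι-ρ u {e} eq with D.label e ≟ᵘ u
      ... | yes eq′ = proj₂ (position u eq′)
      ... | no  ne  = contradiction eq ne

      label-ι : ∀ u a → D.label (ι u a) ≡ u
      label-ι u a = inside (at-∈ (E u) (cast (M+K u) a))

      frame : ∀ u → Frame k D.label u (M u + K u) (K u)
      frame u = record
        { ι       = ι u
        ; ρ       = ρ u
        ; ρ-ι     = λ a → ι-injective u (ι-ρ u (label-ι u a))
        ; ι-ρ     = ι-ρ u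
        ; label-ι = label-ι u
        ; ι-<     = λ a<K → subst (λ e → toℕ e < k) (sym (ι-inV₁ u a<K)) (join-inj₁-< k l _)
        ; ι-≥     = ι-inV₂ u
        }

      frame-root : ∀ u → Maybe.map (ι u) (rootPoint (M u + K u) (kind u)) ≡ pointAt D.partition (D.rep u)
      frame-root (inj₂ b) = sym (Labelling.rep-unpointed D.labelling b)
      frame-root (inj₁ a) = trans (cong (Maybe.map (ι u)) (rootPoint-1 e≡0)) (trans (cong just ι-root)
        (sym (Labelling.rep-pointed D.labelling a)))
        where
        u : Label p q
        u = inj₁ a
        e : Fin (M u + K u)
        e = firstElement (suc zero) (blockDefined t u)
        e≡0 : toℕ e ≡ 0
        e≡0 = firstElement≡0 (suc zero) (blockDefined t u)
        e<K : toℕ e < K u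
        e<K = subst (_< K u) (sym e≡0) (1≤ks t a)
        ι-root : ι u e ≡ D.mark a ↑ˡ l
        ι-root = trans (ι-inV₁ u e<K) (cong (_↑ˡ l) (E₁-first a (fromℕ< e<K) (trans (Fin.toℕ-fromℕ< e<K) e≡0)))

      -- The block of the root has the first pointed label, and `join` places pointed labels before
      -- unpointed ones, so it becomes the first element of the quotient.
      quotient-root : Maybe.map (Quotient.blk D.labelling) (rootPoint n o) ≡ rootPoint (p + q) o
      quotient-root = go o refl
        where
        go : ∀ o′ → o ≡ o′ → Maybe.map (Quotient.blk D.labelling) (rootPoint n o′) ≡ rootPoint (p + q) o′
        go zero       _    = refl
        go (suc zero) refl = let e≡0 = firstElement≡0 o d
                                 a , eq , a≡0 = D.labelling-root refl e≡0
          in trans (cong (Maybe.map (Quotient.blk D.labelling)) (rootPoint-1 e≡0))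
               (sym (rootPoint-1 (trans (cong (toℕ ∘ join p q) eq) (trans (toℕ-join-inj₁ p q a) a≡0))))

      module I = Poset (P n k o d)

    lower-∼ : interval (P n k o d) I.0̂ (decode (t , c)) (I.minimum (decode (t , c)))
      ∼ (∏ᶠ (blockPosets t ∘ inj₁) ⊠ ∏ᶠ (blockPosets t ∘ inj₂))
    lower-∼ = iso (blocks-≅ {l = l} refl d D.element D.labelling M K (blockDefined t) frame frame-root (sum-ks t) (sum-ls t))

    upper-∼ : interval (P n k o d) (decode (t , c)) I.1̂ (I.maximum (decode (t , c))) ∼ P (p + q) p o rootDefined
    upper-∼ = ∼-sym (iso (quotient-≅ d rootDefined D.element D.labelling quotient-root))

-- Coefficients

fromℕ-+ : ∀ m n → fromℕ (m + n) ≡ fromℕ m ℚ.+ fromℕ n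
fromℕ-+ zero    n = sym (ℚ.+-identityˡ (fromℕ n))
fromℕ-+ (suc m) n = trans (cong (1ℚ ℚ.+_) (fromℕ-+ m n)) (sym (ℚ.+-assoc 1ℚ (fromℕ m) (fromℕ n)))

fromℕ-* : ∀ m n → fromℕ (m ℕ.* n) ≡ fromℕ m ℚ.* fromℕ n
fromℕ-* zero    n = sym (ℚ.*-zeroˡ (fromℕ n))
fromℕ-* (suc m) n = trans (fromℕ-+ n (m ℕ.* n)) (trans
  (cong₂ ℚ._+_ (sym (ℚ.*-identityˡ (fromℕ n))) (fromℕ-* m n)) (sym (ℚ.*-distribʳ-+ (fromℕ n) 1ℚ (fromℕ m))))

toℚᵘ-fromℕ : ∀ m → ℚ.toℚᵘ (fromℕ m) ℚᵘ.≃ mkℚᵘ (ℤ.+ m) 0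
toℚᵘ-fromℕ zero    = ℚᵘ.≃-refl
toℚᵘ-fromℕ (suc m) = ℚᵘ.≃-trans (ℚ.toℚᵘ-homo-+ 1ℚ (fromℕ m))
  (ℚᵘ.≃-trans (ℚᵘ.+-congʳ (ℚ.toℚᵘ 1ℚ) (toℚᵘ-fromℕ m))
    (*≡* (cong (ℤ._* ℤ.+ 1) (cong (ℤ._+_ (ℤ.+ 1)) (ℤ.*-identityʳ (ℤ.+ m))))))

-- Checked among unnormalised fractions, where equality is cross-multiplication.
fromℕ-inverse : ∀ m .{{_ : NonZero m}} → fromℕ m ℚ.* (ℤ.+ 1 ℚ./ m) ≡ 1ℚ
fromℕ-inverse (suc m) = ℚ.toℚᵘ-injective (ℚᵘ.≃-trans (ℚ.toℚᵘ-homo-* (fromℕ (suc m)) (ℤ.+ 1 ℚ./ suc m))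
  (ℚᵘ.≃-trans (ℚᵘ.*-cong (toℚᵘ-fromℕ (suc m)) (ℚ.toℚᵘ-fromℚᵘ (mkℚᵘ (ℤ.+ 1) m)))
    (*≡* (cong ℤ.+_ (trans (ℕ.*-identityʳ _) (trans (ℕ.*-identityʳ _) (sym (trans (ℕ.*-identityˡ _) (ℕ.*-identityˡ _)))))))))

fromℕ-! : ∀ n → fromℕ (n !) ℚ.* 1/ n ! ≡ 1ℚ
fromℕ-! n = fromℕ-inverse (n !) {{n !≢0}}

-- The number of codes of an index

size-Codes₀ : ∀ k l (t : Index k l zero) → let open Coding k l zero; open Index t using (p; q) in
  size (Codes-finite t) ≡ size (Letters.words-finite p q (letterContent (ks∘ t)) k) ℕ.* size (Labels.words-finite p q (ls∘ t) l)
size-Codes₀ k l t = trans (sym (size-bijection (×-finite W G) (Codes-finite t) f f-injective f-surjective)) (size-× W G)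
  where
  open Coding k l zero
  open Index t using (p; q)
  W = Letters.words-finite p q (letterContent (ks∘ t)) k
  G = Labels.words-finite p q (ls∘ t) l
  f : Letters.Words p q (letterContent (ks∘ t)) k × Labels.Words p q (ls∘ t) l → Codes t
  f ((w , [ h ]) , (g , [ h′ ])) = (w , g) , [ h , h′ , (λ ()) ]
  f-injective : ∀ {a b} → f a ≡ f b → a ≡ b
  f-injective {(w , _) , (g , _)} {(w′ , _) , (g′ , _)} eq with cong value eq
  ... | refl = refl
  f-surjective : ∀ c → ∃[ a ] f a ≡ c
  f-surjective ((w , g) , [ h ]) = ((w , [ proj₁ h ]) , (g , [ proj₁ (proj₂ h) ])) , refl

module _ (k l : ℕ) (t : Index (suc k) l (suc zero)) where
  open Coding (suc k) l (suc zero)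
  open Index t using (p; q; rootDefined)

  private
    a₀ : Fin p
    a₀ = fromℕ< (proj₁ rootDefined)

    a₀≡0 : toℕ a₀ ≡ 0
    a₀≡0 = Fin.toℕ-fromℕ< (proj₁ rootDefined)

  rootLetter : Letter p q
  rootLetter = inj₁ a₀ , true

  private
    κ : Letter p q → ℕ
    κ = letterContent (ks∘ t)

    W = Letters.words-finite p q (Letters._⊖_ p q κ rootLetter) k
    G = Labels.words-finite p q (ls∘ t) l

    f : Letters.Words p q (Letters._⊖_ p q κ rootLetter) k × Labels.Words p q (ls∘ t) l → Codes t
    f ((w , [ h ]) , (g , [ h′ ])) = (rootLetter ∷ w , g) ,
      [ Letters.cons-content p q κ rootLetter w (s≤s z≤n) h , h′ , (λ { _ zero _ → a₀≡0 }) ]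

    f-injective : ∀ {a b} → f a ≡ f b → a ≡ b
    f-injective {(w , _) , (g , _)} {(w′ , _) , (g′ , _)} eq with cong value eq
    ... | refl = refl

    f-surjective : ∀ c → ∃[ a ] f a ≡ c
    f-surjective c@((x ∷ w , g) , [ h ]) with rootLetter⁻ {c = x} (proj₂ (proj₂ (profile t c)) refl zero refl)
    ... | a , refl , a≡0 with Fin.toℕ-injective (trans a≡0 (sym a₀≡0))
    ... | refl = ((w , [ Letters.cons-content⁻ p q κ rootLetter w (proj₁ h) ]) , (g , [ proj₁ (proj₂ h) ])) , refl

  -- The first letter is forced, so a code amounts to the rest of the word on V₁, whose content
  -- lacks one root letter, together with the word on V₂.
  size-Codes₁ : size (Codes-finite t) ≡ size W ℕ.* size G
  size-Codes₁ = trans (sym (size-bijection (×-finite W G) (Codes-finite t) f f-injective f-surjective)) (size-× W G)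

module _ (k l : ℕ) (o : Fin 2) (t : Index k l o) where
  open Coding k l o
  open Index t using (p; q)

  weight : ℕ
  weight = Letters.total! p q (letterContent (ks∘ t)) ℕ.* Labels.total! p q (ls∘ t)

  total-letters : Letters.total p q (letterContent (ks∘ t)) ≡ k
  total-letters = trans (sum-letters (letterContent (ks∘ t)) (elements (Label-finite p q)))
    (trans (cong sum (List.map-cong (letterContent-total t) (elements (Label-finite p q)))) (trans (sum-labels p q (ks∘ t)) (sum-ks t)))

  total-labels : Labels.total p q (ls∘ t) ≡ l
  total-labels = trans (sum-labels p q (ls∘ t)) (sum-ls t)

*-interchange : ∀ a b c d → (a ℕ.* b) ℕ.* (c ℕ.* d) ≡ (a ℕ.* c) ℕ.* (b ℕ.* d)
*-interchange = solve 4 (λ a b c d → (a :* b) :* (c :* d) := (a :* c) :* (b :* d)) refl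
  where open +-*-Solver

-- The words on V₁ and V₂ are chosen independently, so two multinomial coefficients multiply;
-- `weight` is the product of their denominators.
size-Codes : ∀ k l o (d : Defined (k + l) k o) (t : Index k l o) →
  size (Coding.Codes-finite k l o t) ℕ.* weight k l o t ≡ (k ∸ toℕ o) ! ℕ.* l !
size-Codes k l zero d t = trans (cong (ℕ._* weight k l zero t) (size-Codes₀ k l t))
  (trans (*-interchange (size (Letters.words-finite p q (letterContent (ks∘ t)) k)) (size (Labels.words-finite p q (ls∘ t) l))
            (Letters.total! p q (letterContent (ks∘ t))) (Labels.total! p q (ls∘ t)))
    (cong₂ ℕ._*_ (Letters.size-words p q k _ (total-letters k l zero t)) (Labels.size-words p q l _ (total-labels k l zero t))))
  where
  open Coding k l zero
  open Index t using (p; q)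
size-Codes (suc k) l (suc zero) d t = trans (cong₂ ℕ._*_ (size-Codes₁ k l t)
    -- The root letter has multiplicity one, so `total!-⊖` says that deleting it leaves the product
    -- of factorials unchanged.
    (cong (ℕ._* Labels.total! p q (ls∘ t)) (sym (trans (sym (ℕ.*-identityˡ _)) (Letters.total!-⊖ p q κ r (s≤s z≤n))))))
  (trans (*-interchange (size (Letters.words-finite p q (Letters._⊖_ p q κ r) k)) (size (Labels.words-finite p q (ls∘ t) l))
            (Letters.total! p q (Letters._⊖_ p q κ r)) (Labels.total! p q (ls∘ t)))
    (cong₂ ℕ._*_ (Letters.size-words p q k _ (ℕ.suc-injective (trans (Letters.total-⊖ p q κ r (s≤s z≤n))
                 (total-letters (suc k) l (suc zero) t))))
               (Labels.size-words p q l _ (total-labels (suc k) l (suc zero) t))))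
  where
  open Coding (suc k) l (suc zero)
  open Index t using (p; q)
  κ = letterContent (ks∘ t)
  r = rootLetter k l t

∏ℚ : ∀ {m} → (Fin m → ℚ) → ℚ
∏ℚ {zero}  r = 1ℚ
∏ℚ {suc m} r = r zero ℚ.* ∏ℚ (r ∘ suc)

∏ℕ : ∀ {m} → (Fin m → ℕ) → ℕ
∏ℕ {zero}  f = 1
∏ℕ {suc m} f = f zero ℕ.* ∏ℕ (f ∘ suc)

inverse-* : ∀ r s m n → fromℕ m ℚ.* r ≡ 1ℚ → fromℕ n ℚ.* s ≡ 1ℚ → fromℕ (m ℕ.* n) ℚ.* (r ℚ.* s) ≡ 1ℚ
inverse-* r s m n eq eq′ = trans (cong (ℚ._* (r ℚ.* s)) (fromℕ-* m n))
  (trans (solve 4 (λ a b c d → (a :* b) :* (c :* d) := (a :* c) :* (b :* d)) refl (fromℕ m) (fromℕ n) r s)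
    (trans (cong₂ ℚ._*_ eq eq′) (ℚ.*-identityˡ 1ℚ)))
  where open Data.Rational.Solver.+-*-Solver

inverse-∏ : ∀ {m} (r : Fin m → ℚ) (f : Fin m → ℕ) → (∀ i → fromℕ (f i) ℚ.* r i ≡ 1ℚ) → fromℕ (∏ℕ f) ℚ.* ∏ℚ r ≡ 1ℚ
inverse-∏ {zero}  r f h = refl
inverse-∏ {suc m} r f h = inverse-* (r zero) (∏ℚ (r ∘ suc)) (f zero) (∏ℕ (f ∘ suc)) (h zero) (inverse-∏ (r ∘ suc) (f ∘ suc) (h ∘ suc))

product-labels : ∀ p q (f : Label p q → ℕ) → product (map f (elements (Label-finite p q))) ≡ ∏ℕ (f ∘ inj₁) ℕ.* ∏ℕ (f ∘ inj₂)
product-labels p q f = trans (cong product (List.map-++ f (map inj₁ (allFin p)) (map inj₂ (allFin q))))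
  (trans (product-++ (map f (map inj₁ (allFin p))) _) (cong₂ ℕ._*_ (part inj₁) (part inj₂)))
  where
  go : ∀ {A : Set} {m} (f : A → ℕ) (g : Fin m → A) → product (map f (List.tabulate g)) ≡ ∏ℕ (f ∘ g)
  go {m = zero}  f g = refl
  go {m = suc m} f g = cong (f (g zero) ℕ.*_) (go f (g ∘ suc))
  part : ∀ {m} (h : Fin m → Label p q) → product (map f (map h (allFin m))) ≡ ∏ℕ (f ∘ h)
  part h = trans (cong product (sym (List.map-∘ {g = f} {f = h} (allFin _)))) (go (f ∘ h) id)

product-letters : ∀ {p q} (f : Letter p q → ℕ) us →
  product (map f (List.cartesianProduct us (true ∷ false ∷ []))) ≡ product (map (λ u → f (u , true) ℕ.* f (u , false)) us)
product-letters f []       = refl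
product-letters f (u ∷ us) = trans (cong (λ s → f (u , true) ℕ.* (f (u , false) ℕ.* s)) (product-letters f us))
  (sym (ℕ.*-assoc (f (u , true)) (f (u , false)) _))

product-map-* : ∀ {A : Set} (f g : A → ℕ) xs → product (map f xs) ℕ.* product (map g xs) ≡ product (map (λ x → f x ℕ.* g x) xs)
product-map-* f g []       = refl
product-map-* f g (x ∷ xs) = trans (*-interchange (f x) (product (map f xs)) (g x) (product (map g xs)))
  (cong (f x ℕ.* g x ℕ.*_) (product-map-* f g xs))

module _ (k l : ℕ) (o : Fin 2) (t : Index k l o) where
  open Coding k l o
  open Index t using (p; q)

  blockWeight : Label p q → ℕ
  blockWeight (inj₁ a) = ls∘ t (inj₁ a) ! ℕ.* (ks∘ t (inj₁ a) ∸ 1) !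
  blockWeight (inj₂ b) = ls∘ t (inj₂ b) ! ℕ.* ks∘ t (inj₂ b) !

  weight-∏ : weight k l o t ≡ ∏ℕ (blockWeight ∘ inj₁) ℕ.* ∏ℕ (blockWeight ∘ inj₂)
  weight-∏ = trans (cong (ℕ._* Labels.total! p q (ls∘ t)) (product-letters (λ c → letterContent (ks∘ t) c !) us))
    (trans (product-map-* (λ u → letterContent (ks∘ t) (u , true) ! ℕ.* letterContent (ks∘ t) (u , false) !) (λ u → ls∘ t u !) us)
      (trans (cong product (List.map-cong eq us)) (product-labels p q blockWeight)))
    where
    us = elements (Label-finite p q)
    eq : ∀ u → letterContent (ks∘ t) (u , true) ! ℕ.* letterContent (ks∘ t) (u , false) ! ℕ.* ls∘ t u ! ≡ blockWeight u
    eq (inj₁ a) = trans (ℕ.*-comm (1 ℕ.* (ks∘ t (inj₁ a) ∸ 1) !) _) (cong (ls∘ t (inj₁ a) ! ℕ.*_) (ℕ.*-identityˡ _))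
    eq (inj₂ b) = trans (ℕ.*-comm (1 ℕ.* ks∘ t (inj₂ b) !) _) (cong (ls∘ t (inj₂ b) ! ℕ.*_) (ℕ.*-identityˡ _))

  -- The trailing `1ℚ` is the coefficient in `cls`, kept so that the factors of the theorem have
  -- these coefficients by computation.
  blockCoefficient : Label p q → ℚ
  blockCoefficient (inj₁ a) = (1/ ls∘ t (inj₁ a) ! ℚ.* 1/ (ks∘ t (inj₁ a) ∸ 1) !) ℚ.* 1ℚ
  blockCoefficient (inj₂ b) = (1/ ls∘ t (inj₂ b) ! ℚ.* 1/ ks∘ t (inj₂ b) !) ℚ.* 1ℚ

  blockCoefficient-inverse : ∀ u → fromℕ (blockWeight u) ℚ.* blockCoefficient u ≡ 1ℚ
  blockCoefficient-inverse (inj₁ a) = trans (cong (fromℕ (blockWeight (inj₁ a)) ℚ.*_) (ℚ.*-identityʳ _))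
    (inverse-* _ _ (ls∘ t (inj₁ a) !) ((ks∘ t (inj₁ a) ∸ 1) !) (fromℕ-! (ls∘ t (inj₁ a))) (fromℕ-! (ks∘ t (inj₁ a) ∸ 1)))
  blockCoefficient-inverse (inj₂ b) = trans (cong (fromℕ (blockWeight (inj₂ b)) ℚ.*_) (ℚ.*-identityʳ _))
    (inverse-* _ _ (ls∘ t (inj₂ b) !) (ks∘ t (inj₂ b) !) (fromℕ-! (ls∘ t (inj₂ b))) (fromℕ-! (ks∘ t (inj₂ b))))

  coefficient : ℚ
  coefficient = ∏ℚ (blockCoefficient ∘ inj₁) ℚ.* ∏ℚ (blockCoefficient ∘ inj₂)

  coefficient-inverse : fromℕ (weight k l o t) ℚ.* coefficient ≡ 1ℚ
  coefficient-inverse = trans (cong (λ m → fromℕ m ℚ.* coefficient) weight-∏)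
    (inverse-* _ _ (∏ℕ (blockWeight ∘ inj₁)) (∏ℕ (blockWeight ∘ inj₂))
      (inverse-∏ (blockCoefficient ∘ inj₁) (blockWeight ∘ inj₁) (blockCoefficient-inverse ∘ inj₁))
      (inverse-∏ (blockCoefficient ∘ inj₂) (blockWeight ∘ inj₂) (blockCoefficient-inverse ∘ inj₂)))

∏-cls : ∀ {m} (r : Fin m → ℚ) (X : Fin m → 𝓕) → ∏ (λ i → (r i , X i) ∷ []) ≡ (∏ℚ r , ∏ᶠ X) ∷ []
∏-cls {zero}  r X = refl
∏-cls {suc m} r X = cong (((r zero , X zero) ∷ []) ·_) (∏-cls (r ∘ suc) (X ∘ suc))

-- The coproduct

module Coproduct (k l : ℕ) (o : Fin 2) (d : Defined (k + l) k o) where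
  open Coding k l o
  open Bijection k l o d
  open Profile k l o d
  open FreeVectorSpace (×-setoid ∼-setoid ∼-setoid) using (≈-refl; ≈-sym; ≈-trans; basis)
  open Sums (×-setoid ∼-setoid ∼-setoid)

  private
    X = P (k + l) k o d
    module X = BoundedBlockPoset ⟦ X ⟧

    c : ℚ
    c = 1/ l ! ℚ.* 1/ (k ∸ toℕ o) !

    orderWeight : ℕ → ℕ → ℚ
    orderWeight p q = 1/ q ! ℚ.* 1/ (p ∸ toℕ o) !

    splitting : ∣ X ∣ → 𝓕 × 𝓕
    splitting x = interval X X.0̂ x (X.minimum x) , interval X x X.1̂ (X.maximum x)

    blocksAndQuotient : Index k l o → 𝓕 × 𝓕
    blocksAndQuotient t = ∏ᶠ (blockPosets t ∘ inj₁) ⊠ ∏ᶠ (blockPosets t ∘ inj₂) ,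
      P (Index.p t + Index.q t) (Index.p t) o (Index.rootDefined t)

    term : ℚ → 𝓕 × 𝓕 → 𝓘⊗𝓘
    term r XY = (r , XY) ∷ []

    codeTerm : Σ (Index k l o) Codes → 𝓘⊗𝓘
    codeTerm (t , _) = term (c ℚ.* orderWeight (Index.p t) (Index.q t)) (blocksAndQuotient t)

    orderWeightOf : ∣ X ∣ → ℚ
    orderWeightOf x = orderWeight (pointedBlocks (value x)) (unpointedBlocks (value x))

    -- An equal share of the term of `x` for each of its orderings; by `scale-order` the shares add
    -- up to the whole term.
    orderedTerm : Σ ∣ X ∣ Orderings → 𝓘⊗𝓘
    orderedTerm (x , _) = term (c ℚ.* orderWeightOf x) (splitting x)

    Δ-expand : Δ (c • cls X) ≡ ∑ X.finite (λ x → term c (splitting x))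
    Δ-expand = trans (List.++-identityʳ _) (trans (List.map-concatMap _ _ (elements X.finite))
      (List.concatMap-cong (λ x → cong (λ r → term r (splitting x)) (coefficient≡c c)) (elements X.finite)))
      where
      coefficient≡c : ∀ c → c ℚ.* 1ℚ ℚ.* (1ℚ ℚ.* 1ℚ) ≡ c
      coefficient≡c c = trans (ℚ.*-identityʳ (c ℚ.* 1ℚ)) (ℚ.*-identityʳ c)

    scale-order : ∀ x → fromℕ (size (Orderings-finite x)) ℚ.* (c ℚ.* orderWeightOf x) ≡ c
    scale-order x = begin
      fromℕ (size (Orderings-finite x)) ℚ.* (c ℚ.* r)
        ≡⟨ cong (λ m → fromℕ m ℚ.* (c ℚ.* r)) (trans (size-× (Perm-finite pb) (Perm-finite ub))
             (cong₂ ℕ._*_ (size-Perm pb) (size-Perm ub))) ⟩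
      fromℕ (pb ! ℕ.* ub !) ℚ.* (c ℚ.* r)
        ≡⟨ solve 4 (λ a b s t → a :* (b :* (t :* s)) := (a :* (s :* t)) :* b) refl (fromℕ (pb ! ℕ.* ub !)) c (1/ pb !) (1/ ub !) ⟩
      fromℕ (pb ! ℕ.* ub !) ℚ.* (1/ pb ! ℚ.* 1/ ub !) ℚ.* c
        ≡⟨ cong (ℚ._* c) (inverse-* _ _ (pb !) (ub !) (fromℕ-! pb) (fromℕ-! ub)) ⟩
      1ℚ ℚ.* c
        ≡⟨ ℚ.*-identityˡ c ⟩
      c ∎
      where
      open ≡-Reasoning
      open Data.Rational.Solver.+-*-Solver
      pb = pointedBlocks (value x) ∸ toℕ o
      ub = unpointedBlocks (value x)
      r = orderWeightOf x

    scale-code : ∀ t → fromℕ (size (Codes-finite t)) ℚ.* (c ℚ.* orderWeight (Index.p t) (Index.q t))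
      ≡ coefficient k l o t ℚ.* (orderWeight (Index.p t) (Index.q t) ℚ.* 1ℚ)
    scale-code t = begin
      S ℚ.* (c ℚ.* r)
        ≡⟨ ℚ.*-identityˡ _ ⟨
      1ℚ ℚ.* (S ℚ.* (c ℚ.* r))
        -- Inserting `D * C`, which equals 1, brings `S` next to `D`; by `size-Codes` their product
        -- is the inverse of `c`, and `C` survives.
        ≡⟨ cong (ℚ._* (S ℚ.* (c ℚ.* r))) (coefficient-inverse k l o t) ⟨
      D ℚ.* C ℚ.* (S ℚ.* (c ℚ.* r))
        ≡⟨ solve 6 (λ D C S a b r → D :* C :* (S :* (b :* a :* r)) := S :* D :* (a :* b) :* (C :* r)) refl
             D C S (1/ (k ∸ toℕ o) !) (1/ l !) r ⟩
      S ℚ.* D ℚ.* (1/ (k ∸ toℕ o) ! ℚ.* 1/ l !) ℚ.* (C ℚ.* r)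
        ≡⟨ cong (λ m → m ℚ.* (1/ (k ∸ toℕ o) ! ℚ.* 1/ l !) ℚ.* (C ℚ.* r))
             (trans (sym (fromℕ-* (size (Codes-finite t)) (weight k l o t))) (cong fromℕ (size-Codes k l o d t))) ⟩
      fromℕ ((k ∸ toℕ o) ! ℕ.* l !) ℚ.* (1/ (k ∸ toℕ o) ! ℚ.* 1/ l !) ℚ.* (C ℚ.* r)
        ≡⟨ cong (ℚ._* (C ℚ.* r)) (inverse-* _ _ ((k ∸ toℕ o) !) (l !) (fromℕ-! (k ∸ toℕ o)) (fromℕ-! l)) ⟩
      1ℚ ℚ.* (C ℚ.* r)
        ≡⟨ trans (ℚ.*-identityˡ _) (cong (C ℚ.*_) (sym (ℚ.*-identityʳ r))) ⟩
      C ℚ.* (r ℚ.* 1ℚ) ∎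
      where
      open ≡-Reasoning
      open Data.Rational.Solver.+-*-Solver
      S = fromℕ (size (Codes-finite t))
      D = fromℕ (weight k l o t)
      C = coefficient k l o t
      r = orderWeight (Index.p t) (Index.q t)

    -- Here the passage to classes is used: the intervals are replaced by products and quotients
    -- under `basis`, with the coefficient untouched.
    splitting-∼ : ∀ s → term (c ℚ.* orderWeight (Index.p (proj₁ s)) (Index.q (proj₁ s))) (splitting (decode s)) ≈⊗ codeTerm s
    splitting-∼ (t , code) = basis _ (lower-∼ t code , upper-∼ t code)

    -- The isomorphisms are available for decoded partitions, hence the transport along
    -- `decode-encode`. Coefficients agree by computation, since the index of a code made by
    -- `encode` stores the block numbers of the partition.
    term-encode : ∀ xαβ → orderedTerm xαβ ≈⊗ codeTerm (encode xαβ)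
    term-encode xαβ = subst
      (λ y → term (c ℚ.* orderWeightOf (proj₁ xαβ)) (splitting y) ≈⊗ codeTerm (encode xαβ)) (decode-encode xαβ) (splitting-∼ (encode xαβ))

  rhsTerm : Index k l o → 𝓘⊗𝓘
  rhsTerm t = let open Index t in
        ( ∏ (λ (i : Fin p) → (1/ ls (i ↑ˡ q) ! ℚ.* 1/ (ks (i ↑ˡ q) ∸ 1) !)
              • cls (P (ls (i ↑ˡ q) + ks (i ↑ˡ q)) (ks (i ↑ˡ q)) (suc zero) (pointedDefined i)))
        · ∏ (λ (i : Fin q) → (1/ ls (p ↑ʳ i) ! ℚ.* 1/ ks (p ↑ʳ i) !)
              • cls (P (ls (p ↑ʳ i) + ks (p ↑ʳ i)) (ks (p ↑ʳ i)) zero (unpointedDefined i))) )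
        ⊗ ((1/ q ! ℚ.* 1/ (p ∸ toℕ o) !) • cls (P (p + q) p o rootDefined))

  private
    rhsTerm-≡ : ∀ t → rhsTerm t ≡ term (coefficient k l o t ℚ.* (orderWeight (Index.p t) (Index.q t) ℚ.* 1ℚ)) (blocksAndQuotient t)
    rhsTerm-≡ t = cong₂ (λ u v → (u · v) ⊗ (orderWeight (Index.p t) (Index.q t) • cls (proj₂ (blocksAndQuotient t))))
      (∏-cls (blockCoefficient k l o t ∘ inj₁) _) (∏-cls (blockCoefficient k l o t ∘ inj₂) _)

  coproduct : Δ (c • cls X) ≈⊗ ∑ (Index-finite k l o) rhsTerm
  coproduct =
    ≈-trans (≡⇒≃ Δ-expand)
    -- Used from right to left: the term of each partition is spread over its orderings.
    (≈-trans (concatMap-cong-≃ (λ x → ≈-sym (≈-trans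
        (concatMap-const _ (splitting x) (elements (Orderings-finite x)))
        (≡⇒≃ (cong (λ r → term r (splitting x)) (scale-order x))))) (elements X.finite))
    (≈-trans (≡⇒≃ (sym (∑-Σ X.finite Orderings-finite orderedTerm)))
    (≈-trans (concatMap-cong-≃ term-encode (elements (Σ-finite X.finite Orderings-finite)))
    (≈-trans (∑-reindex (Σ-finite X.finite Orderings-finite) (Σ-finite (Index-finite k l o) Codes-finite)
        encode encode-injective encode-surjective codeTerm)
    (≈-trans (≡⇒≃ (∑-Σ (Index-finite k l o) Codes-finite codeTerm))
    -- `codeTerm` sees a code only through its index, so each index contributes its term times the
    -- number of its codes.
    (concatMap-cong-≃ (λ t → ≈-trans
        (concatMap-const _ (blocksAndQuotient t) (elements (Codes-finite t)))
        (≡⇒≃ (trans (cong (λ r → term r (blocksAndQuotient t)) (scale-code t)) (sym (rhsTerm-≡ t)))))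
      (elements (Index-finite k l o))))))))

mainTheorem14 : ∀ (k l : ℕ) (o : Fin 2) (d : Defined (k + l) k o) →
    Δ ((1/ l ! * 1/ (k ∸ toℕ o) !) • cls (P (k + l) k o d))
    ≈⊗
    ∑ (Index-finite k l o) (λ t → let open Index t in
    ( ∏ (λ (i : Fin p) → (1/ ls (i ↑ˡ q) ! * 1/ (ks (i ↑ˡ q) ∸ 1) !)
    • cls (P (ls (i ↑ˡ q) + ks (i ↑ˡ q)) (ks (i ↑ˡ q)) (suc zero) (pointedDefined i)))
    · ∏ (λ (i : Fin q) → (1/ ls (p ↑ʳ i) ! * 1/ ks (p ↑ʳ i) !)
    • cls (P (ls (p ↑ʳ i) + ks (p ↑ʳ i)) (ks (p ↑ʳ i)) zero (unpointedDefined i))) )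
    ⊗ ((1/ q ! * 1/ (p ∸ toℕ o) !) • cls (P (p + q) p o rootDefined)))
mainTheorem14 = Coproduct.coproduct
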